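{- For every code $C\subseteq\{0,1\}^r$ and every $\varepsilon\in(0,1)$, one can compute, in randomized $\mathrm{poly}(r,|C|,\varepsilon^{ -1})$ time, an $\varepsilon$-sparsifier $w:[r]\to\mathbb{R}_{\ge0}$ of $C$ with $$|\operatorname{supp}(w)|\le O\left(\varepsilon^{ -2}\,\mathrm{NRD}(C)\cdot(\log|C|)(\log r)\right),$$ where the implied constant is universal.
   Context: A code is any (possibly non-linear) nonempty subset $C\subseteq\{0,1\}^r$. For $c\in C$, $\mathrm{wt}(c)=\sum_{i\in[r]}c_i$. A map $w:[r]\to\mathbb{R}_{\ge0}$ is an $\varepsilon$-sparsifier of $C$ if for every $c\in C$, $(1-\varepsilon)\mathrm{wt}(c)\le\sum_{i\in[r]}w_ic_i\le(1+\varepsilon)\mathrm{wt}(c)$. Non-redundancy: $\mathrm{NRD}(C)$ is the largest integer $k$ such that there exist an index set $I\subseteq[r]$ with $|I|=k$ and codewords $c^{(j)}\in C$, one for each $j\in I$, such that for all $i,j\in I$, $c^{(j)}_i=1$ if $i=j$ and $c^{(j)}_i=0$ if $i\neq j$. $\operatorname{supp}(w)=\{i:w_i\neq0\}$. Convention: in upper bounds $O(\cdot)$, $\log t$ is read as $\max\{1,\log t\}$. A randomized algorithm outputs a correct $w$ with probability at least $2/3$. -}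

module Defs where

open import Data.Bool.Base using (Bool; true; false; if_then_else_; not)
import Data.Bool.Properties as Bool
open import Data.Fin.Base using (Fin; toℕ)
import Data.Fin.Properties as Fin
open import Data.Fin.Subset using (Subset; _∈_; ∣_∣; ⊥)
open import Data.Fin.Subset.Properties using (_∈?_; anySubset?; ∣p∣≤n; ∣⊥∣≡0; ∉⊥)
import Data.Integer.Base as ℤ
open import Data.List.Base using (List; []; _∷_; length; concatMap)
open import Data.List.Relation.Unary.All using (All)
open import Data.List.Relation.Unary.Any using (Any; any?)
open import Data.List.Relation.Unary.Unique.Propositional using (Unique)
open import Data.Nat.Base using (ℕ; zero; suc; _+_; _*_; _∸_; _^_; _≤_; _≡ᵇ_; _⊔_; z≤n)
import Data.Nat.Properties as ℕ
open import Data.Nat.Logarithm using (⌊log₂_⌋)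
open import Data.Product.Base using (∃; _×_; _,_; proj₁)
open import Data.Rational.Base as ℚ using (ℚ; 0ℚ; 1ℚ; ½)
import Data.Rational.Properties as ℚ
open import Data.Vec.Base using (Vec; []; _∷_; lookup; tabulate; toList)
open import Algebra.Properties.CommutativeMonoid.Sum ℚ.+-0-commutativeMonoid using (sum)
open import Function.Base using (_∘_)
open import Relation.Binary.PropositionalEquality.Core using (_≡_; _≢_; refl; sym; subst)
open import Relation.Nullary using (Dec; yes; no; ¬_; contradiction)
open import Relation.Nullary.Decidable using (⌊_⌋; _×-dec_; _→-dec_; ¬?)

------------------------------------------------------------------------
-- Real numbers

2⁻_ : ℕ → ℚ
2⁻ zero  = 1ℚ
2⁻ suc k = ½ ℚ.* 2⁻ k

fromℕ : ℕ → ℚ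
fromℕ n = ℤ.+ n ℚ./ 1

-- A real is a Cauchy sequence of rationals with limit within 2⁻ n of its
-- n-th term.
record ℝ : Set where
  field
    seq     : ℕ → ℚ
    regular : ∀ m n → ℚ.∣ seq m ℚ.- seq n ∣ ℚ.≤ 2⁻ m ℚ.+ 2⁻ n

open ℝ public

-- Real expressions are interpreted by sequences, the operations acting
-- termwise.  On Cauchy sequences (the only ones to which they are applied)
-- these are the operations and the order relations of the real limits.
Seq : Set
Seq = ℕ → ℚ

infix  4 _≤ℝ_ _<ℝ_
infixl 6 _+ℝ_ _-ℝ_
infixl 7 _*ℝ_

const : ℚ → Seq
const q _ = q

_+ℝ_ _-ℝ_ _*ℝ_ : Seq → Seq → Seq
(x +ℝ y) n = x n ℚ.+ y n
(x -ℝ y) n = x n ℚ.- y n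
(x *ℝ y) n = x n ℚ.* y n

_≤ℝ_ _<ℝ_ : Seq → Seq → Set
x ≤ℝ y = ∀ k → ∃ λ N → ∀ n → N ≤ n → x n ℚ.≤ y n ℚ.+ 2⁻ k
x <ℝ y = ∃ λ k → ∃ λ N → ∀ n → N ≤ n → x n ℚ.+ 2⁻ k ℚ.≤ y n

------------------------------------------------------------------------
-- Codes

-- A finite set of words is given by a list of its elements without
-- repetition; the list is also the form in which a program receives it.
record Code (r : ℕ) : Set where
  field
    words    : List (Vec Bool r)
    unique   : Unique words
    nonempty : words ≢ []

open Code public

size : ∀ {r} → Code r → ℕ
size C = length (words C)

bit : Bool → ℕ
bit b = if b then 1 else 0

wt : ∀ {r} → Vec Bool r → ℚ
wt c = sum (λ i → fromℕ (bit (lookup c i)))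

weightedSum : ∀ {r} → (Fin r → ℚ) → Vec Bool r → ℚ
weightedSum w c = sum (λ i → w i ℚ.* fromℕ (bit (lookup c i)))

-- Weights are rational because they are the output of a machine.
record IsSparsifier {r} (ε : ℝ) (C : Code r) (w : Fin r → ℚ) : Set where
  field
    nonneg : ∀ i → 0ℚ ℚ.≤ w i
    lower  : All (λ c → (const 1ℚ -ℝ seq ε) *ℝ const (wt c) ≤ℝ const (weightedSum w c)) (words C)
    upper  : All (λ c → const (weightedSum w c) ≤ℝ (const 1ℚ +ℝ seq ε) *ℝ const (wt c)) (words C)

supp : ∀ {r} → (Fin r → ℚ) → Subset r
supp w = tabulate (λ i → not ⌊ w i ℚ.≟ 0ℚ ⌋)

------------------------------------------------------------------------
-- Non-redundancy

NonRedundant : ∀ {r} → Code r → Subset r → Set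
NonRedundant C I = ∀ j → j ∈ I →
  Any (λ c → lookup c j ≡ true × (∀ i → i ∈ I → i ≢ j → lookup c i ≡ false)) (words C)

NonRedundantOfSize : ∀ {r} → Code r → ℕ → Set
NonRedundantOfSize C k = ∃ λ I → ∣ I ∣ ≡ k × NonRedundant C I

IsLargest : (ℕ → Set) → ℕ → Set
IsLargest P k = P k × (∀ l → P l → l ≤ k)

largest : (P : ℕ → Set) → (∀ k → Dec (P k)) → P 0 →
          ∀ n → (∀ l → P l → l ≤ n) → ∃ (IsLargest P)
largest P P? p₀ zero    bound = 0 , p₀ , bound
largest P P? p₀ (suc n) bound with P? (suc n)
... | yes p = suc n , p , bound
... | no ¬p = largest P P? p₀ n
  (λ l pl → ℕ.≤-pred (ℕ.≤∧≢⇒< (bound l pl) (λ { refl → ¬p pl })))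

nonRedundantOfSize? : ∀ {r} (C : Code r) k → Dec (NonRedundantOfSize C k)
nonRedundantOfSize? C k = anySubset? λ I →
  (∣ I ∣ ℕ.≟ k) ×-dec
  Fin.all? λ j → (j ∈? I) →-dec
    any? (λ c → (lookup c j Bool.≟ true) ×-dec
      Fin.all? λ i → (i ∈? I) →-dec (¬? (i Fin.≟ j) →-dec (lookup c i Bool.≟ false)))
      (words C)

NRD-exists : ∀ {r} (C : Code r) → ∃ (IsLargest (NonRedundantOfSize C))
NRD-exists {r} C = largest (NonRedundantOfSize C) (nonRedundantOfSize? C)
  (⊥ , ∣⊥∣≡0 r , λ j j∈⊥ → contradiction j∈⊥ ∉⊥)
  r (λ { l (I , refl , _) → ∣p∣≤n I })

NRD : ∀ {r} → Code r → ℕ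
NRD C = proj₁ (NRD-exists C)

-- Since log₁ t ≤ max {1 , log₂ t}, upper bounds written with log₁ imply the
-- same upper bounds with the real logarithm.
log₁ : ℕ → ℕ
log₁ t = 1 ⊔ ⌊log₂ t ⌋

-- |supp w| ≤ K · ε⁻² · NRD(C) · log |C| · log r, multiplied through by ε².
SmallSupport : ∀ {r} → ℕ → ℝ → Code r → (Fin r → ℚ) → Set
SmallSupport {r} K ε C w =
  const (fromℕ ∣ supp w ∣) *ℝ (seq ε *ℝ seq ε)
    ≤ℝ const (fromℕ (K * (NRD C * (log₁ (size C) * log₁ r))))

------------------------------------------------------------------------
-- Randomized random access machines

-- Structured RAM programs over registers and an addressable memory, both
-- holding natural numbers.  Since + is the only operation that makes numbers
-- longer than they were (by at most one bit), apart from `approx`, which is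
-- charged for the length of its answer, the running time defined below is polynomially related
-- to that of a (probabilistic) Turing machine.
Reg : Set
Reg = ℕ

infixr 5 _⨾_

data Program : Set where
  skip     : Program
  set      : Reg → ℕ → Program            -- x ≔ n
  add      : Reg → Reg → Reg → Program    -- x ≔ y + z
  sub      : Reg → Reg → Reg → Program    -- x ≔ y ∸ z
  load     : Reg → Reg → Program          -- x ≔ mem[y]
  store    : Reg → Reg → Program          -- mem[x] ≔ y
  flip     : Reg → Program                -- x ≔ fair coin
  approx   : Reg → Reg → Program          -- x ≔ ε to y binary digits
  _⨾_      : Program → Program → Program
  ifZero   : Reg → Program → Program → Program
  whilePos : Reg → Program → Program

record State : Set where
  constructor state
  field
    reg   : ℕ → ℕ
    mem   : ℕ → ℕ
    coins : List Bool

open State public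

infixl 8 _[_≔_]

_[_≔_] : (ℕ → ℕ) → ℕ → ℕ → ℕ → ℕ
(f [ a ≔ v ]) b = if a ≡ᵇ b then v else f b

-- How a program accesses a real number: asked for precision k, it receives
-- max {0 , ⌊2ᵏ · εₖ⌋}.  For ε ≥ 0 the answer is within 2 of 2ᵏ · ε.
digits : ℝ → ℕ → ℕ
digits ε k = ℤ.∣ ℤ.0ℤ ℤ.⊔ ℚ.floor (fromℕ (2 ^ k) ℚ.* seq ε k) ∣

-- Run ε P s t s′ : started in s, P halts in s′ after time t.
data Run (ε : ℝ) : Program → State → ℕ → State → Set where
  skip : ∀ {s} → Run ε skip s 1 s
  set : ∀ {x n ρ μ cs} →
    Run ε (set x n) (state ρ μ cs) 1 (state (ρ [ x ≔ n ]) μ cs)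
  add : ∀ {x y z ρ μ cs} →
    Run ε (add x y z) (state ρ μ cs) 1 (state (ρ [ x ≔ ρ y + ρ z ]) μ cs)
  sub : ∀ {x y z ρ μ cs} →
    Run ε (sub x y z) (state ρ μ cs) 1 (state (ρ [ x ≔ ρ y ∸ ρ z ]) μ cs)
  load : ∀ {x y ρ μ cs} →
    Run ε (load x y) (state ρ μ cs) 1 (state (ρ [ x ≔ μ (ρ y) ]) μ cs)
  store : ∀ {x y ρ μ cs} →
    Run ε (store x y) (state ρ μ cs) 1 (state ρ (μ [ ρ x ≔ ρ y ]) cs)
  flip : ∀ {x ρ μ b cs} →
    Run ε (flip x) (state ρ μ (b ∷ cs)) 1 (state (ρ [ x ≔ bit b ]) μ cs)
  approx : ∀ {x y ρ μ cs} →
    Run ε (approx x y) (state ρ μ cs) (suc (ρ y)) (state (ρ [ x ≔ digits ε (ρ y) ]) μ cs)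
  then : ∀ {P Q s s′ s″ t t′} →
    Run ε P s t s′ → Run ε Q s′ t′ s″ → Run ε (P ⨾ Q) s (t + t′) s″
  ifZero-yes : ∀ {x P Q s s′ t} → reg s x ≡ 0 →
    Run ε P s t s′ → Run ε (ifZero x P Q) s (suc t) s′
  ifZero-no : ∀ {x P Q s s′ t} → reg s x ≢ 0 →
    Run ε Q s t s′ → Run ε (ifZero x P Q) s (suc t) s′
  while-stop : ∀ {x P s} → reg s x ≡ 0 →
    Run ε (whilePos x P) s 1 s
  while-step : ∀ {x P s s′ s″ t t′} → reg s x ≢ 0 →
    Run ε P s t s′ → Run ε (whilePos x P) s′ t′ s″ →
    Run ε (whilePos x P) s (suc (t + t′)) s″

nth : List Bool → ℕ → ℕ
nth []       _       = 0
nth (b ∷ bs) zero    = bit b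
nth (b ∷ bs) (suc a) = nth bs a

-- Register 0 holds r, register 1 holds |C|, and the i-th bit of the j-th word
-- is at address j * r + i; all other cells are 0.
initial : ∀ {r} → Code r → List Bool → State
initial {r} C = state ((λ _ → 0) [ 0 ≔ r ] [ 1 ≔ size C ]) (nth (concatMap toList (words C)))

-- The weight of i is the fraction with numerator at address 2i and
-- denominator one more than the number at address 2i + 1.
output : ∀ {r} → State → Fin r → ℚ
output s i = ℤ.+ mem s (2 * toℕ i) ℚ./ suc (mem s (suc (2 * toℕ i)))

-- Number of elements of an event in the uniform space {0,1}ᵐ.
count : ∀ m → (Vec Bool m → Bool) → ℕ
count zero    A = bit (A [])
count (suc m) A = count m (A ∘ (false ∷_)) + count m (A ∘ (true ∷_))

-- P halts on every sequence of coin flips, always in time satisfying InTime,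
-- and with probability at least 2/3 its output satisfies Correct.  Here m is
-- any number of coins sufficient for all runs (a run with too few is stuck),
-- so the distribution of the output does not depend on m.  The event A makes
-- the probability meaningful without deciding Correct.
Computes : ∀ {r} → Program → Code r → ℝ →
           (InTime : ℕ → Set) (Correct : (Fin r → ℚ) → Set) → Set
Computes P C ε InTime Correct =
  ∃ λ m → ∃ λ (A : Vec Bool m → Bool) →
    2 * 2 ^ m ≤ 3 * count m A ×
    (∀ ω → ∃ λ t → ∃ λ s →
      Run ε P (initial C (toList ω)) t s ×
      InTime t ×
      (A ω ≡ true → Correct (output s)))

-- t ≤ a · (r + |C| + ⌈1/ε⌉)ᵉ, with n ranging over the upper bounds of 1/ε.
PolyTime : ∀ {r} → ℕ → ℕ → Code r → ℝ → ℕ → Set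
PolyTime {r} a e C ε t =
  ∀ n → const 1ℚ ≤ℝ const (fromℕ n) *ℝ seq ε → t ≤ a * (r + size C + n) ^ e

{-# OPTIONS --safe #-}

-- Let mᵢ be the least weight of a codeword containing i.  A minimal subfamily
-- of the codewords of weight at most τ with the same union has a private
-- coordinate for each member; hence #{i : mᵢ ≤ τ} ≤ τ · NRD(C), and
-- Σ 1/mᵢ = O(NRD(C) · log r).  The algorithm gives i the weight 2^tᵢ with
-- probability 2^-tᵢ ≈ log |C| / (ε² mᵢ) and 0 otherwise, by flipping tᵢ coins,
-- so the expected support is as small as claimed and Markov's inequality
-- applies.  The accuracy is a Chernoff bound for each codeword and a union
-- bound.  To stay within rational numbers and integer exponents, the
-- exponential is b^(D·w) with b = 1 + 1/q, q ≈ wt(c) / log |C| and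
-- D = 2^k ≈ 1/ε: if D (D + 1) 2^tᵢ ≤ q, the mean of b^(D wᵢ) is at most
-- b^(D+1) and that of b^(-D wᵢ) at most b^-(D-1).

module Submission where

-- The parameters come from an error budget. For a word c, the moments carry the exponent D + 1 or D
-- - 1 instead of D, an error of one part in D; a tail of probability 2^-L, with L = 4 + ℓ and |C|
-- <= 2^ℓ, costs a further q L <= wt(c), another part in D. So 2/D <= ε is needed, and k is chosen
-- with 2 <= 2^k ε <= 12: the left bound serves accuracy, the right one support and running time.
-- Taking mᵢ to be a least weight makes the condition on tᵢ hold for all words through i at once,
-- since mᵢ <= wt(c). For words lighter than 2 D² L the condition may fail even without coins, but
-- all their coordinates have tᵢ = 0, so their sum is exact. The 2|C| tails total at most 1/8, and
-- Markov's inequality at six times the mean support adds at most 1/6, together less than 1/3.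
-- Exactly tᵢ coins are spent on i whatever they show, so the sample space is a product of blocks of
-- known lengths and expectations are finite sums over coin lists.

open import Defs
open import Data.Nat.Base using (ℕ)
open import Data.Product.Base using (∃-syntax; _×_)
open import Data.Rational.Base using (0ℚ; 1ℚ)

-- Total-correctness logic with time bounds for the machine

module HoareLogic where

  open import Data.Bool.Base using (true; false; if_then_else_; T)
  open import Data.List.Base using (List; []; _∷_)
  open import Data.Nat.Base
  open import Data.Nat.Properties
  open import Data.Product.Base using (∃; _×_; _,_)
  open import Data.Unit.Base using (⊤; tt)
  open import Data.Empty using (⊥)
  open import Relation.Binary.PropositionalEquality
  open import Relation.Nullary using (yes; no)

  -- A Hoare triple at one start state: preconditions are ordinary hypotheses about `s`, and
  -- termination, time and postcondition travel together.
  record Terminates (ε : ℝ) (P : Program) (s : State) (T : ℕ) (Q : State → Set) : Set where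
    constructor terminates
    field
      {time}  : ℕ
      {final} : State
      run     : Run ε P s time final
      bound   : time ≤ T
      post    : Q final

  -- Straight-line code is interpreted by a function, so that its final state and the frame
  -- conditions on it reduce by computation. The last clause serves `skip` and is a dummy for the
  -- commands excluded by `LoopFree`.
  exec : Program → State → State
  exec (set x n)      s = state (reg s [ x ≔ n ]) (mem s) (coins s)
  exec (add x y z)    s = state (reg s [ x ≔ reg s y + reg s z ]) (mem s) (coins s)
  exec (sub x y z)    s = state (reg s [ x ≔ reg s y ∸ reg s z ]) (mem s) (coins s)
  exec (load x y)     s = state (reg s [ x ≔ mem s (reg s y) ]) (mem s) (coins s)
  exec (store x y)    s = state (reg s) (mem s [ reg s x ≔ reg s y ]) (coins s)
  exec (P ⨾ Q)        s = exec Q (exec P s)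
  exec (ifZero x P Q) s = if reg s x ≡ᵇ 0 then exec P s else exec Q s
  exec _              s = s

  cost : Program → ℕ
  cost (P ⨾ Q)        = cost P + cost Q
  cost (ifZero x P Q) = suc (cost P ⊔ cost Q)
  cost _              = 1

  LoopFree : Program → Set
  LoopFree skip           = ⊤
  LoopFree (set _ _)      = ⊤
  LoopFree (add _ _ _)    = ⊤
  LoopFree (sub _ _ _)    = ⊤
  LoopFree (load _ _)     = ⊤
  LoopFree (store _ _)    = ⊤
  LoopFree (flip _)       = ⊥
  LoopFree (approx _ _)   = ⊥
  LoopFree (P ⨾ Q)        = LoopFree P × LoopFree Q
  LoopFree (ifZero _ P Q) = LoopFree P × LoopFree Q
  LoopFree (whilePos _ _) = ⊥

  module _ {ε : ℝ} where

    exec-run : ∀ P → LoopFree P → ∀ s → ∃ λ t → t ≤ cost P × Run ε P s t (exec P s)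
    exec-run skip        _ s = 1 , ≤-refl , skip
    exec-run (set _ _)   _ s = 1 , ≤-refl , set
    exec-run (add _ _ _) _ s = 1 , ≤-refl , add
    exec-run (sub _ _ _) _ s = 1 , ≤-refl , sub
    exec-run (load _ _)  _ s = 1 , ≤-refl , load
    exec-run (store _ _) _ s = 1 , ≤-refl , store
    exec-run (P ⨾ Q) (p , q) s
      with exec-run P p s | exec-run Q q (exec P s)
    ... | t , t≤ , R | t′ , t′≤ , R′ = t + t′ , +-mono-≤ t≤ t′≤ , then R R′
    exec-run (ifZero x P Q) (p , q) s with reg s x in eq
    ... | zero  with exec-run P p s
    ...   | t , t≤ , R = suc t , s≤s (≤-trans t≤ (m≤m⊔n _ _)) , ifZero-yes eq R
    exec-run (ifZero x P Q) (p , q) s | suc _ with exec-run Q q s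
    ...   | t , t≤ , R = suc t , s≤s (≤-trans t≤ (m≤n⊔m _ _)) , ifZero-no (λ z → 1+n≢0 (trans (sym eq) z)) R

    loopFree : ∀ P {_ : LoopFree P} {s} {Q : State → Set} → Q (exec P s) → Terminates ε P s (cost P) Q
    loopFree P {p} {s} q with exec-run P p s
    ... | t , t≤ , R = terminates R t≤ q

    infixr 5 _⨟_ _▸_

    _⨟_ : ∀ {P P′ s T T′ R Q} → Terminates ε P s T R → (∀ {s′} → R s′ → Terminates ε P′ s′ T′ Q) →
          Terminates ε (P ⨾ P′) s (T + T′) Q
    _⨟_ (terminates S t≤ r) f with f r
    ... | terminates S′ t′≤ q = terminates (then S S′) (+-mono-≤ t≤ t′≤) q

    _▸_ : ∀ P {P′} {_ : LoopFree P} {s T Q} → Terminates ε P′ (exec P s) T Q →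
          Terminates ε (P ⨾ P′) s (cost P + T) Q
    _▸_ P {_} {p} t = loopFree P {p} t ⨟ λ t → t

    branch : ∀ {x P P′ s T T′ Q} → (reg s x ≡ 0 → Terminates ε P s T Q) →
             (reg s x ≢ 0 → Terminates ε P′ s T′ Q) → Terminates ε (ifZero x P P′) s (suc (T ⊔ T′)) Q
    branch {x} {s = s} f g with reg s x ≟ 0
    ... | yes p with f p
    ...   | terminates R t≤ q = terminates (ifZero-yes p R) (s≤s (≤-trans t≤ (m≤m⊔n _ _))) q
    branch f g | no p with g p
    ...   | terminates R t≤ q = terminates (ifZero-no p R) (s≤s (≤-trans t≤ (m≤n⊔m _ _))) q

    weaken : ∀ {P s T T′} {Q Q′ : State → Set} → T ≤ T′ → (∀ {s} → Q s → Q′ s) →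
             Terminates ε P s T Q → Terminates ε P s T′ Q′
    weaken T≤ f (terminates R t≤ q) = terminates R (≤-trans t≤ T≤) (f q)

    -- The invariant is indexed by the number of remaining iterations, which no register need hold;
    -- `countdown` is the case where the guard holds it.
    while : ∀ {x P T} (I : ℕ → State → Set) →
      (∀ {s} → I 0 s → reg s x ≡ 0) →
      (∀ {n s} → I (suc n) s → reg s x ≢ 0 × Terminates ε P s T (I n)) →
      ∀ n {s} → I n s → Terminates ε (whilePos x P) s (suc (n * suc T)) (I 0)
    while I stop step zero    i = terminates (while-stop (stop i)) (s≤s z≤n) i
    while {T = T} I stop step (suc n) i with step i
    ... | ≢0 , terminates R t≤ i′ with while I stop step n i′
    ...   | terminates R′ t′≤ q = terminates (while-step ≢0 R R′)
              (s≤s (≤-trans (+-mono-≤ t≤ t′≤) (≤-reflexive (+-suc T (n * suc T))))) q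

    countdown : ∀ {x P T} (I : ℕ → State → Set) →
      (∀ {n s} → I n s → reg s x ≡ n) →
      (∀ {n s} → I (suc n) s → Terminates ε P s T (I n)) →
      ∀ n {s} → I n s → Terminates ε (whilePos x P) s (suc (n * suc T)) (I 0)
    countdown I counter step = while I counter (λ i → (λ z → 1+n≢0 (trans (sym (counter i)) z)) , step i)

  -- With the low registers in one list a frame condition is a single equation: writes to registers
  -- from `k` on preserve `regs k` by reduction, and dropping a prefix passes to a smaller frame.
  -- `reg-value` reads one register back, its range check being settled by evaluation.
  regs : ℕ → (ℕ → ℕ) → List ℕ
  regs zero    ρ = []
  regs (suc k) ρ = ρ k ∷ regs k ρ

  value : ℕ → List ℕ → ℕ → ℕ
  value zero    _        x = 0
  value (suc k) []       x = 0
  value (suc k) (v ∷ vs) x = if x ≡ᵇ k then v else value k vs x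

  reg-value : ∀ {k ρ vs} x {_ : T (x <ᵇ k)} → regs k ρ ≡ vs → ρ x ≡ value k vs x
  reg-value {k} {ρ} x {p} refl = go k x (<ᵇ⇒< x k p)
    where
    go : ∀ k x → x < k → ρ x ≡ value k (regs k ρ) x
    go (suc k) x x<k with x ≡ᵇ k in eq
    ... | true  = cong ρ (≡ᵇ⇒≡ x k (subst T (sym eq) tt))
    ... | false = go k x (≤∧≢⇒< (≤-pred x<k) (λ x≡k → subst T eq (≡⇒≡ᵇ x k x≡k)))

  flip-run : ∀ {ε x P s b cs T} {Q : State → Set} → coins s ≡ b ∷ cs →
    Terminates ε P (state (reg s [ x ≔ bit b ]) (mem s) cs) T Q → Terminates ε (flip x ⨾ P) s (suc T) Q
  flip-run {s = state ρ μ cs} refl t = terminates {time = 1} flip ≤-refl t ⨟ λ t → t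

-- Computing the least weight of a word through each coordinate

module MinimumWeights where

  open HoareLogic
  open import Data.Bool.Base using (Bool; true; false; if_then_else_; T)

  open import Data.List.Base as List using (List; []; _∷_; length; concatMap; _++_; drop)

  open import Data.Vec.Base using (Vec; []; _∷_; toList)
  open import Data.Vec.Properties using (length-toList)
  open import Data.Nat.Base
  open import Data.Nat.Properties
  open import Data.Product.Base using (_,_; proj₁; proj₂)
  open import Data.Unit.Base using (tt)
  open import Data.Empty using (⊥-elim)
  open import Relation.Binary.PropositionalEquality
  open import Relation.Nullary

  ∑< : ℕ → (ℕ → ℕ) → ℕ
  ∑< zero    f = 0
  ∑< (suc n) f = f n + ∑< n f

  bitAt : ∀ {r} → Vec Bool r → ℕ → ℕ
  bitAt c = nth (toList c)

  weight : ∀ {r} → Vec Bool r → ℕ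
  weight {r} c = ∑< r (bitAt c)

  -- `m ∸ (m ∸ u)` is the minimum of `m` and `u`, in the form in which the machine can compute it.
  lighter : ℕ → ℕ → ℕ → ℕ
  lighter b u m = if b ≡ᵇ 0 then m else m ∸ (m ∸ u)

  lightest : ∀ {r} → ℕ → List (Vec Bool r) → ℕ → ℕ
  lightest m []       i = m
  lightest m (c ∷ ws) i = lightest (lighter (bitAt c i) (weight c) m) ws i

  nth-++ˡ : ∀ xs {ys i} → i < length xs → nth (xs ++ ys) i ≡ nth xs i
  nth-++ˡ (x ∷ xs) {i = zero}  _ = refl
  nth-++ˡ (x ∷ xs) {i = suc i} (s≤s p) = nth-++ˡ xs p

  nth-++ʳ : ∀ xs {ys} i → nth (xs ++ ys) (length xs + i) ≡ nth ys i
  nth-++ʳ []       i = refl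
  nth-++ʳ (x ∷ xs) i = nth-++ʳ xs i

  -- Registers: 0 holds r, 1 holds |C|, 2 the constant 1, 3 the precision k,
  -- 4 the power 4^(k+1), 5 the threshold V, 6 is never written, 7 is the current
  -- coordinate; 8 and above are scratch.  The least weights are stored at
  -- addresses |C| r + 2 r + i, beyond both the input and the output.
  weigh scan column columns : Program
  weigh =
    sub 12 12 2 ⨾
    add 14 10 12 ⨾
    load 14 14 ⨾
    add 13 13 14

  scan =
    (sub 11 11 2 ⨾ set 13 0 ⨾ add 12 0 6) ⨾
    whilePos 12 weigh ⨾
    (load 14 8 ⨾ add 8 8 0 ⨾ add 10 10 0) ⨾
    ifZero 14 skip (sub 14 9 13 ⨾ sub 9 9 14)

  column =
    (sub 7 7 2 ⨾ add 8 7 6 ⨾ add 9 0 2 ⨾ set 10 0 ⨾ add 11 1 6) ⨾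
    whilePos 11 scan ⨾
    (add 8 8 0 ⨾ add 8 8 0 ⨾ store 8 9)

  columns = add 7 0 6 ⨾ whilePos 7 column

  record Frame (k : ℕ) (s s′ : State) : Set where
    constructor framed
    field
      reg≡   : regs k (reg s′) ≡ regs k (reg s)
      mem≡   : mem s′ ≡ mem s
      coins≡ : coins s′ ≡ coins s
  open Frame using (reg≡; mem≡)

  at : ∀ {k s s′} x {_ : T (x <ᵇ k)} → Frame k s s′ → reg s′ x ≡ value k (regs k (reg s)) x
  at x {p} f = reg-value x {p} (reg≡ f)

  module _ {r : ℕ} where

    record Weighing (c : Vec Bool r) (s₀ : State) (x : ℕ) (s : State) : Set where
      field
        frame   : Frame 12 s₀ s
        counter : reg s 12 ≡ x
        total   : reg s 13 + ∑< x (bitAt c) ≡ weight c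
        small   : x ≤ r

    weigh-step : ∀ {ε c s₀ x s} → reg s₀ 2 ≡ 1 →
      (∀ i → i < r → mem s₀ (reg s₀ 10 + i) ≡ bitAt c i) →
      Weighing c s₀ (suc x) s → Terminates ε weigh s 4 (Weighing c s₀ x)
    weigh-step {ε} {c} {s₀} {x} {s} one word I = loopFree weigh record
      { frame   = framed (reg≡ frame) (mem≡ frame) (Frame.coins≡ frame)
      ; counter = counter′
      ; total   = begin
          (reg s 13 + mem s (reg s 10 + (reg s 12 ∸ reg s 2))) + ∑< x (bitAt c)
            ≡⟨ cong (λ z → (reg s 13 + z) + ∑< x (bitAt c)) bit≡ ⟩
          (reg s 13 + bitAt c x) + ∑< x (bitAt c)
            ≡⟨ +-assoc (reg s 13) _ _ ⟩
          reg s 13 + ∑< (suc x) (bitAt c)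
            ≡⟨ total ⟩
          weight c ∎
      ; small   = <⇒≤ small
      }
      where
      open Weighing I
      open ≡-Reasoning
      counter′ : reg s 12 ∸ reg s 2 ≡ x
      counter′ = cong₂ _∸_ counter (trans (at 2 frame) one)
      bit≡ : mem s (reg s 10 + (reg s 12 ∸ reg s 2)) ≡ bitAt c x
      bit≡ = trans (cong (λ μ → μ (reg s 10 + (reg s 12 ∸ reg s 2))) (mem≡ frame))
        (trans (cong (mem s₀) (cong₂ _+_ (at 10 frame) counter′)) (word x small))

    -- The machine cannot multiply, so bit i of each word is reached by adding r per word: register
    -- 10 points at the start of the next word and register 8 at its bit i. At the last iteration
    -- `end` turns register 10 into `N * r`, from which the slots are measured.
    record Scanning (i : ℕ) (N : ℕ) (result : ℕ) (s₀ : State) (j : ℕ) (s : State) : Set where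
      field
        frame   : Frame 8 s₀ s
        counter : reg s 11 ≡ j
        rest    : List (Vec Bool r)
        rest-length : length rest ≡ j
        contents : ∀ o → o < j * r → mem s₀ (reg s 10 + o) ≡ nth (concatMap toList rest) o
        bitAddress : reg s 8 ≡ i + reg s 10
        end     : reg s 10 + j * r ≡ N * r
        minimum : lightest (reg s 9) rest i ≡ result

    scan-step : ∀ {ε i N result s₀ j s} → i < r → reg s₀ 0 ≡ r → reg s₀ 2 ≡ 1 → reg s₀ 6 ≡ 0 →
      Scanning i N result s₀ (suc j) s →
      Terminates ε scan s (3 + (suc (r * 5) + (3 + 3))) (Scanning i N result s₀ j)
    scan-step {ε} {i} {N} {result} {s₀} {j} {s} i<r hr one zer
      record { frame = frame ; counter = counter ; rest = c ∷ rest ; rest-length = len ; contents = contents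
             ; bitAddress = bitAddress ; end = end ; minimum = minimum } =
      _ ▸ countdown (Weighing c s₁) Weighing.counter (weigh-step (trans (at 2 frame) one) word) r
            record { frame = framed refl refl refl
                   ; counter = trans (cong₂ _+_ r≡ (trans (at 6 frame) zer)) (+-identityʳ r)
                   ; total = refl ; small = ≤-refl }
        ⨟ after
      where
      open ≡-Reasoning
      s₁ = exec (sub 11 11 2 ⨾ set 13 0 ⨾ add 12 0 6) s
      r≡ : reg s 0 ≡ r
      r≡ = trans (at 0 frame) hr
      contents′ : ∀ o → o < suc j * r → mem s₀ (reg s 10 + o) ≡ nth (toList c ++ concatMap toList rest) o
      contents′ = contents
      word : ∀ i → i < r → mem s (reg s 10 + i) ≡ bitAt c i
      word i i<r = begin
        mem s (reg s 10 + i)  ≡⟨ cong (λ μ → μ (reg s 10 + i)) (mem≡ frame) ⟩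
        mem s₀ (reg s 10 + i) ≡⟨ contents′ i (≤-trans i<r (m≤m+n r (j * r))) ⟩
        nth (toList c ++ concatMap toList rest) i ≡⟨ nth-++ˡ (toList c) (subst (i <_) (sym (length-toList c)) i<r) ⟩
        bitAt c i ∎
      after : ∀ {s₂} → Weighing c s₁ 0 s₂ → Terminates ε _ s₂ (3 + 3) (Scanning i N result s₀ j)
      after {s₂} W = _ ▸ branch
        (λ z → loopFree skip (done refl refl refl refl
          (trans m≡ (cong (λ b → if b ≡ᵇ 0 then reg s 9 else reg s 9 ∸ (reg s 9 ∸ weight c)) (trans (sym z) bit≡)))))
        (λ z → loopFree (sub 14 9 13 ⨾ sub 9 9 14) (done refl refl refl refl
          (trans (cong₂ (λ m u → m ∸ (m ∸ u)) m≡ u≡) (nonzero z))))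
        where
        open Weighing W using (total) renaming (frame to frame₂)
        frame₃ : Frame 8 s₀ s₂
        frame₃ = framed (trans (cong (List.drop 4) (reg≡ frame₂)) (reg≡ frame))
                 (trans (mem≡ frame₂) (mem≡ frame)) (trans (Frame.coins≡ frame₂) (Frame.coins≡ frame))
        m≡ : reg s₂ 9 ≡ reg s 9
        m≡ = at 9 frame₂
        u≡ : reg s₂ 13 ≡ weight c
        u≡ = trans (sym (+-identityʳ _)) total
        bit≡ : mem s₂ (reg s₂ 8) ≡ bitAt c i
        bit≡ = begin
          mem s₂ (reg s₂ 8)     ≡⟨ cong₂ (λ μ a → μ a) (mem≡ frame₂) (at 8 frame₂) ⟩
          mem s (reg s 8)       ≡⟨ cong (mem s) (trans bitAddress (+-comm i _)) ⟩
          mem s (reg s 10 + i)  ≡⟨ word i i<r ⟩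
          bitAt c i             ∎
        nonzero : mem s₂ (reg s₂ 8) ≢ 0 →
          reg s 9 ∸ (reg s 9 ∸ weight c) ≡ lighter (bitAt c i) (weight c) (reg s 9)
        nonzero z with bitAt c i | bit≡
        ... | zero  | e = ⊥-elim (z e)
        ... | suc _ | _ = refl
        done : ∀ {s₄} → regs 8 (reg s₄) ≡ regs 8 (reg s₂) → (mem s₄ , coins s₄) ≡ (mem s₂ , coins s₂) →
          (reg s₄ 8 , reg s₄ 10) ≡ (reg s₂ 8 + reg s₂ 0 , reg s₂ 10 + reg s₂ 0) → reg s₄ 11 ≡ reg s₂ 11 →
          reg s₄ 9 ≡ lighter (bitAt c i) (weight c) (reg s 9) → Scanning i N result s₀ j s₄
        done {s₄} e₀ e₁ e₂ e₃ e₄ = record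
          { frame = framed (trans e₀ (reg≡ frame₃)) (trans (cong proj₁ e₁) (mem≡ frame₃)) (trans (cong proj₂ e₁) (Frame.coins≡ frame₃))
          ; counter = trans e₃ (trans (at 11 frame₂) (cong₂ _∸_ counter (trans (at 2 frame) one)))
          ; rest = rest
          ; rest-length = suc-injective len
          ; contents = λ o o< → begin
              mem s₀ (reg s₄ 10 + o) ≡⟨ cong (λ a → mem s₀ (a + o)) base ⟩
              mem s₀ ((reg s 10 + r) + o) ≡⟨ cong (mem s₀) (+-assoc (reg s 10) r o) ⟩
              mem s₀ (reg s 10 + (r + o)) ≡⟨ contents′ (r + o) (+-monoʳ-< r o<) ⟩
              nth (toList c ++ concatMap toList rest) (r + o)
                ≡⟨ cong (λ l → nth (toList c ++ concatMap toList rest) (l + o)) (sym (length-toList c)) ⟩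
              nth (toList c ++ concatMap toList rest) (length (toList c) + o)
                ≡⟨ nth-++ʳ (toList c) o ⟩
              nth (concatMap toList rest) o ∎
          ; bitAddress = begin
              reg s₄ 8 ≡⟨ cong proj₁ e₂ ⟩
              reg s₂ 8 + reg s₂ 0 ≡⟨ cong₂ _+_ (trans (at 8 frame₂) bitAddress) r≡₂ ⟩
              (i + reg s 10) + r ≡⟨ +-assoc i _ r ⟩
              i + (reg s 10 + r) ≡⟨ cong (i +_) base ⟨
              i + reg s₄ 10 ∎
          ; end = begin
              reg s₄ 10 + j * r ≡⟨ cong (_+ j * r) base ⟩
              (reg s 10 + r) + j * r ≡⟨ +-assoc (reg s 10) r _ ⟩
              reg s 10 + suc j * r ≡⟨ end ⟩
              N * r ∎
          ; minimum = trans (cong (λ m → lightest m rest i) e₄) minimum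
          }
          where
          r≡₂ : reg s₂ 0 ≡ r
          r≡₂ = trans (at 0 frame₃) hr
          base : reg s₄ 10 ≡ reg s 10 + r
          base = trans (cong proj₂ e₂) (cong₂ _+_ (at 10 frame₂) r≡₂)

  ≔-at : ∀ f a {v b} → b ≡ a → (f [ a ≔ v ]) b ≡ v
  ≔-at f a refl with a ≡ᵇ a in eq
  ... | true  = refl
  ... | false = ⊥-elim (subst T eq (≡⇒≡ᵇ a a refl))

  ≔-other : ∀ f a {v b} → b ≢ a → (f [ a ≔ v ]) b ≡ f b
  ≔-other f a {b = b} b≢a with a ≡ᵇ b in eq
  ... | true  = ⊥-elim (b≢a (sym (≡ᵇ⇒≡ a b (subst T (sym eq) tt))))
  ... | false = refl

  scan-cost : ℕ → ℕ
  scan-cost r = 3 + (suc (r * 5) + (3 + 3))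

  column-cost : ℕ → ℕ → ℕ
  column-cost r N = 5 + (suc (N * suc (scan-cost r)) + 3)

  module _ {r : ℕ} (words : List (Vec Bool r)) where

    private
      N : ℕ
      N = length words

    input : ℕ → ℕ
    input = nth (concatMap toList words)

    slot : ℕ → ℕ
    slot i = i + N * r + r + r

    -- The start value `suc r` exceeds every weight, so it survives exactly at the coordinates that
    -- no word contains.
    minWeight : ℕ → ℕ
    minWeight i = lightest (suc r) words i

    -- The field `base` outlives the loop: at `n` zero, register 8 tells `samples` where the table
    -- of least weights begins.
    record Columns (s₀ : State) (n : ℕ) (s : State) : Set where
      field
        low-regs  : regs 7 (reg s) ≡ regs 7 (reg s₀)
        coins≡    : coins s ≡ coins s₀
        counter   : reg s 7 ≡ n
        n≤r       : n ≤ r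
        unchanged : ∀ a → a < N * r → mem s a ≡ input a
        stored    : ∀ i → n ≤ i → i < r → mem s (slot i) ≡ minWeight i
        base      : n < r → reg s 8 ≡ slot n

    module _ {ε : ℝ} {s₀ : State} (hr : reg s₀ 0 ≡ r) (hN : reg s₀ 1 ≡ N) (one : reg s₀ 2 ≡ 1) (zer : reg s₀ 6 ≡ 0) where

      column-step : ∀ {n s} → Columns s₀ (suc n) s → Terminates ε column s (column-cost r N) (Columns s₀ n)
      column-step {n} {s} I = _ ▸ countdown (Scanning n N (minWeight n) s₁) Scanning.counter
          (scan-step n≤r (at-s 0 hr) (at-s 2 one) (at-s 6 zer)) N start
        ⨟ λ S → loopFree (add 8 8 0 ⨾ add 8 8 0 ⨾ store 8 9) (finish S)
        where
        open Columns I
        open ≡-Reasoning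
        s₁ = exec (sub 7 7 2 ⨾ add 8 7 6 ⨾ add 9 0 2 ⨾ set 10 0 ⨾ add 11 1 6) s
        at-s : ∀ x {_ : T (x <ᵇ 7)} {v} → value 7 (regs 7 (reg s₀)) x ≡ v → reg s x ≡ v
        at-s x {p} = trans (reg-value {ρ = reg s} x {p} low-regs)
        n≡ : reg s 7 ∸ reg s 2 ≡ n
        n≡ = cong₂ _∸_ counter (at-s 2 one)
        start : Scanning n N (minWeight n) s₁ N s₁
        start = record
          { frame = framed refl refl refl
          ; counter = trans (cong₂ _+_ (at-s 1 hN) (at-s 6 zer)) (+-identityʳ N)
          ; rest = words
          ; rest-length = refl
          ; contents = unchanged
          ; bitAddress = cong₂ _+_ n≡ (at-s 6 zer)
          ; end = refl
          ; minimum = cong (λ m → lightest m words n) (trans (cong₂ _+_ (at-s 0 hr) (at-s 2 one)) (+-comm r 1))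
          }
        finish : ∀ {s₂} → Scanning n N (minWeight n) s₁ 0 s₂ →
          Columns s₀ n (exec (add 8 8 0 ⨾ add 8 8 0 ⨾ store 8 9) s₂)
        finish {s₂} record { frame = frame ; rest = [] ; bitAddress = bitAddress ; end = end ; minimum = minimum } = record
          { low-regs = trans (cong (List.drop 1) (reg≡ frame)) low-regs
          ; coins≡ = trans (Frame.coins≡ frame) coins≡
          ; counter = trans (at 7 frame) n≡
          ; n≤r = <⇒≤ n≤r
          ; unchanged = λ a a< → trans (≔-other (mem s₂) _ (λ e → <-irrefl refl (<-≤-trans a<
              (≤-trans (≤-trans (m≤n+m (N * r) n) (≤-trans (m≤m+n _ r) (m≤m+n _ r))) (≤-reflexive (trans (sym address) (sym e)))))))
              (trans (cong (λ μ → μ a) (mem≡ frame)) (unchanged a a<))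
          ; stored = stored′
          ; base = λ _ → address
          }
          where
          r≡ : reg s₂ 0 ≡ r
          r≡ = trans (at 0 frame) (at-s 0 hr)
          address : reg s₂ 8 + reg s₂ 0 + reg s₂ 0 ≡ slot n
          address = cong₂ _+_ (cong₂ _+_ (trans bitAddress (cong (n +_) (trans (sym (+-identityʳ _)) end))) r≡) r≡
          stored′ : ∀ i → n ≤ i → i < r →
            (mem s₂ [ reg s₂ 8 + reg s₂ 0 + reg s₂ 0 ≔ reg s₂ 9 ]) (slot i) ≡ minWeight i
          stored′ i n≤i i<r with n ≟ i
          ... | yes refl = trans (≔-at (mem s₂) _ (sym address)) minimum
          ... | no n≢i   = trans (≔-other (mem s₂) _ (λ e → n≢i (sym
                  (+-cancelʳ-≡ (N * r) i n (+-cancelʳ-≡ r _ _ (+-cancelʳ-≡ r _ _ (trans e address)))))))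
                (trans (cong (λ μ → μ (slot i)) (mem≡ frame)) (stored i (≤∧≢⇒< n≤i n≢i) i<r))

      columns-run : ∀ {s} → regs 7 (reg s) ≡ regs 7 (reg s₀) → coins s ≡ coins s₀ →
        (∀ a → a < N * r → mem s a ≡ input a) →
        Terminates ε columns s (1 + suc (r * suc (column-cost r N))) (Columns s₀ 0)
      columns-run {s} e ec inp = _ ▸ countdown (Columns s₀) Columns.counter column-step r record
        { low-regs = e ; coins≡ = ec
        ; counter = trans (cong₂ _+_ (trans (reg-value {ρ = reg s} 0 e) hr) (trans (reg-value {ρ = reg s} 6 e) zer)) (+-identityʳ r)
        ; n≤r = ≤-refl ; unchanged = inp
        ; stored = λ i r≤i i<r → ⊥-elim (<-irrefl refl (<-≤-trans i<r r≤i))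
        ; base = λ r<r → ⊥-elim (<-irrefl refl r<r)
        }

-- Sampling the weights by doubling or nothing

module CoinTossing where

  open HoareLogic
  open MinimumWeights
  open import Data.Bool.Base using (Bool; true; false; if_then_else_; T)

  open import Data.List.Base as List using (List; []; _∷_; length; _++_; take; drop)
  open import Data.List.Properties using (length-drop; length-take; take++drop≡id)
  open import Data.Vec.Base using (Vec; []; _∷_)

  open import Data.Nat.Base
  open import Data.Nat.Properties
  open import Data.Product.Base using (_×_; _,_; proj₁; proj₂)
  open import Data.Unit.Base using (tt)
  open import Data.Empty using (⊥-elim)
  open import Relation.Binary.PropositionalEquality
  open import Relation.Nullary
  open Frame using (reg≡; mem≡)

  -- A failure sends the weight to 0, but the remaining coins are still consumed: the number of
  -- coins read does not depend on what they show.
  toss : ℕ → List Bool → ℕ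
  toss w []       = w
  toss w (b ∷ bs) = toss (if b then w + w else 0) bs

  tossing sample samples : Program
  tossing = flip 13 ⨾ ifZero 13 (set 10 0) (add 10 10 10) ⨾ add 11 11 11 ⨾ sub 12 9 11

  sample =
    (sub 7 7 2 ⨾ add 9 8 7 ⨾ load 9 9 ⨾ sub 10 9 0 ⨾ sub 10 2 10 ⨾ add 9 9 2 ⨾
     add 11 5 6 ⨾ sub 12 9 11) ⨾
    whilePos 12 tossing ⨾
    (add 13 7 7 ⨾ store 13 10 ⨾ add 13 13 2 ⨾ store 13 6)

  samples = add 7 0 6 ⨾ whilePos 7 sample

  -- Describes the loop that doubles V until it exceeds m: it runs exactly `n` times. For positive
  -- `n` the two fields confine m to V 2^(n-1) <= m < V 2^n, so rounding to a power of two loses at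
  -- most a factor 2.
  record Doublings (V m n : ℕ) : Set where
    field
      above : m < V * 2 ^ n
      below : ∀ {j} → j < n → V * 2 ^ j ≤ m

  doublings-suc : ∀ {V m n} → Doublings V m (suc n) → Doublings (V + V) m n
  doublings-suc {V} {m} {n} d = record
    { above = subst (m <_) (shift n) above
    ; below = λ {j} j<n → subst (_≤ m) (shift j) (below (s≤s j<n)) }
    where
    open Doublings d
    shift : ∀ j → V * 2 ^ suc j ≡ (V + V) * 2 ^ j
    shift j = trans (sym (*-assoc V 2 (2 ^ j))) (cong (_* 2 ^ j) (trans (*-comm V 2) (cong (V +_) (+-identityʳ V))))

  -- Register 9 holds `suc m` rather than m, so that the guard `suc m ∸ V` is positive exactly when
  -- V <= m. The number `n` of remaining tosses is known to the proof only.
  record Tossing (m w : ℕ) (later : List Bool) (s₀ : State) (n : ℕ) (s : State) : Set where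
    field
      low-regs : regs 9 (reg s) ≡ regs 9 (reg s₀)
      memory   : mem s ≡ mem s₀
      V        : ℕ
      now      : List Bool
      m≡       : reg s 9 ≡ suc m
      V≡       : reg s 11 ≡ V
      guard≡   : reg s 12 ≡ suc m ∸ V
      doublings : Doublings V m n
      coins≡   : coins s ≡ now ++ later
      length≡  : length now ≡ n
      toss≡    : toss (reg s 10) now ≡ w

  toss-step : ∀ {ε m w later s₀ n s} → Tossing m w later s₀ (suc n) s →
    reg s 12 ≢ 0 × Terminates ε tossing s 5 (Tossing m w later s₀ n)
  toss-step {ε} {m} {w} {later} {s₀} {n} {s} record { low-regs = low ; memory = memory ; V = V ; now = b ∷ now ; m≡ = m≡ ; V≡ = V≡ ; guard≡ = guard≡
    ; doublings = d ; coins≡ = coins≡ ; length≡ = length≡ ; toss≡ = toss≡ } =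
    (λ z → <-irrefl (trans (sym z) guard≡) (m<n⇒0<n∸m (s≤s V≤m))) , flip-run coins≡ (next b toss≡)
    where
    V≤m : V ≤ m
    V≤m = subst (_≤ m) (*-identityʳ V) (Doublings.below d (s≤s z≤n))
    next : ∀ b → toss (if b then reg s 10 + reg s 10 else 0) now ≡ w →
      Terminates ε (ifZero 13 (set 10 0) (add 10 10 10) ⨾ add 11 11 11 ⨾ sub 12 9 11)
        (state (reg s [ 13 ≔ bit b ]) (mem s) (now ++ later)) 4 (Tossing m w later s₀ n)
    next true  e = loopFree _ record
      { low-regs = low ; memory = memory ; V = V + V ; now = now ; m≡ = m≡ ; V≡ = cong₂ _+_ V≡ V≡
      ; guard≡ = cong₂ _∸_ m≡ (cong₂ _+_ V≡ V≡) ; doublings = doublings-suc d ; coins≡ = refl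
      ; length≡ = suc-injective length≡ ; toss≡ = e }
    next false e = loopFree _ record
      { low-regs = low ; memory = memory ; V = V + V ; now = now ; m≡ = m≡ ; V≡ = cong₂ _+_ V≡ V≡
      ; guard≡ = cong₂ _∸_ m≡ (cong₂ _+_ V≡ V≡) ; doublings = doublings-suc d ; coins≡ = refl
      ; length≡ = suc-injective length≡ ; toss≡ = e }

  toss-run : ∀ {ε m w later s₀ n s} → Tossing m w later s₀ n s →
    Terminates ε (whilePos 12 tossing) s (suc (n * 6)) (Tossing m w later s₀ 0)
  toss-run {ε} {m} {w} {later} {s₀} {n} = while (Tossing m w later s₀)
    (λ I → let open Tossing I in trans guard≡ (m≤n⇒m∸n≡0 (subst (m <_) (*-identityʳ V) (Doublings.above doublings))))
    toss-step n

  module Sampler (t w₀ : ℕ → ℕ) where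

    need : ℕ → ℕ
    need zero    = 0
    need (suc n) = t n + need n

    -- Coordinates are served from the highest down, so the coins of coordinate `n` precede those of
    -- all smaller ones.
    sampled : ℕ → List Bool → ℕ → ℕ
    sampled zero    cs i = 0
    sampled (suc n) cs i =
      if i ≡ᵇ n then toss (w₀ n) (take (t n) cs) else sampled n (drop (t n) cs) i

    length-drop-need : ∀ n {cs : List Bool} → length cs ≡ need (suc n) → length (drop (t n) cs) ≡ need n
    length-drop-need n {cs} e = trans (length-drop (t n) cs) (trans (cong (_∸ t n) e) (m+n∸m≡n (t n) (need n)))

    length-take-need : ∀ n {cs : List Bool} → length cs ≡ need (suc n) → length (take (t n) cs) ≡ t n
    length-take-need n {cs} e = trans (length-take (t n) cs) (trans (cong (t n ⊓_) e) (m≤n⇒m⊓n≡m (m≤m+n (t n) (need n))))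

  ≡ᵇ-refl : ∀ n → (n ≡ᵇ n) ≡ true
  ≡ᵇ-refl zero    = refl
  ≡ᵇ-refl (suc n) = ≡ᵇ-refl n

  ≢⇒≡ᵇ-false : ∀ {m n} → m ≢ n → (m ≡ᵇ n) ≡ false
  ≢⇒≡ᵇ-false {m} {n} m≢n with m ≡ᵇ n in eq
  ... | true  = ⊥-elim (m≢n (≡ᵇ⇒≡ m n (subst T (sym eq) tt)))
  ... | false = refl

  sample-cost : ℕ → ℕ
  sample-cost tmax = 8 + (suc (tmax * 6) + 4)

  module _ {r : ℕ} (words : List (Vec Bool r)) {V : ℕ} (t : ℕ → ℕ) (tmax : ℕ)
    (t≤tmax : ∀ {i} → i < r → t i ≤ tmax)
    (t-doublings : ∀ {i} → i < r → Doublings V (minWeight words i) (t i)) where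

    -- The initial weight is 1, but 0 when `minWeight` is the marker `suc r`: coordinates in no word
    -- must stay out of the support, since NRD(C) does not bound their number.
    open Sampler t (λ i → 1 ∸ (minWeight words i ∸ r))

    module _ {ε : ℝ} {s₀ : State} (hr : reg s₀ 0 ≡ r) (one : reg s₀ 2 ≡ 1) (hV : reg s₀ 5 ≡ V) (zer : reg s₀ 6 ≡ 0)
      (ω : List Bool) where

      -- The output may overwrite the input, which is no longer read, but it stays below 2r and
      -- hence below every slot; this keeps `pending` true. `future` says that the unread coins give
      -- the remaining coordinates the values prescribed by the whole list.
      record Sampling (n : ℕ) (s : State) : Set where
        field
          low-regs : regs 7 (reg s) ≡ regs 7 (reg s₀)
          counter  : reg s 7 ≡ n
          n≤r      : n ≤ r
          base     : 0 < r → reg s 8 ≡ slot words 0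
          pending  : ∀ {i} → i < n → mem s (slot words i) ≡ minWeight words i
          enough   : length (coins s) ≡ need n
          future   : ∀ {i} → i < n → sampled n (coins s) i ≡ sampled r ω i
          written  : ∀ {i} → n ≤ i → i < r → mem s (i + i) ≡ sampled r ω i × mem s (i + i + 1) ≡ 0

      sample-step : ∀ {n s} → Sampling (suc n) s → Terminates ε sample s (sample-cost tmax) (Sampling n)
      sample-step {n} {s} I = weaken
          (+-monoʳ-≤ 8 (+-monoˡ-≤ 4 (s≤s (*-monoˡ-≤ 6 (t≤tmax n≤r))))) (λ q → q)
          (_ ▸ toss-run start ⨟ λ S → loopFree (add 13 7 7 ⨾ store 13 10 ⨾ add 13 13 2 ⨾ store 13 6) (finish S))
        where
        open Sampling I
        open ≡-Reasoning
        s₁ = exec (sub 7 7 2 ⨾ add 9 8 7 ⨾ load 9 9 ⨾ sub 10 9 0 ⨾ sub 10 2 10 ⨾ add 9 9 2 ⨾ add 11 5 6 ⨾ sub 12 9 11) s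
        now later : List Bool
        now = take (t n) (coins s)
        later = drop (t n) (coins s)
        w : ℕ
        w = toss (1 ∸ (minWeight words n ∸ r)) now
        at-s : ∀ x {_ : T (x <ᵇ 7)} {v} → value 7 (regs 7 (reg s₀)) x ≡ v → reg s x ≡ v
        at-s x {p} = trans (reg-value {ρ = reg s} x {p} low-regs)
        n≡ : reg s 7 ∸ reg s 2 ≡ n
        n≡ = cong₂ _∸_ counter (at-s 2 one)
        slot≡ : slot words 0 + n ≡ slot words n
        slot≡ = trans (+-comm _ n) (trans (sym (+-assoc n _ r)) (cong (_+ r) (sym (+-assoc n _ r))))
        loaded : mem s (reg s 8 + (reg s 7 ∸ reg s 2)) ≡ minWeight words n
        loaded = trans (cong (mem s) (trans (cong₂ _+_ (base (≤-trans (s≤s z≤n) n≤r)) n≡) slot≡)) (pending ≤-refl)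
        m≡ : reg s₁ 9 ≡ suc (minWeight words n)
        m≡ = trans (cong₂ _+_ loaded (at-s 2 one)) (+-comm _ 1)
        V≡ : reg s₁ 11 ≡ V
        V≡ = trans (cong₂ _+_ (at-s 5 hV) (at-s 6 zer)) (+-identityʳ V)
        start : Tossing (minWeight words n) w later s₁ (t n) s₁
        start = record
          { low-regs = refl ; memory = refl ; V = V ; now = now
          ; m≡ = m≡ ; V≡ = V≡ ; guard≡ = cong₂ _∸_ m≡ V≡
          ; doublings = t-doublings n≤r
          ; coins≡ = sym (take++drop≡id (t n) (coins s))
          ; length≡ = length-take-need n enough
          ; toss≡ = cong (λ w → toss w now) (cong₂ _∸_ (at-s 2 one) (cong₂ _∸_ loaded (at-s 0 hr)))
          }
        finish : ∀ {s₂} → Tossing (minWeight words n) w later s₁ 0 s₂ →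
          Sampling n (exec (add 13 7 7 ⨾ store 13 10 ⨾ add 13 13 2 ⨾ store 13 6) s₂)
        finish {s₂} record { low-regs = low ; memory = memory ; now = [] ; coins≡ = coins≡ ; toss≡ = toss≡ } = record
          { low-regs = trans (cong (List.drop 2) low) low-regs
          ; counter  = n≡₂
          ; n≤r      = <⇒≤ n≤r
          ; base     = λ 0<r → trans (reg-value {ρ = reg s₂} 8 low) (base 0<r)
          ; pending  = λ {i} i<n → trans (elsewhere
              (λ e → <-irrefl (sym e) (low-address i (m≤m+n (n + n) 1)))
              (λ e → <-irrefl (sym e) (low-address i ≤-refl)))
              (pending (m<n⇒m<1+n i<n))
          ; enough   = trans (cong length coins≡) (length-drop-need n enough)
          ; future   = λ {i} i<n → trans (cong (λ cs → sampled n cs i) coins≡)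
              (trans (sym (cong (λ b → if b then w else sampled n later i) (≢⇒≡ᵇ-false (<⇒≢ i<n)))) (future (m<n⇒m<1+n i<n)))
          ; written  = written′
          }
          where
          n≡₂ : reg s₂ 7 ≡ n
          n≡₂ = trans (reg-value {ρ = reg s₂} 7 low) n≡
          a≡ : reg s₂ 7 + reg s₂ 7 ≡ n + n
          a≡ = cong₂ _+_ n≡₂ n≡₂
          a′≡ : reg s₂ 7 + reg s₂ 7 + reg s₂ 2 ≡ n + n + 1
          a′≡ = cong₂ _+_ a≡ (trans (reg-value {ρ = reg s₂} 2 low) (at-s 2 one))
          μ₁ : ℕ → ℕ
          μ₁ = mem s₂ [ reg s₂ 7 + reg s₂ 7 ≔ reg s₂ 10 ]
          elsewhere : ∀ {a} → a ≢ n + n → a ≢ n + n + 1 →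
            (μ₁ [ reg s₂ 7 + reg s₂ 7 + reg s₂ 2 ≔ reg s₂ 6 ]) a ≡ mem s a
          elsewhere {a} ≢₁ ≢₂ = trans (≔-other μ₁ _ (λ e → ≢₂ (trans e a′≡)))
            (trans (≔-other (mem s₂) _ (λ e → ≢₁ (trans e a≡))) (cong (λ μ → μ a) memory))
          double-suc : ∀ k → suc (k + k + 1) ≡ suc k + suc k
          double-suc k = cong suc (trans (+-comm _ 1) (sym (+-suc k k)))
          low-address : ∀ i {j} → j ≤ n + n + 1 → j < slot words i
          low-address i j≤ = ≤-trans (s≤s j≤) (≤-trans (≤-reflexive (double-suc n))
            (≤-trans (+-mono-≤ n≤r n≤r) (≤-trans (m≤n+m (r + r) (i + List.length words * r))
              (≤-reflexive (sym (+-assoc (i + List.length words * r) r r))))))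
          above : ∀ {i} → n < i → n + n + 1 < i + i
          above n<i = ≤-trans (≤-reflexive (double-suc n)) (+-mono-≤ n<i n<i)
          written′ : ∀ {i} → n ≤ i → i < r →
            (μ₁ [ reg s₂ 7 + reg s₂ 7 + reg s₂ 2 ≔ reg s₂ 6 ]) (i + i) ≡ sampled r ω i ×
            (μ₁ [ reg s₂ 7 + reg s₂ 7 + reg s₂ 2 ≔ reg s₂ 6 ]) (i + i + 1) ≡ 0
          written′ {i} n≤i i<r with n ≟ i
          ... | yes refl = trans (≔-other μ₁ _ (λ e → <-irrefl (trans e a′≡) (≤-reflexive (+-comm 1 (n + n)))))
                  (trans (≔-at (mem s₂) _ (sym a≡)) (trans toss≡
                    (trans (sym (cong (λ b → if b then w else sampled n later n) (≡ᵇ-refl n))) (future ≤-refl)))) ,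
                trans (≔-at μ₁ _ (sym a′≡)) (trans (reg-value {ρ = reg s₂} 6 low) (at-s 6 zer))
          ... | no n≢i = trans (elsewhere (λ e → <-irrefl (sym e) (≤-trans (s≤s (m≤m+n _ 1)) n<<i))
                                          (λ e → <-irrefl (sym e) n<<i)) (proj₁ old) ,
                         trans (elsewhere (λ e → <-irrefl (sym e) (≤-trans (s≤s (m≤m+n _ 1)) n<<i′))
                                          (λ e → <-irrefl (sym e) n<<i′)) (proj₂ old)
            where
            n<i = ≤∧≢⇒< n≤i n≢i
            n<<i = above n<i
            n<<i′ : n + n + 1 < i + i + 1
            n<<i′ = ≤-trans n<<i (m≤m+n _ 1)
            old = written n<i i<r

-- The complete program and its run

module Algorithm where

  open HoareLogic
  open MinimumWeights
  open CoinTossing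
  open import Data.Bool.Base using (Bool; T)
  open import Data.List.Base as List using (List; []; _∷_; length; drop)
  open import Data.Vec.Base using ([]; _∷_)
  open import Data.Nat.Base
  open import Data.Nat.Properties
  open import Data.Product.Base using (∃; _×_; _,_; proj₁; proj₂)

  open import Data.Empty using (⊥-elim)
  open import Relation.Binary.PropositionalEquality
  open import Relation.Nullary
  open import Function.Base using (case_of_)
  open import Data.Sum.Base using (inj₁; inj₂)

  -- Multiplication is avoided throughout: 4^(k+1) is updated by two doublings per precision tried,
  -- and (4 + ℓ) 4^(k+1) by one addition per doubling of the power of two that is compared with |C|.
  precision doubling program : Program
  precision =
    (set 2 1 ⨾ set 15 4 ⨾ set 4 4) ⨾ approx 9 3 ⨾ sub 9 15 9 ⨾
    whilePos 9 ((add 3 3 2 ⨾ add 4 4 4 ⨾ add 4 4 4) ⨾ approx 9 3 ⨾ sub 9 15 9)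
  doubling =
    (add 5 4 4 ⨾ add 5 5 5 ⨾ set 8 1 ⨾ sub 9 1 8) ⨾
    whilePos 9 (add 8 8 8 ⨾ add 5 5 4 ⨾ sub 9 1 8)
  program = precision ⨾ doubling ⨾ columns ⨾ samples

  approx-run : ∀ {ε x y P s k T} {Q : State → Set} → reg s y ≡ k →
    Terminates ε P (state (reg s [ x ≔ digits ε k ]) (mem s) (coins s)) T Q →
    Terminates ε (approx x y ⨾ P) s (suc k + T) Q
  approx-run {s = state ρ μ cs} refl t = terminates {time = suc _} approx ≤-refl t ⨟ λ t → t

  IsLeast : (ℕ → Set) → ℕ → Set
  IsLeast P k = P k × (∀ {j} → j < k → ¬ P j)

  least : ∀ {P : ℕ → Set} → (∀ n → Dec (P n)) → ∀ n → P n → ∃ (IsLeast P)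
  least {P} P? n p = search 0 n refl λ ()
    where
    search : ∀ m d → m + d ≡ n → (∀ {j} → j < m → ¬ P j) → ∃ (IsLeast P)
    search m d e none with P? m
    ... | yes q = m , q , none
    search m zero    e none | no ¬q = ⊥-elim (¬q (subst P (trans (sym e) (+-identityʳ m)) p))
    search m (suc d) e none | no ¬q = search (suc m) d (trans (sym (+-suc m d)) e) λ j<1+m Pj →
      case m≤n⇒m<n∨m≡n (≤-pred j<1+m) of λ { (inj₁ j<m) → none j<m Pj ; (inj₂ refl) → ¬q Pj }

  record Preamble (env : List ℕ) (s₀ s : State) : Set where
    field
      low-regs : regs 7 (reg s) ≡ env
      memory   : mem s ≡ mem s₀
      coins≡   : coins s ≡ coins s₀

  precision-cost : ℕ → ℕ
  precision-cost k = 3 + (1 + (1 + suc (k * suc (5 + k))))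

  module _ {ε : ℝ} {k : ℕ} (k-least : IsLeast (λ j → 4 ≤ digits ε j) k) {r N : ℕ} where

    record Approximating (s₀ : State) (n : ℕ) (s : State) : Set where
      field
        j        : ℕ
        j+n      : j + n ≡ k
        low-regs : regs 7 (reg s) ≡ 0 ∷ 0 ∷ 4 ^ suc j ∷ j ∷ 1 ∷ N ∷ r ∷ []
        four     : reg s 15 ≡ 4
        guard    : reg s 9 ≡ 4 ∸ digits ε j
        memory   : mem s ≡ mem s₀
        coins≡   : coins s ≡ coins s₀

    fourfold : ∀ x → (x + x) + (x + x) ≡ 4 * x
    fourfold x = trans (+-assoc x x _) (cong (λ y → x + (x + (x + y))) (sym (+-identityʳ x)))

    approximate : ∀ {s₀ n s} → Approximating s₀ (suc n) s →
      reg s 9 ≢ 0 × Terminates ε ((add 3 3 2 ⨾ add 4 4 4 ⨾ add 4 4 4) ⨾ approx 9 3 ⨾ sub 9 15 9) s (5 + k) (Approximating s₀ n)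
    approximate {s₀} {n} {s} I =
      (λ z → proj₂ k-least j<k (m∸n≡0⇒m≤n (trans (sym guard) z))) ,
      weaken (+-monoʳ-≤ 3 (s≤s (≤-trans (≤-reflexive (+-comm (suc j) 1)) (s≤s j<k)))) (λ q → q)
        (_ ▸ approx-run j≡ (loopFree (sub 9 15 9) record
          { j = suc j ; j+n = trans (sym (+-suc j n)) j+n
          ; low-regs = cong₂ _∷_ (at-s 6) (cong₂ _∷_ (at-s 5) (cong₂ _∷_
              (trans (cong (λ x → (x + x) + (x + x)) (at-s 4)) (fourfold (4 ^ suc j)))
              (cong₂ _∷_ j≡ (cong (List.drop 4) low-regs))))
          ; four = four ; guard = cong (_∸ digits ε (suc j)) four
          ; memory = memory ; coins≡ = coins≡ }))
      where
      open Approximating I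
      at-s : ∀ x {_ : T (x <ᵇ 7)} → reg s x ≡ value 7 (0 ∷ 0 ∷ 4 ^ suc j ∷ j ∷ 1 ∷ N ∷ r ∷ []) x
      at-s x {p} = reg-value {ρ = reg s} x {p} low-regs
      j≡ : reg s 3 + reg s 2 ≡ suc j
      j≡ = trans (cong₂ _+_ (at-s 3) (at-s 2)) (+-comm j 1)
      j<k : j < k
      j<k = ≤-trans (s≤s (m≤m+n j n)) (≤-reflexive (trans (sym (+-suc j n)) j+n))

    precision-run : ∀ {s} → regs 7 (reg s) ≡ 0 ∷ 0 ∷ 0 ∷ 0 ∷ 0 ∷ N ∷ r ∷ [] →
      Terminates ε precision s (precision-cost k) (Preamble (0 ∷ 0 ∷ 4 ^ suc k ∷ k ∷ 1 ∷ N ∷ r ∷ []) s)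
    precision-run {s} e = _ ▸ approx-run (reg-value {ρ = reg s} 3 e) (_ ▸ weaken ≤-refl done
      (while (Approximating s)
        (λ I → let open Approximating I in trans guard (m≤n⇒m∸n≡0 (subst (λ j → 4 ≤ digits ε j)
          (trans (sym j+n) (+-identityʳ j)) (proj₁ k-least)))) approximate k record
        { j = 0 ; j+n = refl
        ; low-regs = cong₂ _∷_ (at-s 6) (cong₂ _∷_ (at-s 5) (cong₂ _∷_ refl (cong₂ _∷_ (at-s 3) (cong₂ _∷_ refl
            (cong₂ _∷_ (at-s 1) (cong₂ _∷_ (at-s 0) refl))))))
        ; four = refl ; guard = refl ; memory = refl ; coins≡ = refl }))
      where
      at-s : ∀ x {_ : T (x <ᵇ 7)} → reg s x ≡ value 7 (0 ∷ 0 ∷ 0 ∷ 0 ∷ 0 ∷ N ∷ r ∷ []) x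
      at-s x {p} = reg-value {ρ = reg s} x {p} e
      done : ∀ {s′} → Approximating s 0 s′ → Preamble (0 ∷ 0 ∷ 4 ^ suc k ∷ k ∷ 1 ∷ N ∷ r ∷ []) s s′
      done I = record { low-regs = subst (λ j → _ ≡ 0 ∷ 0 ∷ 4 ^ suc j ∷ j ∷ 1 ∷ N ∷ r ∷ []) (trans (sym (+-identityʳ j)) j+n) low-regs
                      ; memory = memory ; coins≡ = coins≡ }
        where open Approximating I

  module _ {h k N r ℓ : ℕ} (ℓ-least : IsLeast (λ j → N ≤ 2 ^ j) ℓ) where

    record Doubling (s₀ : State) (n : ℕ) (s : State) : Set where
      field
        j        : ℕ
        j+n      : j + n ≡ ℓ
        low-regs : regs 7 (reg s) ≡ 0 ∷ (4 + j) * h ∷ h ∷ k ∷ 1 ∷ N ∷ r ∷ []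
        power    : reg s 8 ≡ 2 ^ j
        guard    : reg s 9 ≡ N ∸ 2 ^ j
        memory   : mem s ≡ mem s₀
        coins≡   : coins s ≡ coins s₀

    double : ∀ {ε s₀ n s} → Doubling s₀ (suc n) s →
      reg s 9 ≢ 0 × Terminates ε (add 8 8 8 ⨾ add 5 5 4 ⨾ sub 9 1 8) s 3 (Doubling s₀ n)
    double {s₀ = s₀} {n} {s} I =
      (λ z → proj₂ ℓ-least j<ℓ (m∸n≡0⇒m≤n (trans (sym guard) z))) ,
      loopFree _ record
        { j = suc j ; j+n = trans (sym (+-suc j n)) j+n
        ; low-regs = cong₂ _∷_ (at-s 6) (cong₂ _∷_
            (trans (cong₂ _+_ (at-s 5) (at-s 4)) (+-comm _ h)) (cong (List.drop 2) low-regs))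
        ; power = power′ ; guard = cong₂ _∸_ (at-s 1) power′
        ; memory = memory ; coins≡ = coins≡ }
      where
      open Doubling I
      at-s : ∀ x {_ : T (x <ᵇ 7)} → reg s x ≡ value 7 (0 ∷ (4 + j) * h ∷ h ∷ k ∷ 1 ∷ N ∷ r ∷ []) x
      at-s x {p} = reg-value {ρ = reg s} x {p} low-regs
      power′ : reg s 8 + reg s 8 ≡ 2 ^ suc j
      power′ = cong₂ _+_ power (trans power (sym (+-identityʳ _)))
      j<ℓ : j < ℓ
      j<ℓ = ≤-trans (s≤s (m≤m+n j n)) (≤-reflexive (trans (sym (+-suc j n)) j+n))

    doubling-run : ∀ {ε s v} → regs 7 (reg s) ≡ 0 ∷ v ∷ h ∷ k ∷ 1 ∷ N ∷ r ∷ [] →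
      Terminates ε doubling s (4 + suc (ℓ * 4)) (Preamble (0 ∷ (4 + ℓ) * h ∷ h ∷ k ∷ 1 ∷ N ∷ r ∷ []) s)
    doubling-run {ε} {s} {v} e = _ ▸ weaken ≤-refl done
      (while (Doubling s)
        (λ I → let open Doubling I in trans guard (m≤n⇒m∸n≡0 (subst (λ j → N ≤ 2 ^ j)
          (trans (sym j+n) (+-identityʳ j)) (proj₁ ℓ-least)))) double ℓ record
        { j = 0 ; j+n = refl
        ; low-regs = cong₂ _∷_ (at-s 6) (cong₂ _∷_ (trans (cong (λ x → (x + x) + (x + x)) (at-s 4))
            (trans (+-assoc h h _) (cong (λ y → h + (h + (h + y))) (sym (+-identityʳ h))))) (cong (List.drop 2) e))
        ; power = refl ; guard = cong (_∸ 1) (at-s 1) ; memory = refl ; coins≡ = refl })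
      where
      at-s : ∀ x {_ : T (x <ᵇ 7)} → reg s x ≡ value 7 (0 ∷ v ∷ h ∷ k ∷ 1 ∷ N ∷ r ∷ []) x
      at-s x {p} = reg-value {ρ = reg s} x {p} e
      done : ∀ {s′} → Doubling s 0 s′ → Preamble (0 ∷ (4 + ℓ) * h ∷ h ∷ k ∷ 1 ∷ N ∷ r ∷ []) s s′
      done I = record { low-regs = subst (λ j → _ ≡ 0 ∷ (4 + j) * h ∷ h ∷ k ∷ 1 ∷ N ∷ r ∷ []) (trans (sym (+-identityʳ j)) j+n) low-regs
                      ; memory = memory ; coins≡ = coins≡ }
        where open Doubling I

  program-cost : (r N k ℓ tmax : ℕ) → ℕ
  program-cost r N k ℓ tmax = precision-cost k + ((4 + suc (ℓ * 4)) +
    ((1 + suc (r * suc (column-cost r N))) + (1 + suc (r * suc (sample-cost tmax)))))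

  module _ {ε : ℝ} {r : ℕ} (C : Code r) {k ℓ : ℕ}
    (k-least : IsLeast (λ j → 4 ≤ digits ε j) k) (ℓ-least : IsLeast (λ j → size C ≤ 2 ^ j) ℓ)
    (t : ℕ → ℕ) (tmax : ℕ) (t≤tmax : ∀ {i} → i < r → t i ≤ tmax)
    (t-doublings : ∀ {i} → i < r → Doublings ((4 + ℓ) * 4 ^ suc k) (minWeight (words C) i) (t i)) where

    open Sampler t (λ i → 1 ∸ (minWeight (words C) i ∸ r))

    program-run : ∀ (ω : List Bool) → length ω ≡ need r →
      Terminates ε program (initial C ω) (program-cost r (size C) k ℓ tmax)
        (λ s → ∀ {i} → i < r → mem s (i + i) ≡ sampled r ω i × mem s (i + i + 1) ≡ 0)
    program-run ω enough = precision-run k-least refl ⨟ after-precision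
      where
      env₁ env₂ : List ℕ
      env₁ = 0 ∷ 0 ∷ 4 ^ suc k ∷ k ∷ 1 ∷ size C ∷ r ∷ []
      env₂ = 0 ∷ (4 + ℓ) * 4 ^ suc k ∷ 4 ^ suc k ∷ k ∷ 1 ∷ size C ∷ r ∷ []
      Post : State → Set
      Post s = ∀ {i} → i < r → mem s (i + i) ≡ sampled r ω i × mem s (i + i + 1) ≡ 0
      after-doubling : ∀ {s} → regs 7 (reg s) ≡ env₂ → mem s ≡ input (words C) → coins s ≡ ω →
        Terminates ε (columns ⨾ samples) s _ Post
      after-doubling {s} e em ec =
        columns-run (words C) {s₀ = s} (at-s 0) (at-s 1) (at-s 2) (at-s 6) refl refl (λ a _ → cong (λ μ → μ a) em)
        ⨟ λ {s′} Cs → let open Columns Cs renaming (low-regs to low) in _ ▸ weaken ≤-refl (λ S {i} → Sampling.written S z≤n)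
          (countdown (Sampling (words C) t tmax t≤tmax t-doublings {s₀ = s} (at-s 0) (at-s 2) (at-s 5) (at-s 6) ω)
             Sampling.counter (sample-step (words C) t tmax t≤tmax t-doublings {s₀ = s} (at-s 0) (at-s 2) (at-s 5) (at-s 6) ω) r record
            { low-regs = low
            ; counter = trans (cong₂ _+_ (trans (reg-value {ρ = reg s′} 0 low) (at-s 0)) (trans (reg-value {ρ = reg s′} 6 low) (at-s 6))) (+-identityʳ r)
            ; n≤r = ≤-refl ; base = base
            ; pending = stored _ z≤n
            ; enough = trans (cong length (trans coins≡ ec)) enough
            ; future = λ _ → cong (λ cs → sampled r cs _) (trans coins≡ ec)
            ; written = λ r≤i i<r → ⊥-elim (<-irrefl refl (<-≤-trans i<r r≤i))
            })
        where
        at-s : ∀ x {_ : T (x <ᵇ 7)} → reg s x ≡ value 7 env₂ x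
        at-s x {p} = reg-value {ρ = reg s} x {p} e
      after-precision : ∀ {s} → Preamble env₁ (initial C ω) s → Terminates ε (doubling ⨾ columns ⨾ samples) s _ Post
      after-precision {s} Pr = doubling-run ℓ-least (Preamble.low-regs Pr) ⨟ λ Pr′ →
        after-doubling (Preamble.low-regs Pr′) (trans (Preamble.memory Pr′) (Preamble.memory Pr))
          (trans (Preamble.coins≡ Pr′) (Preamble.coins≡ Pr))

-- Ordered arithmetic of rationals and Bernoulli's inequality

module RationalOrder where

  open import Data.Nat.Base as ℕ using (ℕ; zero; suc)
  import Data.Nat.Properties as ℕ
  import Data.Integer.Base as ℤ
  import Data.Integer.Properties as ℤ
  open import Data.Rational.Base
  open import Data.Rational.Properties
  import Data.Rational.Unnormalised.Base as ℚᵘ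
  import Data.Rational.Unnormalised.Properties as ℚᵘ
  open import Data.Rational.Solver using (module +-*-Solver)
  open import Relation.Binary.PropositionalEquality
  open import Algebra.Bundles using (module CommutativeRing)
  open import Algebra.Properties.Semiring.Exp (CommutativeRing.semiring +-*-commutativeRing) using (_^_)
  open +-*-Solver

  -- For open `n` the normalised fraction `fromℕ n` does not reduce; passing to unnormalised
  -- fractions turns facts about it into facts about integers.
  fromℕ≃ : ∀ n → toℚᵘ (fromℕ n) ℚᵘ.≃ ℚᵘ.mkℚᵘ (ℤ.+ n) 0
  fromℕ≃ n = toℚᵘ-fromℚᵘ (ℚᵘ.mkℚᵘ (ℤ.+ n) 0)

  fromℕ-+ : ∀ m n → fromℕ (m ℕ.+ n) ≡ fromℕ m + fromℕ n
  fromℕ-+ m n = toℚᵘ-injective (ℚᵘ.≃-trans (fromℕ≃ (m ℕ.+ n)) (ℚᵘ.≃-trans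
    (ℚᵘ.*≡* (cong (ℤ._* ℤ.1ℤ) (sym (cong₂ ℤ._+_ (ℤ.*-identityʳ (ℤ.+ m)) (ℤ.*-identityʳ (ℤ.+ n))))))
    (ℚᵘ.≃-sym (ℚᵘ.≃-trans (toℚᵘ-homo-+ (fromℕ m) (fromℕ n)) (ℚᵘ.+-cong (fromℕ≃ m) (fromℕ≃ n))))))

  fromℕ-* : ∀ m n → fromℕ (m ℕ.* n) ≡ fromℕ m * fromℕ n
  fromℕ-* m n = toℚᵘ-injective (ℚᵘ.≃-trans (fromℕ≃ (m ℕ.* n)) (ℚᵘ.≃-trans
    (ℚᵘ.*≡* (cong (ℤ._* ℤ.1ℤ) (ℤ.pos-* m n)))
    (ℚᵘ.≃-sym (ℚᵘ.≃-trans (toℚᵘ-homo-* (fromℕ m) (fromℕ n)) (ℚᵘ.*-cong (fromℕ≃ m) (fromℕ≃ n))))))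

  fromℕ-mono-≤ : ∀ {m n} → m ℕ.≤ n → fromℕ m ≤ fromℕ n
  fromℕ-mono-≤ {m} {n} m≤n = toℚᵘ-cancel-≤ (ℚᵘ.≤-trans (ℚᵘ.≤-reflexive (fromℕ≃ m)) (ℚᵘ.≤-trans
    (ℚᵘ.*≤* (ℤ.*-monoʳ-≤-nonNeg ℤ.1ℤ (ℤ.+≤+ m≤n))) (ℚᵘ.≤-reflexive (ℚᵘ.≃-sym (fromℕ≃ n)))))

  fromℕ-mono-< : ∀ {m n} → m ℕ.< n → fromℕ m < fromℕ n
  fromℕ-mono-< {m} {n} m<n = toℚᵘ-cancel-< (ℚᵘ.≤-<-trans (ℚᵘ.≤-reflexive (fromℕ≃ m)) (ℚᵘ.<-≤-trans
    (ℚᵘ.*<* (ℤ.*-monoʳ-<-pos ℤ.1ℤ (ℤ.+<+ m<n))) (ℚᵘ.≤-reflexive (ℚᵘ.≃-sym (fromℕ≃ n)))))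

  fromℕ-cancel-≤ : ∀ {m n} → fromℕ m ≤ fromℕ n → m ℕ.≤ n
  fromℕ-cancel-≤ {m} {n} p = ℕ.≮⇒≥ λ n<m → <-irrefl refl (<-≤-trans (fromℕ-mono-< n<m) p)

  0≤fromℕ : ∀ n → 0ℚ ≤ fromℕ n
  0≤fromℕ n = fromℕ-mono-≤ {0} {n} ℕ.z≤n

  *-monoˡ-≤ : ∀ {r p q} → 0ℚ ≤ r → p ≤ q → r * p ≤ r * q
  *-monoˡ-≤ {r} 0≤r = *-monoˡ-≤-nonNeg r {{nonNegative 0≤r}}

  *-monoʳ-≤ : ∀ {r p q} → 0ℚ ≤ r → p ≤ q → p * r ≤ q * r
  *-monoʳ-≤ {r} 0≤r = *-monoʳ-≤-nonNeg r {{nonNegative 0≤r}}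

  *-cancelˡ-≤ : ∀ {r p q} → 0ℚ < r → r * p ≤ r * q → p ≤ q
  *-cancelˡ-≤ {r} 0<r = *-cancelˡ-≤-pos r {{positive 0<r}}

  *-cancelʳ-≤ : ∀ {r p q} → 0ℚ < r → p * r ≤ q * r → p ≤ q
  *-cancelʳ-≤ {r} 0<r = *-cancelʳ-≤-pos r {{positive 0<r}}

  *-nonNeg : ∀ {p q} → 0ℚ ≤ p → 0ℚ ≤ q → 0ℚ ≤ p * q
  *-nonNeg {p} 0≤p 0≤q = ≤-trans (≤-reflexive (sym (*-zeroʳ p))) (*-monoˡ-≤ 0≤p 0≤q)

  *-pos : ∀ {p q} → 0ℚ < p → 0ℚ < q → 0ℚ < p * q
  *-pos {p} {q} 0<p 0<q = positive⁻¹ (p * q) {{pos*pos⇒pos p {{positive 0<p}} q {{positive 0<q}}}}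

  +-nonNeg : ∀ {p q} → 0ℚ ≤ p → 0ℚ ≤ q → 0ℚ ≤ p + q
  +-nonNeg = +-mono-≤

  ^-pos : ∀ {x} → 0ℚ < x → ∀ n → 0ℚ < x ^ n
  ^-pos 0<x zero    = positive⁻¹ 1ℚ
  ^-pos 0<x (suc n) = *-pos 0<x (^-pos 0<x n)

  ≤-by-difference : ∀ {p q d} → 0ℚ ≤ d → p + d ≡ q → p ≤ q
  ≤-by-difference {p} {q} 0≤d refl = ≤-trans (≤-reflexive (sym (+-identityʳ p))) (+-monoʳ-≤ p 0≤d)

  1≤x⇒^-mono : ∀ {x} → 1ℚ ≤ x → ∀ {m n} → m ℕ.≤ n → x ^ m ≤ x ^ n
  1≤x⇒^-mono {x} 1≤x {n = zero} ℕ.z≤n = ≤-refl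
  1≤x⇒^-mono {x} 1≤x {n = suc n} ℕ.z≤n = ≤-trans (≤-trans (1≤x⇒^-mono 1≤x {n = n} ℕ.z≤n) (≤-reflexive (sym (*-identityˡ (x ^ n)))))
    (*-monoʳ-≤ (<⇒≤ (^-pos (<-≤-trans (positive⁻¹ 1ℚ) 1≤x) n)) 1≤x)
  1≤x⇒^-mono {x} 1≤x (ℕ.s≤s m≤n) = *-monoˡ-≤ (≤-trans (<⇒≤ (positive⁻¹ 1ℚ)) 1≤x) (1≤x⇒^-mono 1≤x m≤n)

  ^-inverse : ∀ {x y} → x * y ≡ 1ℚ → ∀ n → x ^ n * y ^ n ≡ 1ℚ
  ^-inverse {x} {y} e zero    = refl
  ^-inverse {x} {y} e (suc n) = trans
    (solve 4 (λ x y a b → x :* a :* (y :* b) := x :* y :* (a :* b)) refl x y (x ^ n) (y ^ n))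
    (cong₂ _*_ e (^-inverse e n))

  bernoulli : ∀ {μ} → 0ℚ ≤ μ → ∀ n → 1ℚ + fromℕ n * μ ≤ (1ℚ + μ) ^ n
  bernoulli {μ} 0≤μ zero    = ≤-reflexive (trans (cong (1ℚ +_) (*-zeroˡ μ)) (+-identityʳ 1ℚ))
  bernoulli {μ} 0≤μ (suc n) = ≤-trans
    (≤-by-difference (*-nonNeg (0≤fromℕ n) (*-nonNeg 0≤μ 0≤μ)) (trans
      (cong (λ z → 1ℚ + z * μ + fromℕ n * (μ * μ)) (fromℕ-+ 1 n))
      (solve 2 (λ μ n → con 1ℚ :+ (con 1ℚ :+ n) :* μ :+ n :* (μ :* μ) := (con 1ℚ :+ μ) :* (con 1ℚ :+ n :* μ)) refl μ (fromℕ n))))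
    (*-monoˡ-≤ (+-nonNeg (<⇒≤ (positive⁻¹ 1ℚ)) 0≤μ) (bernoulli 0≤μ n))

  -- For n μ < 1 this bounds (1 + μ)ⁿ above by 1 / (1 − n μ).
  bernoulli-upper : ∀ {μ} → 0ℚ ≤ μ → ∀ n → (1ℚ + μ) ^ n * (1ℚ - fromℕ n * μ) ≤ 1ℚ
  bernoulli-upper {μ} 0≤μ zero    = ≤-reflexive (solve 1 (λ μ → con 1ℚ :* (con 1ℚ :- con 0ℚ :* μ) := con 1ℚ) refl μ)
  bernoulli-upper {μ} 0≤μ (suc n) = ≤-trans
    (≤-by-difference (*-nonNeg (<⇒≤ (^-pos 0<1+μ n)) (*-nonNeg (0≤fromℕ (suc n)) (*-nonNeg 0≤μ 0≤μ))) (trans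
      (cong (λ z → (1ℚ + μ) * (1ℚ + μ) ^ n * (1ℚ - z * μ) + (1ℚ + μ) ^ n * (z * (μ * μ))) (fromℕ-+ 1 n))
      (solve 3 (λ μ n b → (con 1ℚ :+ μ) :* b :* (con 1ℚ :- (con 1ℚ :+ n) :* μ) :+ b :* ((con 1ℚ :+ n) :* (μ :* μ))
         := b :* (con 1ℚ :- n :* μ)) refl μ (fromℕ n) ((1ℚ + μ) ^ n))))
    (bernoulli-upper 0≤μ n)
    where
    0<1+μ : 0ℚ < 1ℚ + μ
    0<1+μ = <-≤-trans (positive⁻¹ 1ℚ) (≤-trans (≤-reflexive (sym (+-identityʳ 1ℚ))) (+-monoʳ-≤ 1ℚ 0≤μ))

-- Exponential moments and Chernoff bounds

module TailBounds where

  open MinimumWeights using (∑<)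
  open CoinTossing using (toss; module Sampler; ≢⇒≡ᵇ-false; ≡ᵇ-refl)
  open RationalOrder
  open import Data.Bool.Base using (Bool; true; false; if_then_else_; not; _∧_)
  open import Data.List.Base as List using (List; []; _∷_; take; drop)
  open import Data.Vec.Base using (Vec; []; _∷_; toList)
  open import Data.Nat.Base as ℕ using (ℕ; zero; suc)
  import Data.Nat.Properties as ℕ
  open import Data.Product.Base using (_×_; _,_)
  open import Data.Rational.Base
  open import Data.Rational.Properties
  open import Data.Rational.Solver using (module +-*-Solver)
  open import Data.Sum.Base using (_⊎_; inj₁; inj₂)
  open import Function.Base using (_∘_)
  open import Relation.Nullary using (yes; no)
  open import Relation.Nullary.Decidable using (isYes)
  open import Relation.Binary.PropositionalEquality
  open import Algebra.Bundles using (module CommutativeRing)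
  open import Algebra.Properties.Semiring.Exp (CommutativeRing.semiring +-*-commutativeRing) using (_^_; ^-homo-*)
  open +-*-Solver

  0≤1ℚ : 0ℚ ≤ 1ℚ
  0≤1ℚ = <⇒≤ (positive⁻¹ 1ℚ)

  module _ {μ : ℚ} {q D W : ℕ} (0≤μ : 0ℚ ≤ μ) (qμ : fromℕ q * μ ≡ 1ℚ) (D≥1 : 1 ℕ.≤ D)
           (small : D ℕ.* suc D ℕ.* W ℕ.≤ q) where

    private
      b = 1ℚ + μ
      d = fromℕ D
      w = fromℕ W
      a = d * w * μ

      0≤a : 0ℚ ≤ a
      0≤a = *-nonNeg (*-nonNeg (0≤fromℕ D) (0≤fromℕ W)) 0≤μ

      da≤1 : d * (1ℚ + d) * w * μ ≤ 1ℚ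
      da≤1 = ≤-trans (≤-reflexive (cong (_* μ) (sym (trans (fromℕ-* (D ℕ.* suc D) W)
          (cong (_* w) (trans (fromℕ-* D (suc D)) (cong (d *_) (fromℕ-+ 1 D))))))))
        (≤-trans (*-monoʳ-≤ 0≤μ (fromℕ-mono-≤ small)) (≤-reflexive qμ))

      DW≡ : fromℕ (D ℕ.* W) * μ ≡ a
      DW≡ = cong (_* μ) (fromℕ-* D W)

      a+a≤1 : a + a ≤ 1ℚ
      a+a≤1 = ≤-trans (≤-by-difference (*-nonNeg 0≤d-1 0≤a)
        (solve 3 (λ d w μ → d :* w :* μ :+ d :* w :* μ :+ (d :- con 1ℚ) :* (d :* w :* μ) := d :* (con 1ℚ :+ d) :* w :* μ) refl d w μ)) da≤1
        where
        0≤d-1 : 0ℚ ≤ d - 1ℚ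
        0≤d-1 = ≤-trans (≤-reflexive (sym (+-inverseʳ 1ℚ))) (+-monoˡ-≤ (- 1ℚ) (fromℕ-mono-≤ D≥1))

      0<1-a : 0ℚ < 1ℚ - a
      0<1-a = <-≤-trans (positive⁻¹ ½) (≤-by-difference
        (*-nonNeg {½} (<⇒≤ (positive⁻¹ ½)) (≤-trans (≤-reflexive (sym (+-inverseʳ (a + a)))) (+-monoˡ-≤ (- (a + a)) a+a≤1)))
        (solve 1 (λ a → con ½ :+ con ½ :* (con 1ℚ :- (a :+ a)) := con 1ℚ :- a) refl a))

      0<1+a : 0ℚ < 1ℚ + a
      0<1+a = <-≤-trans (positive⁻¹ 1ℚ) (≤-by-difference 0≤a refl)

      -- This is the excess of (1 + W (D + 1) μ)(1 - a) over 1, the place where smallness of W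
      -- against q is used.
      slack : 0ℚ ≤ w * μ * (1ℚ - d * (1ℚ + d) * w * μ)
      slack = *-nonNeg (*-nonNeg (0≤fromℕ W) 0≤μ)
        (≤-trans (≤-reflexive (sym (+-inverseʳ (d * (1ℚ + d) * w * μ)))) (+-monoˡ-≤ (- (d * (1ℚ + d) * w * μ)) da≤1))

    -- Divided by W, the left side is the mean of b^(D v) for v equal to W with probability 1/W and
    -- to 0 otherwise. `bernoulli-upper` gives b^(D W) <= 1/(1 - a), and by `slack` this is at most
    -- 1 + W (D + 1) μ. The mean is then at most 1 + (D + 1) μ, and Bernoulli's inequality finishes.
    growth-moment : b ^ (D ℕ.* W) + (w - 1ℚ) ≤ w * b ^ suc D
    growth-moment = ≤-trans (+-monoˡ-≤ (w - 1ℚ) y≤1+z) (≤-trans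
      (≤-reflexive (solve 3 (λ d w μ → con 1ℚ :+ w :* (con 1ℚ :+ d) :* μ :+ (w :- con 1ℚ) := w :* (con 1ℚ :+ (con 1ℚ :+ d) :* μ)) refl d w μ))
      (*-monoˡ-≤ (0≤fromℕ W) (≤-trans (≤-reflexive (cong (λ z → 1ℚ + z * μ) (sym (fromℕ-+ 1 D)))) (bernoulli 0≤μ (suc D)))))
      where
      y≤1+z : b ^ (D ℕ.* W) ≤ 1ℚ + w * (1ℚ + d) * μ
      y≤1+z = *-cancelʳ-≤ 0<1-a (≤-trans
        (≤-trans (≤-reflexive (cong (λ z → b ^ (D ℕ.* W) * (1ℚ - z)) (sym DW≡))) (bernoulli-upper 0≤μ (D ℕ.* W)))
        (≤-by-difference slack (solve 3 (λ d w μ → con 1ℚ :+ w :* μ :* (con 1ℚ :- d :* (con 1ℚ :+ d) :* w :* μ)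
          := (con 1ℚ :+ w :* (con 1ℚ :+ d) :* μ) :* (con 1ℚ :- d :* w :* μ)) refl d w μ)))

    -- The mirror image: β^(D W) <= 1/(1 + a) by Bernoulli's inequality, and this is at most 1 - W
    -- (D - 1) μ, the excess now being that of `slack` plus 2 a W μ. The resulting mean 1 - (D - 1)
    -- μ is at most β^(D-1) by `bernoulli-upper`.
    decay-moment : ∀ {β D′} → 0ℚ < β → β * b ≡ 1ℚ → D ≡ suc D′ → β ^ (D ℕ.* W) + (w - 1ℚ) ≤ w * β ^ D′
    decay-moment {β} {D′} 0<β βb refl = ≤-trans (+-monoˡ-≤ (w - 1ℚ) y≤1-z) (≤-trans
      (≤-reflexive (solve 3 (λ d w μ → con 1ℚ :- w :* d :* μ :+ (w :- con 1ℚ) := w :* (con 1ℚ :- d :* μ)) refl d′ w μ))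
      (*-monoˡ-≤ (0≤fromℕ W) 1-d′μ≤))
      where
      d′ = fromℕ D′
      d≡ : d ≡ 1ℚ + d′
      d≡ = fromℕ-+ 1 D′
      scaled : ∀ n {p} → b ^ n * p ≤ 1ℚ → p ≤ β ^ n
      scaled n {p} h = ≤-trans (≤-reflexive (trans (sym (*-identityˡ p)) (trans (cong (_* p) (sym (^-inverse βb n))) (*-assoc (β ^ n) (b ^ n) p))))
        (≤-trans (*-monoˡ-≤ (<⇒≤ (^-pos 0<β n)) h) (≤-reflexive (*-identityʳ _)))
      1-d′μ≤ : 1ℚ - d′ * μ ≤ β ^ D′
      1-d′μ≤ = scaled D′ (bernoulli-upper 0≤μ D′)
      y≤1-z : β ^ (D ℕ.* W) ≤ 1ℚ - w * d′ * μ
      y≤1-z = *-cancelʳ-≤ 0<1+a (≤-trans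
        (≤-trans (*-monoˡ-≤ (<⇒≤ (^-pos 0<β (D ℕ.* W))) (≤-trans (≤-reflexive (cong (1ℚ +_) (sym DW≡))) (bernoulli 0≤μ (D ℕ.* W))))
                 (≤-reflexive (^-inverse βb (D ℕ.* W))))
        (≤-by-difference (+-nonNeg slack (*-nonNeg (*-nonNeg (0≤fromℕ W) 0≤μ) (+-nonNeg 0≤a 0≤a)))
          (trans (cong (λ d → 1ℚ + (w * μ * (1ℚ - d * (1ℚ + d) * w * μ) + w * μ * (d * w * μ + d * w * μ))) d≡)
          (trans (solve 3 (λ d w μ → let D = con 1ℚ :+ d in
             con 1ℚ :+ (w :* μ :* (con 1ℚ :- D :* (con 1ℚ :+ D) :* w :* μ) :+ w :* μ :* (D :* w :* μ :+ D :* w :* μ))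
             := (con 1ℚ :- w :* d :* μ) :* (con 1ℚ :+ D :* w :* μ)) refl d′ w μ)
            (cong (λ d → (1ℚ - w * d′ * μ) * (1ℚ + d * w * μ)) (sym d≡))))))

  -- 2^m times the expectation over m fair coins; keeping the factor avoids division.
  ∑ᶜ : ℕ → (List Bool → ℚ) → ℚ
  ∑ᶜ zero    f = f []
  ∑ᶜ (suc m) f = ∑ᶜ m (f ∘ (false ∷_)) + ∑ᶜ m (f ∘ (true ∷_))

  pow2 : ℕ → ℚ
  pow2 n = fromℕ (2 ℕ.^ n)

  pow2-suc : ∀ n → pow2 (suc n) ≡ pow2 n + pow2 n
  pow2-suc n = trans (cong fromℕ (cong (2 ℕ.^ n ℕ.+_) (ℕ.+-identityʳ _))) (fromℕ-+ (2 ℕ.^ n) (2 ℕ.^ n))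

  pow2-+ : ∀ m n → pow2 (m ℕ.+ n) ≡ pow2 m * pow2 n
  pow2-+ m n = trans (cong fromℕ (ℕ.^-distribˡ-+-* 2 m n)) (fromℕ-* (2 ℕ.^ m) (2 ℕ.^ n))

  ∑ᶜ-cong : ∀ m {f g} → (∀ cs → f cs ≡ g cs) → ∑ᶜ m f ≡ ∑ᶜ m g
  ∑ᶜ-cong zero    h = h []
  ∑ᶜ-cong (suc m) h = cong₂ _+_ (∑ᶜ-cong m (h ∘ (false ∷_))) (∑ᶜ-cong m (h ∘ (true ∷_)))

  ∑ᶜ-*ˡ : ∀ m a f → ∑ᶜ m (λ cs → a * f cs) ≡ a * ∑ᶜ m f
  ∑ᶜ-*ˡ zero    a f = refl
  ∑ᶜ-*ˡ (suc m) a f = trans (cong₂ _+_ (∑ᶜ-*ˡ m a _) (∑ᶜ-*ˡ m a _)) (sym (*-distribˡ-+ a _ _))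

  ∑ᶜ-const+ : ∀ m a f → ∑ᶜ m (λ cs → a + f cs) ≡ pow2 m * a + ∑ᶜ m f
  ∑ᶜ-const+ zero    a f = cong (_+ f []) (sym (*-identityˡ a))
  ∑ᶜ-const+ (suc m) a f = trans (cong₂ _+_ (∑ᶜ-const+ m a _) (∑ᶜ-const+ m a _)) (trans
    (solve 4 (λ p a x y → p :* a :+ x :+ (p :* a :+ y) := (p :+ p) :* a :+ (x :+ y)) refl (pow2 m) a (∑ᶜ m (f ∘ (false ∷_))) (∑ᶜ m (f ∘ (true ∷_))))
    (cong (λ p → p * a + ∑ᶜ (suc m) f) (sym (pow2-suc m))))

  -- Starting from weight w, t fair doublings-or-nothing leave w 2ᵗ for one of
  -- the 2ᵗ outcomes and 0 for the others.
  ∑ᶜ-toss : ∀ t m w (f : ℕ → List Bool → ℚ) →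
    ∑ᶜ (t ℕ.+ m) (λ cs → f (toss w (take t cs)) (drop t cs)) ≡ ∑ᶜ m (f (w ℕ.* 2 ℕ.^ t)) + (pow2 t - 1ℚ) * ∑ᶜ m (f 0)
  ∑ᶜ-toss zero    m w f = trans (cong (λ w → ∑ᶜ m (f w)) (sym (ℕ.*-identityʳ w)))
    (solve 2 (λ x y → x := x :+ (con 1ℚ :- con 1ℚ) :* y) refl (∑ᶜ m (f (w ℕ.* 1))) (∑ᶜ m (f 0)))
  ∑ᶜ-toss (suc t) m w f = trans (cong₂ _+_ (∑ᶜ-toss t m 0 f) (∑ᶜ-toss t m (w ℕ.+ w) f)) (trans
    (cong (λ v → ∑ᶜ m (f 0) + (pow2 t - 1ℚ) * ∑ᶜ m (f 0) + (∑ᶜ m (f v) + (pow2 t - 1ℚ) * ∑ᶜ m (f 0)))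
      (trans (cong (ℕ._* 2 ℕ.^ t) (trans (cong (w ℕ.+_) (sym (ℕ.+-identityʳ w))) (ℕ.*-comm 2 w))) (ℕ.*-assoc w 2 (2 ℕ.^ t))))
    (trans (solve 3 (λ p x y → y :+ (p :- con 1ℚ) :* y :+ (x :+ (p :- con 1ℚ) :* y) := x :+ ((p :+ p) :- con 1ℚ) :* y)
      refl (pow2 t) (∑ᶜ m (f (w ℕ.* 2 ℕ.^ suc t))) (∑ᶜ m (f 0)))
      (cong (λ p → ∑ᶜ m (f (w ℕ.* 2 ℕ.^ suc t)) + (p - 1ℚ) * ∑ᶜ m (f 0)) (sym (pow2-suc t)))))

  pow2-2⁻ : ∀ n → pow2 n * 2⁻ n ≡ 1ℚ
  pow2-2⁻ zero    = refl
  pow2-2⁻ (suc n) = trans (cong (_* (½ * 2⁻ n)) (pow2-suc n)) (trans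
    (solve 2 (λ p h → (p :+ p) :* (con ½ :* h) := p :* h) refl (pow2 n) (2⁻ n)) (pow2-2⁻ n))

  sign : ℕ → ℕ
  sign zero    = 0
  sign (suc _) = 1

  ∑<-cong : ∀ n {f g} → (∀ {i} → i ℕ.< n → f i ≡ g i) → ∑< n f ≡ ∑< n g
  ∑<-cong zero    h = refl
  ∑<-cong (suc n) h = cong₂ ℕ._+_ (h ℕ.≤-refl) (∑<-cong n (h ∘ ℕ.m<n⇒m<1+n))

  markov : ∀ m (A : List Bool → Bool) {f y} → (∀ cs → 0ℚ ≤ f cs) → (∀ cs → A cs ≡ true → y ≤ f cs) →
    fromℕ (count m (A ∘ toList)) * y ≤ ∑ᶜ m f
  markov zero A {f} {y} 0≤f h with A [] in eq
  ... | true  = ≤-trans (≤-reflexive (*-identityˡ y)) (h [] eq)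
  ... | false = ≤-trans (≤-reflexive (*-zeroˡ y)) (0≤f [])
  markov (suc m) A {f} {y} 0≤f h = ≤-trans
    (≤-reflexive (trans (cong (_* y) (fromℕ-+ N₀ N₁)) (*-distribʳ-+ y (fromℕ N₀) (fromℕ N₁))))
    (+-mono-≤ (markov m (A ∘ (false ∷_)) (0≤f ∘ (false ∷_)) (h ∘ (false ∷_)))
              (markov m (A ∘ (true ∷_)) (0≤f ∘ (true ∷_)) (h ∘ (true ∷_))))
    where
    N₀ N₁ : ℕ
    N₀ = count m (A ∘ (false ∷_) ∘ toList)
    N₁ = count m (A ∘ (true ∷_) ∘ toList)

  module Moments (t w₀ : ℕ → ℕ) where

    open Sampler t w₀

    -- Eats the coins block by block, so that independence of the coordinates becomes recursion on
    -- `n`; `statistic-sampled` identifies it with a sum over sampled values.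
    statistic : (ℕ → ℕ → ℕ) → ℕ → List Bool → ℕ
    statistic g zero    cs = 0
    statistic g (suc n) cs = g n (toss (w₀ n) (take (t n) cs)) ℕ.+ statistic g n (drop (t n) cs)

    -- The hypothesis is the moment bound of one coordinate, cleared of the denominator 2^tᵢ.
    -- `∑ᶜ-toss` sums out the block of the top coordinate and leaves its moment as a factor. The
    -- base `x` and the exponent `E` are free in order to serve both tails.
    exponential-moment : ∀ {x} → 0ℚ < x → ∀ (c : ℕ → ℕ) D E n →
      (∀ {i} → i ℕ.< n → x ^ (D ℕ.* (w₀ i ℕ.* 2 ℕ.^ t i ℕ.* c i)) + (pow2 (t i) - 1ℚ) ≤ pow2 (t i) * x ^ (E ℕ.* c i)) →
      ∑ᶜ (need n) (λ cs → x ^ (D ℕ.* statistic (λ i v → v ℕ.* c i) n cs)) ≤ pow2 (need n) * x ^ (E ℕ.* ∑< n c)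
    exponential-moment {x} 0<x c D E zero h = ≤-reflexive (trans (cong (x ^_) (ℕ.*-zeroʳ D))
      (trans (cong (x ^_) (sym (ℕ.*-zeroʳ E))) (sym (*-identityˡ _))))
    exponential-moment {x} 0<x c D E (suc n) h = begin
      ∑ᶜ (t n ℕ.+ need n) (λ cs → x ^ (D ℕ.* (toss (w₀ n) (take (t n) cs) ℕ.* c n ℕ.+ Z (drop (t n) cs))))
        ≡⟨ ∑ᶜ-toss (t n) (need n) (w₀ n) (λ v cs → x ^ (D ℕ.* (v ℕ.* c n ℕ.+ Z cs))) ⟩
      ∑ᶜ (need n) (λ cs → x ^ (D ℕ.* (W ℕ.* c n ℕ.+ Z cs))) + (pow2 (t n) - 1ℚ) * S
        ≡⟨ cong (_+ (pow2 (t n) - 1ℚ) * S) (trans (∑ᶜ-cong (need n) split) (∑ᶜ-*ˡ (need n) y _)) ⟩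
      y * S + (pow2 (t n) - 1ℚ) * S
        ≡⟨ *-distribʳ-+ S y (pow2 (t n) - 1ℚ) ⟨
      (y + (pow2 (t n) - 1ℚ)) * S
        ≤⟨ *-monoʳ-≤ (0≤∑ᶜ (need n) (λ cs → D ℕ.* Z cs)) (h ℕ.≤-refl) ⟩
      pow2 (t n) * x ^ (E ℕ.* c n) * S
        ≤⟨ *-monoˡ-≤ (*-nonNeg (0≤fromℕ (2 ℕ.^ t n)) (<⇒≤ (^-pos 0<x (E ℕ.* c n)))) (exponential-moment 0<x c D E n (h ∘ ℕ.m<n⇒m<1+n)) ⟩
      pow2 (t n) * x ^ (E ℕ.* c n) * (pow2 (need n) * x ^ (E ℕ.* ∑< n c))
        ≡⟨ solve 4 (λ a b c d → a :* b :* (c :* d) := a :* c :* (b :* d)) refl (pow2 (t n)) (x ^ (E ℕ.* c n)) (pow2 (need n)) (x ^ (E ℕ.* ∑< n c)) ⟩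
      pow2 (t n) * pow2 (need n) * (x ^ (E ℕ.* c n) * x ^ (E ℕ.* ∑< n c))
        ≡⟨ cong₂ _*_ (sym (pow2-+ (t n) (need n))) (trans (sym (^-homo-* x (E ℕ.* c n) _)) (cong (x ^_) (sym (ℕ.*-distribˡ-+ E (c n) _)))) ⟩
      pow2 (need (suc n)) * x ^ (E ℕ.* ∑< (suc n) c) ∎
      where
      open ≤-Reasoning
      Z : List Bool → ℕ
      Z = statistic (λ i v → v ℕ.* c i) n
      W : ℕ
      W = w₀ n ℕ.* 2 ℕ.^ t n
      y S : ℚ
      y = x ^ (D ℕ.* (W ℕ.* c n))
      S = ∑ᶜ (need n) (λ cs → x ^ (D ℕ.* Z cs))
      split : ∀ cs → x ^ (D ℕ.* (W ℕ.* c n ℕ.+ Z cs)) ≡ y * x ^ (D ℕ.* Z cs)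
      split cs = trans (cong (x ^_) (ℕ.*-distribˡ-+ D (W ℕ.* c n) (Z cs))) (^-homo-* x (D ℕ.* (W ℕ.* c n)) _)
      0≤∑ᶜ : ∀ m (k : List Bool → ℕ) → 0ℚ ≤ ∑ᶜ m (λ cs → x ^ k cs)
      0≤∑ᶜ zero    k = <⇒≤ (^-pos 0<x (k []))
      0≤∑ᶜ (suc m) k = +-nonNeg (0≤∑ᶜ m (k ∘ (false ∷_))) (0≤∑ᶜ m (k ∘ (true ∷_)))

    supportMean : ℕ → ℚ
    supportMean zero    = 0ℚ
    supportMean (suc n) = fromℕ (sign (w₀ n ℕ.* 2 ℕ.^ t n)) * 2⁻ t n + supportMean n

    support-moment : ∀ n → ∑ᶜ (need n) (fromℕ ∘ statistic (λ _ → sign) n) ≡ pow2 (need n) * supportMean n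
    support-moment zero    = refl
    support-moment (suc n) = begin
      ∑ᶜ (t n ℕ.+ need n) (λ cs → fromℕ (sign (toss (w₀ n) (take (t n) cs)) ℕ.+ Z (drop (t n) cs)))
        ≡⟨ ∑ᶜ-toss (t n) (need n) (w₀ n) (λ v cs → fromℕ (sign v ℕ.+ Z cs)) ⟩
      ∑ᶜ (need n) (λ cs → fromℕ (sign W ℕ.+ Z cs)) + (pow2 (t n) - 1ℚ) * S
        ≡⟨ cong (_+ (pow2 (t n) - 1ℚ) * S) (trans (∑ᶜ-cong (need n) (λ cs → fromℕ-+ (sign W) (Z cs))) (∑ᶜ-const+ (need n) (fromℕ (sign W)) (fromℕ ∘ Z))) ⟩
      pow2 (need n) * fromℕ (sign W) + S + (pow2 (t n) - 1ℚ) * S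
        ≡⟨ solve 3 (λ a p s → a :+ s :+ (p :- con 1ℚ) :* s := a :+ p :* s) refl (pow2 (need n) * fromℕ (sign W)) (pow2 (t n)) S ⟩
      pow2 (need n) * fromℕ (sign W) + pow2 (t n) * S
        ≡⟨ cong₂ _+_ (trans (sym (*-identityˡ (pow2 (need n) * fromℕ (sign W)))) (cong (_* (pow2 (need n) * fromℕ (sign W))) (sym (pow2-2⁻ (t n)))))
                     (cong (pow2 (t n) *_) (support-moment n)) ⟩
      pow2 (t n) * 2⁻ t n * (pow2 (need n) * fromℕ (sign W)) + pow2 (t n) * (pow2 (need n) * supportMean n)
        ≡⟨ solve 5 (λ p h m s a → p :* h :* (m :* s) :+ p :* (m :* a) := p :* m :* (s :* h :+ a)) refl
             (pow2 (t n)) (2⁻ t n) (pow2 (need n)) (fromℕ (sign W)) (supportMean n) ⟩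
      pow2 (t n) * pow2 (need n) * (fromℕ (sign W) * 2⁻ t n + supportMean n)
        ≡⟨ cong (_* supportMean (suc n)) (pow2-+ (t n) (need n)) ⟨
      pow2 (need (suc n)) * supportMean (suc n) ∎
      where
      open ≡-Reasoning
      Z : List Bool → ℕ
      Z = statistic (λ _ → sign) n
      W : ℕ
      W = w₀ n ℕ.* 2 ℕ.^ t n
      S : ℚ
      S = ∑ᶜ (need n) (fromℕ ∘ Z)

    statistic-sampled : ∀ g n cs → statistic g n cs ≡ ∑< n (λ i → g i (sampled n cs i))
    statistic-sampled g zero    cs = refl
    statistic-sampled g (suc n) cs = cong₂ ℕ._+_
      (cong (λ b → g n (if b then toss (w₀ n) (take (t n) cs) else sampled n (drop (t n) cs) n)) (sym (≡ᵇ-refl n)))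
      (trans (statistic-sampled g n (drop (t n) cs)) (∑<-cong n λ {i} i<n →
        cong (λ b → g i (if b then toss (w₀ n) (take (t n) cs) else sampled n (drop (t n) cs) i)) (sym (≢⇒≡ᵇ-false (ℕ.<⇒≢ i<n)))))

  count-split : ∀ m (A B : Vec Bool m → Bool) → count m A ℕ.≤ count m (λ ω → A ω ∧ B ω) ℕ.+ count m (not ∘ B)
  count-split zero A B with A [] | B []
  ... | true  | true  = ℕ.s≤s ℕ.z≤n
  ... | true  | false = ℕ.s≤s ℕ.z≤n
  ... | false | _     = ℕ.z≤n
  count-split (suc m) A B = ℕ.≤-trans
    (ℕ.+-mono-≤ (count-split m (A ∘ (false ∷_)) (B ∘ (false ∷_))) (count-split m (A ∘ (true ∷_)) (B ∘ (true ∷_))))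
    (ℕ.≤-reflexive (+-interchange (count m _) (count m _) (count m _) (count m _)))
    where open import Algebra.Properties.CommutativeSemigroup ℕ.+-commutativeSemigroup renaming (interchange to +-interchange)

  count-all : ∀ m → count m (λ _ → true) ≡ 2 ℕ.^ m
  count-all zero    = refl
  count-all (suc m) = cong₂ ℕ._+_ (count-all m) (trans (count-all m) (sym (ℕ.+-identityʳ _)))

  pow2≤^ : ∀ {x} q → 1ℚ + 1ℚ ≤ x ^ q → ∀ L → pow2 L ≤ x ^ (q ℕ.* L)
  pow2≤^ {x} q 2≤ zero    = ≤-reflexive (cong (x ^_) (sym (ℕ.*-zeroʳ q)))
  pow2≤^ {x} q 2≤ (suc L) = begin
    pow2 (suc L)              ≡⟨ pow2-suc L ⟩
    pow2 L + pow2 L           ≡⟨ solve 1 (λ p → p :+ p := (con 1ℚ :+ con 1ℚ) :* p) refl (pow2 L) ⟩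
    (1ℚ + 1ℚ) * pow2 L        ≤⟨ *-monoʳ-≤ (0≤fromℕ (2 ℕ.^ L)) 2≤ ⟩
    x ^ q * pow2 L            ≤⟨ *-monoˡ-≤ (≤-trans (+-nonNeg 0≤1ℚ 0≤1ℚ) 2≤) (pow2≤^ q 2≤ L) ⟩
    x ^ q * x ^ (q ℕ.* L)     ≡⟨ ^-homo-* x q (q ℕ.* L) ⟨
    x ^ (q ℕ.+ q ℕ.* L)       ≡⟨ cong (x ^_) (ℕ.*-suc q L) ⟨
    x ^ (q ℕ.* suc L)         ∎
    where open ≤-Reasoning

  module Tails (t w₀ : ℕ → ℕ) (c : ℕ → ℕ) {n D q : ℕ} (D≥1 : 1 ℕ.≤ D)
    {μ β : ℚ} (0≤μ : 0ℚ ≤ μ) (qμ : fromℕ q * μ ≡ 1ℚ) (0<β : 0ℚ < β) (βb : β * (1ℚ + μ) ≡ 1ℚ)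
    (coordinates : ∀ {i} → i ℕ.< n → c i ≡ 0 ⊎ (c i ≡ 1 × w₀ i ≡ 1 × D ℕ.* suc D ℕ.* 2 ℕ.^ t i ℕ.≤ q)) where

    open Sampler t w₀
    open Moments t w₀

    score : List Bool → ℕ
    score = statistic (λ i v → v ℕ.* c i) n

    private
      b : ℚ
      b = 1ℚ + μ

      1≤b : 1ℚ ≤ b
      1≤b = ≤-by-difference 0≤μ refl

      0<b : 0ℚ < b
      0<b = <-≤-trans (positive⁻¹ 1ℚ) 1≤b

      -- (1 + 1/q)^q >= 2 by Bernoulli's inequality: each q in the exponent of b is worth a factor
      -- 1/2 in probability.
      pow2≤b : ∀ L → pow2 L ≤ b ^ (q ℕ.* L)
      pow2≤b = pow2≤^ q (≤-trans (≤-reflexive (cong (1ℚ +_) (sym qμ))) (bernoulli 0≤μ q))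

      -- Chernoff's argument for both tails, with `x` equal to b above and to β = 1/b below: on the
      -- event, x^(D score) exceeds the bound on its mean by the factor b^(q L).
      tail : ∀ {x} → 0ℚ < x → ∀ E L (A : List Bool → Bool) →
        (∀ {i} → D ℕ.* suc D ℕ.* 2 ℕ.^ t i ℕ.≤ q → x ^ (D ℕ.* 2 ℕ.^ t i) + (pow2 (t i) - 1ℚ) ≤ pow2 (t i) * x ^ E) →
        (∀ cs → A cs ≡ true → x ^ (E ℕ.* ∑< n c) * b ^ (q ℕ.* L) ≤ x ^ (D ℕ.* score cs)) →
        count (need n) (A ∘ toList) ℕ.* 2 ℕ.^ L ℕ.≤ 2 ℕ.^ need n
      tail {x} 0<x E L A moment event = fromℕ-cancel-≤ (*-cancelʳ-≤ 0<xᴱ (begin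
        fromℕ (N ℕ.* 2 ℕ.^ L) * xᴱ        ≡⟨ cong (_* xᴱ) (fromℕ-* N (2 ℕ.^ L)) ⟩
        fromℕ N * pow2 L * xᴱ             ≡⟨ solve 3 (λ n p x → n :* p :* x := n :* x :* p) refl (fromℕ N) (pow2 L) xᴱ ⟩
        fromℕ N * xᴱ * pow2 L             ≤⟨ *-monoˡ-≤ (*-nonNeg (0≤fromℕ N) (<⇒≤ 0<xᴱ)) (pow2≤b L) ⟩
        fromℕ N * xᴱ * b ^ (q ℕ.* L)      ≡⟨ *-assoc (fromℕ N) xᴱ _ ⟩
        fromℕ N * (xᴱ * b ^ (q ℕ.* L))    ≤⟨ markov (need n) A (λ cs → <⇒≤ (^-pos 0<x (D ℕ.* score cs))) event ⟩
        ∑ᶜ (need n) (λ cs → x ^ (D ℕ.* score cs)) ≤⟨ exponential-moment 0<x c D E n coordinate ⟩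
        pow2 (need n) * xᴱ                ∎))
        where
        open ≤-Reasoning
        N : ℕ
        N = count (need n) (A ∘ toList)
        xᴱ : ℚ
        xᴱ = x ^ (E ℕ.* ∑< n c)
        0<xᴱ : 0ℚ < xᴱ
        0<xᴱ = ^-pos 0<x (E ℕ.* ∑< n c)
        coordinate : ∀ {i} → i ℕ.< n →
          x ^ (D ℕ.* (w₀ i ℕ.* 2 ℕ.^ t i ℕ.* c i)) + (pow2 (t i) - 1ℚ) ≤ pow2 (t i) * x ^ (E ℕ.* c i)
        coordinate {i} i<n with c i | w₀ i | coordinates i<n
        ... | _ | w | inj₁ refl = ≤-reflexive (trans
          (cong (λ k → x ^ k + (pow2 (t i) - 1ℚ)) (trans (cong (D ℕ.*_) (ℕ.*-zeroʳ (w ℕ.* 2 ℕ.^ t i))) (ℕ.*-zeroʳ D)))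
          (trans (solve 1 (λ p → con 1ℚ :+ (p :- con 1ℚ) := p :* con 1ℚ) refl (pow2 (t i)))
            (cong (λ k → pow2 (t i) * x ^ k) (sym (ℕ.*-zeroʳ E)))))
        ... | _ | _ | inj₂ (refl , refl , small) = ≤-trans
          (≤-reflexive (cong (λ k → x ^ (D ℕ.* k) + (pow2 (t i) - 1ℚ)) (trans (ℕ.*-identityʳ _) (ℕ.*-identityˡ _))))
          (≤-trans (moment {i} small) (≤-reflexive (cong (λ k → pow2 (t i) * x ^ k) (sym (ℕ.*-identityʳ E)))))

    overweight : ∀ L {a} → q ℕ.* L ℕ.≤ a → count (need n) (λ ω → not (isYes (D ℕ.* score (toList ω) ℕ.≤? suc D ℕ.* ∑< n c ℕ.+ a))) ℕ.* 2 ℕ.^ L ℕ.≤ 2 ℕ.^ need n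
    overweight L {a} qL≤a = tail 0<b (suc D) L (λ cs → not (isYes (D ℕ.* score cs ℕ.≤? suc D ℕ.* ∑< n c ℕ.+ a)))
      (λ {i} → growth-moment {q = q} {D} {2 ℕ.^ t i} 0≤μ qμ D≥1) event
      where
      event : ∀ cs → not (isYes (D ℕ.* score cs ℕ.≤? suc D ℕ.* ∑< n c ℕ.+ a)) ≡ true →
        b ^ (suc D ℕ.* ∑< n c) * b ^ (q ℕ.* L) ≤ b ^ (D ℕ.* score cs)
      event cs e with D ℕ.* score cs ℕ.≤? suc D ℕ.* ∑< n c ℕ.+ a
      event cs () | yes _
      ... | no ¬p = ≤-trans (≤-reflexive (sym (^-homo-* b (suc D ℕ.* ∑< n c) (q ℕ.* L))))
                      (1≤x⇒^-mono 1≤b (ℕ.≤-trans (ℕ.+-monoʳ-≤ (suc D ℕ.* ∑< n c) qL≤a) (ℕ.<⇒≤ (ℕ.≰⇒> ¬p))))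

    underweight : ∀ {D′} → D ≡ suc D′ → ∀ L {a} → q ℕ.* L ℕ.≤ a →
      count (need n) (λ ω → not (isYes (D′ ℕ.* ∑< n c ℕ.≤? D ℕ.* score (toList ω) ℕ.+ a))) ℕ.* 2 ℕ.^ L ℕ.≤ 2 ℕ.^ need n
    underweight {D′} D≡ L {a} qL≤a = tail 0<β D′ L (λ cs → not (isYes (D′ ℕ.* ∑< n c ℕ.≤? D ℕ.* score cs ℕ.+ a)))
      (λ {i} small → decay-moment {q = q} {D} {2 ℕ.^ t i} 0≤μ qμ D≥1 small 0<β βb D≡) event
      where
      event : ∀ cs → not (isYes (D′ ℕ.* ∑< n c ℕ.≤? D ℕ.* score cs ℕ.+ a)) ≡ true →
        β ^ (D′ ℕ.* ∑< n c) * b ^ (q ℕ.* L) ≤ β ^ (D ℕ.* score cs)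
      event cs e with D′ ℕ.* ∑< n c ℕ.≤? D ℕ.* score cs ℕ.+ a
      event cs () | yes _
      ... | no ¬p = begin
        -- Since v exceeds u by at least q L, the factor b^(q L) may be raised to b^(v - u), which
        -- cancels the surplus powers of β.
        β ^ v * b ^ (q ℕ.* L)          ≤⟨ *-monoˡ-≤ (<⇒≤ (^-pos 0<β v)) (1≤x⇒^-mono 1≤b qL≤) ⟩
        β ^ v * b ^ (v ℕ.∸ u)          ≡⟨ cong (λ k → β ^ k * b ^ (v ℕ.∸ u)) (ℕ.m+[n∸m]≡n u≤v) ⟨
        β ^ (u ℕ.+ (v ℕ.∸ u)) * b ^ (v ℕ.∸ u) ≡⟨ cong (_* b ^ (v ℕ.∸ u)) (^-homo-* β u (v ℕ.∸ u)) ⟩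
        β ^ u * β ^ (v ℕ.∸ u) * b ^ (v ℕ.∸ u) ≡⟨ *-assoc (β ^ u) _ _ ⟩
        β ^ u * (β ^ (v ℕ.∸ u) * b ^ (v ℕ.∸ u)) ≡⟨ cong (β ^ u *_) (^-inverse βb (v ℕ.∸ u)) ⟩
        β ^ u * 1ℚ                     ≡⟨ *-identityʳ (β ^ u) ⟩
        β ^ u                          ∎
        where
        open ≤-Reasoning
        u v : ℕ
        u = D ℕ.* score cs
        v = D′ ℕ.* ∑< n c
        u+qL≤v : u ℕ.+ q ℕ.* L ℕ.≤ v
        u+qL≤v = ℕ.≤-trans (ℕ.+-monoʳ-≤ u qL≤a) (ℕ.<⇒≤ (ℕ.≰⇒> ¬p))
        u≤v : u ℕ.≤ v
        u≤v = ℕ.≤-trans (ℕ.m≤m+n u _) u+qL≤v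
        qL≤ : q ℕ.* L ℕ.≤ v ℕ.∸ u
        qL≤ = ℕ.≤-trans (ℕ.≤-reflexive (sym (ℕ.m+n∸m≡n u _))) (ℕ.∸-monoˡ-≤ u u+qL≤v)

-- Counting the coordinates of light words by non-redundancy

module Covering where

  open MinimumWeights using (∑<; bitAt; weight; lighter; lightest)
  open import Data.Bool.Base using (Bool; true; false; _∨_)
  import Data.Bool.Properties as Bool
  open import Data.Fin.Base using (Fin; zero; suc; toℕ)
  import Data.Fin.Properties as Fin
  open import Data.Fin.Subset using (Subset; ∣_∣; _∪_; ⊥)
  open import Data.Fin.Subset.Properties using (∣⊥∣≡0; ∉⊥)
  open import Data.List.Base using (List; []; _∷_; filter)
  open import Data.List.Membership.Propositional using (_∈_; find; lose)
  open import Data.List.Membership.Propositional.Properties using (∈-filter⁺; ∈-filter⁻)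
  open import Data.List.Relation.Unary.All as All using (All; []; _∷_)
  open import Data.List.Relation.Unary.Any using (here; there; any?)
  open import Data.Nat.Base
  open import Data.Nat.Properties
  open import Data.Product.Base using (∃; _×_; _,_; proj₁; proj₂)
  open import Data.Sum.Base using (_⊎_; inj₁; inj₂)
  open import Data.Vec.Base using (Vec; []; _∷_; lookup; _[_]≔_)
  open import Data.Vec.Properties using (lookup∘update′; lookup-zipWith; []=⇒lookup; lookup⇒[]=)
  open import Function.Base using (_∘_)
  open import Relation.Binary.PropositionalEquality
  open import Relation.Nullary
  open import Relation.Nullary.Decidable using (_×-dec_)

  ∣∪∣≤ : ∀ {n} (p q : Subset n) → ∣ p ∪ q ∣ ≤ ∣ p ∣ + ∣ q ∣
  ∣∪∣≤ []          []          = z≤n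
  ∣∪∣≤ (true  ∷ p) (true  ∷ q) = s≤s (≤-trans (∣∪∣≤ p q) (+-monoʳ-≤ ∣ p ∣ (n≤1+n ∣ q ∣)))
  ∣∪∣≤ (true  ∷ p) (false ∷ q) = s≤s (∣∪∣≤ p q)
  ∣∪∣≤ (false ∷ p) (true  ∷ q) = ≤-trans (s≤s (∣∪∣≤ p q)) (≤-reflexive (sym (+-suc ∣ p ∣ ∣ q ∣)))
  ∣∪∣≤ (false ∷ p) (false ∷ q) = ∣∪∣≤ p q

  ∣insert∣ : ∀ {n} (p : Subset n) i → lookup p i ≡ false → ∣ p [ i ]≔ true ∣ ≡ suc ∣ p ∣
  ∣insert∣ (false ∷ p) zero    refl = refl
  ∣insert∣ (true  ∷ p) (suc i) e = cong suc (∣insert∣ p i e)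
  ∣insert∣ (false ∷ p) (suc i) e = ∣insert∣ p i e

  ∑<-shift : ∀ n f → ∑< (suc n) f ≡ f 0 + ∑< n (f ∘ suc)
  ∑<-shift zero    f = refl
  ∑<-shift (suc n) f = trans (cong (f (suc n) +_) (∑<-shift n f))
    (trans (sym (+-assoc (f (suc n)) (f 0) _)) (trans (cong (_+ ∑< n (f ∘ suc)) (+-comm (f (suc n)) (f 0))) (+-assoc (f 0) _ _)))

  ∑<-mono : ∀ n {f g} → (∀ {i} → i < n → f i ≤ g i) → ∑< n f ≤ ∑< n g
  ∑<-mono zero    h = z≤n
  ∑<-mono (suc n) h = +-mono-≤ (h ≤-refl) (∑<-mono n (h ∘ m<n⇒m<1+n))

  weight≡∣∣ : ∀ {r} (c : Vec Bool r) → weight c ≡ ∣ c ∣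
  weight≡∣∣ []                  = refl
  weight≡∣∣ {suc r} (true  ∷ c) = trans (∑<-shift r (bitAt (true ∷ c))) (cong suc (weight≡∣∣ c))
  weight≡∣∣ {suc r} (false ∷ c) = trans (∑<-shift r (bitAt (false ∷ c))) (weight≡∣∣ c)

  bitAt-lookup : ∀ {r} (c : Vec Bool r) i → bitAt c (toℕ i) ≡ bit (lookup c i)
  bitAt-lookup (b ∷ c) zero    = refl
  bitAt-lookup (b ∷ c) (suc i) = bitAt-lookup c i

  ∪-lookupˡ : ∀ {n} (p q : Subset n) i → lookup p i ≡ true → lookup (p ∪ q) i ≡ true
  ∪-lookupˡ p q i e = trans (lookup-zipWith _∨_ i p q) (cong (_∨ lookup q i) e)

  ∪-lookupʳ : ∀ {n} (p q : Subset n) i → lookup q i ≡ true → lookup (p ∪ q) i ≡ true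
  ∪-lookupʳ p q i e = trans (lookup-zipWith _∨_ i p q) (trans (cong (lookup p i ∨_) e) (Bool.∨-zeroʳ (lookup p i)))

  module _ {r : ℕ} (C : Code r) (τ : ℕ) where

    -- A word is kept when it has a coordinate that neither the words kept so
    -- far (with union K) nor the remaining ones cover; I collects these
    -- private coordinates.
    record Kept (I K : Subset r) (ws : List (Vec Bool r)) : Set where
      field
        owner   : ∀ j → lookup I j ≡ true → ∃ λ c → c ∈ words C × lookup c j ≡ true ×
                    (∀ i → lookup I i ≡ true → i ≢ j → lookup c i ≡ false) ×
                    (∀ i → lookup c i ≡ true → lookup K i ≡ true)
        private′ : ∀ j → lookup I j ≡ true → ∀ {c} → c ∈ ws → lookup c j ≡ false
        few     : ∣ K ∣ ≤ τ * ∣ I ∣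

    -- A kept word's new coordinate p avoids the remaining words by choice, and it avoids the
    -- earlier owners because they lie inside K, which misses p. A word without such a p may be
    -- dropped: each of its coordinates lies in K or in a remaining word, and the final union
    -- contains both.
    cover : ∀ ws → (∀ {c} → c ∈ ws → c ∈ words C × ∣ c ∣ ≤ τ) → ∀ {I K} → Kept I K ws →
      ∃ λ I → ∃ λ K′ → Kept I K′ [] × (∀ i → lookup K i ≡ true → lookup K′ i ≡ true) ×
        (∀ {c} → c ∈ ws → ∀ i → lookup c i ≡ true → lookup K′ i ≡ true)
    cover [] within {I} {K} kept = I , K , kept , (λ _ e → e) , λ ()
    cover (c ∷ ws) within {I} {K} kept
      with Fin.any? (λ p → (lookup c p Bool.≟ true) ×-dec (lookup K p Bool.≟ false) ×-dec All.all? (λ c → lookup c p Bool.≟ false) ws)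
    ... | yes (p , cp , Kp , free) = let (I″ , K″ , kept″ , K⊆ , ws⊆) = cover ws (within ∘ there) kept′ in
        I″ , K″ , kept″ , (λ i → K⊆ i ∘ ∪-lookupˡ K c i) ,
        λ { (here refl) i e → K⊆ i (∪-lookupʳ K c i e) ; (there c∈) → ws⊆ c∈ }
      where
      open Kept kept
      p∉I : lookup I p ≡ false
      p∉I = Bool.¬-not λ e → case-true≡false (trans (sym cp) (private′ p e (here refl)))
        where
        case-true≡false : true ≢ false
        case-true≡false ()
      old : ∀ {i} → i ≢ p → lookup (I [ p ]≔ true) i ≡ true → lookup I i ≡ true
      old {i} i≢p e = trans (sym (lookup∘update′ i≢p I true)) e
      owner′ : ∀ j → lookup (I [ p ]≔ true) j ≡ true → ∃ λ c′ → c′ ∈ words C × lookup c′ j ≡ true ×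
                    (∀ i → lookup (I [ p ]≔ true) i ≡ true → i ≢ j → lookup c′ i ≡ false) ×
                    (∀ i → lookup c′ i ≡ true → lookup (K ∪ c) i ≡ true)
      owner′ j e with j Fin.≟ p
      ... | yes refl = c , proj₁ (within (here refl)) , cp , (λ i e i≢p → private′ i (old i≢p e) (here refl)) , ∪-lookupʳ K c
      ... | no j≢p with owner j (old j≢p e)
      ...   | c′ , c′∈ , c′j , others , c′⊆K = c′ , c′∈ , c′j , others′ , λ i → ∪-lookupˡ K c i ∘ c′⊆K i
        where
        others′ : ∀ i → lookup (I [ p ]≔ true) i ≡ true → i ≢ j → lookup c′ i ≡ false
        others′ i e i≢j with i Fin.≟ p
        ... | yes refl = Bool.¬-not λ c′p → Bool.not-¬ Kp (c′⊆K p c′p)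
        ... | no i≢p   = others i (old i≢p e) i≢j
      kept′ : Kept (I [ p ]≔ true) (K ∪ c) ws
      kept′ = record
        { owner = owner′
        ; private′ = λ j e c∈ → helper j e c∈
        ; few = ≤-trans (∣∪∣≤ K c) (≤-trans (+-mono-≤ few (proj₂ (within (here refl))))
            (≤-reflexive (trans (+-comm (τ * ∣ I ∣) τ) (trans (sym (*-suc τ ∣ I ∣)) (cong (τ *_) (sym (∣insert∣ I p p∉I)))))))
        }
        where
        helper : ∀ j → lookup (I [ p ]≔ true) j ≡ true → ∀ {c} → c ∈ ws → lookup c j ≡ false
        helper j e c∈ with j Fin.≟ p
        ... | yes refl = All.lookup free c∈
        ... | no j≢p   = private′ j (old j≢p e) (there c∈)
    ... | no ¬p = let (I″ , K″ , kept″ , K⊆ , ws⊆) = cover ws (within ∘ there) kept′ in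
        I″ , K″ , kept″ , K⊆ , λ { (here refl) i e → redundant {K″} K⊆ ws⊆ i e ; (there c∈) → ws⊆ c∈ }
      where
      open Kept kept
      kept′ : Kept I K ws
      kept′ = record { owner = owner ; private′ = λ j e c∈ → private′ j e (there c∈) ; few = few }
      redundant : ∀ {K″ : Subset r} → (∀ i → lookup K i ≡ true → lookup K″ i ≡ true) →
        (∀ {c} → c ∈ ws → ∀ i → lookup c i ≡ true → lookup K″ i ≡ true) →
        ∀ i → lookup c i ≡ true → lookup K″ i ≡ true
      redundant K⊆ ws⊆ i ci with lookup K i Bool.≟ true | any? (λ c → lookup c i Bool.≟ true) ws
      ... | yes Ki | _ = K⊆ i Ki
      ... | no _ | yes a = let (c′ , c′∈ , e) = find a in ws⊆ c′∈ i e
      ... | no ¬Ki | no ¬a = contradiction (i , ci , Bool.¬-not ¬Ki , All.tabulate (λ c∈ → Bool.¬-not (λ e → ¬a (lose c∈ e)))) ¬p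

    -- The private coordinates witness non-redundancy, so at most NRD(C) words are kept, and each
    -- adds at most τ coordinates to K.
    light-coordinates : ∃ λ K → ∣ K ∣ ≤ τ * NRD C ×
      (∀ {c} → c ∈ words C → weight c ≤ τ → ∀ i → lookup c i ≡ true → lookup K i ≡ true)
    light-coordinates =
      let (I , K , kept , _ , ws⊆) = cover ws within start in
      K , ≤-trans (Kept.few kept) (*-monoʳ-≤ τ (proj₂ (proj₂ (NRD-exists C)) ∣ I ∣ (I , refl , nonRedundant kept))) ,
      λ {c} c∈ light → ws⊆ (∈-filter⁺ (λ c → weight c ≤? τ) c∈ light)
      where
      ws : List (Vec Bool r)
      ws = filter (λ c → weight c ≤? τ) (words C)
      within : ∀ {c} → c ∈ ws → c ∈ words C × ∣ c ∣ ≤ τ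
      within {c} c∈ = let (c∈C , light) = ∈-filter⁻ (λ c → weight c ≤? τ) c∈ in c∈C , subst (_≤ τ) (weight≡∣∣ c) light
      none : ∀ {A : Set} j → lookup (⊥ {r}) j ≡ true → A
      none j e = contradiction (lookup⇒[]= j ⊥ e) ∉⊥
      start : Kept ⊥ ⊥ ws
      start = record { owner = λ j → none j ; private′ = λ j e → none j e ; few = subst (_≤ τ * ∣ ⊥ {r} ∣) (sym (∣⊥∣≡0 r)) z≤n }
      nonRedundant : ∀ {I K} → Kept I K [] → NonRedundant C I
      nonRedundant kept j j∈I = let (c , c∈ , cj , others , _) = Kept.owner kept j ([]=⇒lookup j∈I) in
        lose c∈ (cj , λ i i∈I → others i ([]=⇒lookup i∈I))

  m∸[m∸n]≡m⊓n : ∀ m n → m ∸ (m ∸ n) ≡ m ⊓ n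
  m∸[m∸n]≡m⊓n m n with ≤-total m n
  ... | inj₁ m≤n = trans (cong (m ∸_) (m≤n⇒m∸n≡0 m≤n)) (sym (m≤n⇒m⊓n≡m m≤n))
  ... | inj₂ n≤m = trans (m∸[m∸n]≡n n≤m) (sym (m≥n⇒m⊓n≡n n≤m))

  module _ {r : ℕ} where

    lighter≤ : ∀ b u m → lighter b u m ≤ m
    lighter≤ zero    u m = ≤-refl
    lighter≤ (suc b) u m = m∸n≤m m (m ∸ u)

    lightest≤ : ∀ m (ws : List (Vec Bool r)) i → lightest m ws i ≤ m
    lightest≤ m []       i = ≤-refl
    lightest≤ m (c ∷ ws) i = ≤-trans (lightest≤ _ ws i) (lighter≤ (bitAt c i) (weight c) m)

    lightest≤weight : ∀ m (ws : List (Vec Bool r)) i {c} → c ∈ ws → bitAt c i ≢ 0 → lightest m ws i ≤ weight c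
    lightest≤weight m (c ∷ ws) i (here refl) ≢0 = ≤-trans (lightest≤ _ ws i) (step (bitAt c i) ≢0)
      where
      step : ∀ b → b ≢ 0 → lighter b (weight c) m ≤ weight c
      step zero    ≢0 = contradiction refl ≢0
      step (suc b) _  = ≤-trans (≤-reflexive (m∸[m∸n]≡m⊓n m (weight c))) (m⊓n≤n m (weight c))
    lightest≤weight m (_ ∷ ws) i (there c∈) ≢0 = lightest≤weight _ ws i c∈ ≢0

    lightest-attained : ∀ m (ws : List (Vec Bool r)) i →
      lightest m ws i ≡ m ⊎ ∃ λ c → c ∈ ws × bitAt c i ≢ 0 × lightest m ws i ≡ weight c
    lightest-attained m [] i = inj₁ refl
    lightest-attained m (c ∷ ws) i with lightest-attained (lighter (bitAt c i) (weight c) m) ws i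
    ... | inj₂ (c′ , c′∈ , p , e) = inj₂ (c′ , there c′∈ , p , e)
    ... | inj₁ e with bitAt c i in eq
    ...   | zero  = inj₁ e
    ...   | suc _ with ≤-total m (weight c)
    ...     | inj₁ m≤ = inj₁ (trans e (trans (m∸[m∸n]≡m⊓n m (weight c)) (m≤n⇒m⊓n≡m m≤)))
    ...     | inj₂ ≤m = inj₂ (c , here refl , (λ z → 1+n≢0 (trans (sym eq) z)) , trans e (trans (m∸[m∸n]≡m⊓n m (weight c)) (m≥n⇒m⊓n≡n ≤m)))

-- Expected size of the support

module SupportSize where

  open MinimumWeights using (∑<; bitAt; weight; minWeight)
  open CoinTossing using (module Sampler; Doublings)
  open RationalOrder
  open TailBounds
  open Covering
  open import Data.Bool.Base using (Bool; true; false; if_then_else_; not; T)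
  open import Data.Fin.Base using (Fin; fromℕ<)
  open import Data.Fin.Properties using (toℕ-fromℕ<)
  open import Data.Fin.Subset using (∣_∣)
  open import Data.List.Base as List using (List; []; _∷_)
  open import Data.Vec.Base using (Vec; []; _∷_; toList; lookup)
  open import Data.Nat.Base as ℕ using (ℕ; zero; suc)
  import Data.Nat.Properties as ℕ
  open import Data.Product.Base using (∃; _×_; _,_)
  open import Data.Rational.Base hiding (∣_∣)
  open import Data.Rational.Properties
  open import Data.Rational.Solver using (module +-*-Solver)
  open import Data.Sum.Base using (_⊎_; inj₁; inj₂)
  open import Function.Base using (_∘_)
  open import Relation.Nullary using (yes; no; contradiction)
  open import Relation.Nullary.Decidable using (isYes)
  open import Relation.Binary.PropositionalEquality
  open import Data.Unit.Base using (tt)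
  open +-*-Solver

  reciprocals : ∀ {q} → 1 ℕ.≤ q → ∃ λ μ → ∃ λ β →
    0ℚ ≤ μ × fromℕ q * μ ≡ 1ℚ × 0ℚ < β × β * (1ℚ + μ) ≡ 1ℚ
  reciprocals {q} q≥1 = 1/ fromℕ q , 1/ (1ℚ + 1/ fromℕ q) , <⇒≤ 0<μ , *-inverseʳ (fromℕ q) ,
    positive⁻¹ _ {{1/pos⇒pos (1ℚ + 1/ fromℕ q) {{positive 0<b}}}} , *-inverseˡ (1ℚ + 1/ fromℕ q)
    where
    instance
      q≢0 : NonZero (fromℕ q)
      q≢0 = pos⇒nonZero (fromℕ q) {{positive (fromℕ-mono-< q≥1)}}
    0<μ : 0ℚ < 1/ fromℕ q
    0<μ = positive⁻¹ (1/ fromℕ q) {{1/pos⇒pos (fromℕ q) {{positive (fromℕ-mono-< q≥1)}}}}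
    0<b : 0ℚ < 1ℚ + 1/ fromℕ q
    0<b = <-≤-trans (positive⁻¹ 1ℚ) (≤-by-difference (<⇒≤ 0<μ) refl)
    instance
      b≢0 : NonZero (1ℚ + 1/ fromℕ q)
      b≢0 = pos⇒nonZero (1ℚ + 1/ fromℕ q) {{positive 0<b}}

  0≤2⁻ : ∀ n → 0ℚ ≤ 2⁻ n
  0≤2⁻ zero    = 0≤1ℚ
  0≤2⁻ (suc n) = *-nonNeg (<⇒≤ (positive⁻¹ ½)) (0≤2⁻ n)

  -- The expected number of survivors if `k j` coordinates survive with probability 2^-j each, over
  -- the levels j < J.
  mass : ℕ → (ℕ → ℕ) → ℚ
  mass zero    k = 0ℚ
  mass (suc J) k = 2⁻ J * fromℕ (k J) + mass J k

  0≤mass : ∀ J k → 0ℚ ≤ mass J k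
  0≤mass zero    k = ≤-refl
  0≤mass (suc J) k = +-nonNeg (*-nonNeg (0≤2⁻ J) (0≤fromℕ (k J))) (0≤mass J k)

  mass-+ : ∀ J k l → mass J (λ j → k j ℕ.+ l j) ≡ mass J k + mass J l
  mass-+ zero    k l = refl
  mass-+ (suc J) k l = trans (cong₂ (λ x y → 2⁻ J * x + y) (fromℕ-+ (k J) (l J)) (mass-+ J k l))
    (solve 5 (λ h a b c d → h :* (a :+ b) :+ (c :+ d) := (h :* a :+ c) :+ (h :* b :+ d)) refl
      (2⁻ J) (fromℕ (k J)) (fromℕ (l J)) (mass J k) (mass J l))

  -- The growth 2^j of the level counts cancels the survival probability, so every level contributes
  -- at most X. The number J of levels is the source of the factor log r.
  mass-≤ : ∀ J {k X} → (∀ j → k j ℕ.≤ X ℕ.* 2 ℕ.^ j) → mass J k ≤ fromℕ (J ℕ.* X)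
  mass-≤ zero        h = ≤-refl
  mass-≤ (suc J) {k} {X} h = ≤-trans (+-mono-≤ (≤-trans (*-monoˡ-≤ (0≤2⁻ J) (fromℕ-mono-≤ (h J))) (≤-reflexive level)) (mass-≤ J h))
    (≤-reflexive (sym (fromℕ-+ X (J ℕ.* X))))
    where
    level : 2⁻ J * fromℕ (X ℕ.* 2 ℕ.^ J) ≡ fromℕ X
    level = trans (cong (2⁻ J *_) (fromℕ-* X (2 ℕ.^ J))) (trans
      (solve 3 (λ h x p → h :* (x :* p) := x :* (p :* h)) refl (2⁻ J) (fromℕ X) (pow2 J))
      (trans (cong (fromℕ X *_) (pow2-2⁻ J)) (*-identityʳ (fromℕ X))))

  module _ (t w₀ : ℕ → ℕ) where

    open Sampler t w₀
    open Moments t w₀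

    live : ℕ → ℕ
    live i = sign (w₀ i ℕ.* 2 ℕ.^ t i)

    atLevel : ℕ → ℕ → ℕ
    atLevel j i = if t i ℕ.≡ᵇ j then live i else 0

    supportMean≤mass : ∀ n J → (∀ {i} → i ℕ.< n → live i ≡ 0 ⊎ t i ℕ.< J) →
      supportMean n ≤ mass J (λ j → ∑< n (atLevel j))
    supportMean≤mass zero    J h = 0≤mass J (λ _ → 0)
    supportMean≤mass (suc n) J h = ≤-trans (+-mono-≤ (single J (h ℕ.≤-refl)) (supportMean≤mass n J (h ∘ ℕ.m<n⇒m<1+n)))
      (≤-reflexive (sym (mass-+ J (λ j → atLevel j n) (λ j → ∑< n (atLevel j)))))
      where
      single : ∀ J → live n ≡ 0 ⊎ t n ℕ.< J → fromℕ (live n) * 2⁻ t n ≤ mass J (λ j → atLevel j n)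
      single J       (inj₁ e) = ≤-trans (≤-reflexive (trans (cong (λ s → fromℕ s * 2⁻ t n) e) (*-zeroˡ (2⁻ t n)))) (0≤mass J (λ j → atLevel j n))
      single (suc J) (inj₂ (ℕ.s≤s t≤J)) with t n ℕ.≟ J
      ... | yes t≡J = ≤-by-difference (0≤mass J (λ j → atLevel j n)) (cong (_+ mass J (λ j → atLevel j n))
            (trans (*-comm (fromℕ (live n)) (2⁻ t n)) (cong₂ (λ j l → 2⁻ j * fromℕ l) t≡J
              (sym (cong (λ b → if b then live n else 0) (T⇒≡true (ℕ.≡⇒≡ᵇ (t n) J t≡J)))))))
        where
        T⇒≡true : ∀ {b} → T b → b ≡ true
        T⇒≡true {true} _ = refl
      ... | no t≢J = ≤-trans (single J (inj₂ (ℕ.≤∧≢⇒< t≤J t≢J)))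
            (≤-by-difference (*-nonNeg (0≤2⁻ J) (0≤fromℕ (atLevel J n))) (+-comm (mass J (λ j → atLevel j n)) _))

    -- Markov's inequality at 6 M + 1 rather than 6 M, so that M = 0 needs no other argument: there
    -- it makes the event empty.
    support-tail : ∀ n M → supportMean n ≤ fromℕ M →
      count (need n) (λ ω → not (isYes (statistic (λ _ → sign) n (toList ω) ℕ.≤? 6 ℕ.* M))) ℕ.* 6 ℕ.≤ 2 ℕ.^ need n
    support-tail n M mean≤ = cancel M bound
      where
      A : List Bool → Bool
      A cs = not (isYes (statistic (λ _ → sign) n cs ℕ.≤? 6 ℕ.* M))
      N : ℕ
      N = count (need n) (A ∘ toList)
      event : ∀ cs → A cs ≡ true → fromℕ (suc (6 ℕ.* M)) ≤ fromℕ (statistic (λ _ → sign) n cs)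
      event cs e with statistic (λ _ → sign) n cs ℕ.≤? 6 ℕ.* M
      event cs () | yes _
      ... | no ¬p = fromℕ-mono-≤ (ℕ.≰⇒> ¬p)
      bound : N ℕ.* suc (6 ℕ.* M) ℕ.≤ 2 ℕ.^ need n ℕ.* M
      bound = fromℕ-cancel-≤ (begin
        fromℕ (N ℕ.* suc (6 ℕ.* M))         ≡⟨ fromℕ-* N (suc (6 ℕ.* M)) ⟩
        fromℕ N * fromℕ (suc (6 ℕ.* M))     ≤⟨ markov (need n) A (λ cs → 0≤fromℕ (statistic (λ _ → sign) n cs)) event ⟩
        ∑ᶜ (need n) (fromℕ ∘ statistic (λ _ → sign) n) ≡⟨ support-moment n ⟩
        pow2 (need n) * supportMean n       ≤⟨ *-monoˡ-≤ (0≤fromℕ (2 ℕ.^ need n)) mean≤ ⟩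
        pow2 (need n) * fromℕ M             ≡⟨ fromℕ-* (2 ℕ.^ need n) M ⟨
        fromℕ (2 ℕ.^ need n ℕ.* M)          ∎)
        where open ≤-Reasoning
      cancel : ∀ M → N ℕ.* suc (6 ℕ.* M) ℕ.≤ 2 ℕ.^ need n ℕ.* M → N ℕ.* 6 ℕ.≤ 2 ℕ.^ need n
      cancel zero    h = ℕ.≤-trans (ℕ.≤-reflexive (cong (ℕ._* 6) N≡0)) ℕ.z≤n
        where
        N≡0 : N ≡ 0
        N≡0 = ℕ.n≤0⇒n≡0 (ℕ.≤-trans (ℕ.≤-reflexive (sym (ℕ.*-identityʳ N))) (ℕ.≤-trans h (ℕ.≤-reflexive (ℕ.*-zeroʳ (2 ℕ.^ need n)))))
      cancel (suc M) h = ℕ.*-cancelʳ-≤ (N ℕ.* 6) (2 ℕ.^ need n) (suc M) (ℕ.≤-trans (ℕ.≤-reflexive (ℕ.*-assoc N 6 (suc M)))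
        (ℕ.≤-trans (ℕ.*-monoʳ-≤ N (ℕ.n≤1+n (6 ℕ.* suc M))) h))

  module _ {r : ℕ} (C : Code r) {V : ℕ} (t : ℕ → ℕ)
    (t-doublings : ∀ {i} → i ℕ.< r → Doublings V (minWeight (words C) i) (t i)) where

    private
      w₀ : ℕ → ℕ
      w₀ i = 1 ℕ.∸ (minWeight (words C) i ℕ.∸ r)

    live⇒≤r : ∀ {i} → live t w₀ i ≢ 0 → minWeight (words C) i ℕ.≤ r
    live⇒≤r {i} ≢0 with minWeight (words C) i ℕ.≤? r
    ... | yes p = p
    ... | no ¬p = contradiction (cong (λ w → sign (w ℕ.* 2 ℕ.^ t i)) (ℕ.m≤n⇒m∸n≡0 (ℕ.m<n⇒0<n∸m (ℕ.≰⇒> ¬p)))) ≢0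

    -- For a live coordinate of level j the value mᵢ < V 2^j is the weight of an actual word through
    -- i, not the marker, so `light-coordinates` applies with τ = V 2^j.
    atLevel-count : ∀ j → ∑< r (atLevel t w₀ j) ℕ.≤ (V ℕ.* NRD C) ℕ.* 2 ℕ.^ j
    atLevel-count j with light-coordinates C (V ℕ.* 2 ℕ.^ j)
    ... | K , K≤ , light⊆ = begin
      ∑< r (atLevel t w₀ j)        ≤⟨ ∑<-mono r below ⟩
      ∑< r (bitAt K)               ≡⟨ weight≡∣∣ K ⟩
      ∣ K ∣                        ≤⟨ K≤ ⟩
      V ℕ.* 2 ℕ.^ j ℕ.* NRD C      ≡⟨ ℕ.*-assoc V _ _ ⟩
      V ℕ.* (2 ℕ.^ j ℕ.* NRD C)    ≡⟨ cong (V ℕ.*_) (ℕ.*-comm (2 ℕ.^ j) _) ⟩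
      V ℕ.* (NRD C ℕ.* 2 ℕ.^ j)    ≡⟨ ℕ.*-assoc V _ _ ⟨
      V ℕ.* NRD C ℕ.* 2 ℕ.^ j      ∎
      where
      open ℕ.≤-Reasoning
      sign≤1 : ∀ n → sign n ℕ.≤ 1
      sign≤1 zero    = ℕ.z≤n
      sign≤1 (suc n) = ℕ.≤-refl
      below : ∀ {i} → i ℕ.< r → atLevel t w₀ j i ℕ.≤ bitAt K i
      below {i} i<r with t i ℕ.≡ᵇ j in eq
      ... | false = ℕ.z≤n
      ... | true  with live t w₀ i ℕ.≟ 0
      ...   | yes e = ℕ.≤-trans (ℕ.≤-reflexive e) ℕ.z≤n
      ...   | no ≢0 with lightest-attained (suc r) (words C) i
      ...     | inj₁ e = contradiction (ℕ.≤-trans (ℕ.≤-reflexive (sym e)) (live⇒≤r ≢0)) (ℕ.<-irrefl refl)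
      ...     | inj₂ (c , c∈ , bit≢0 , e) = ℕ.≤-trans (sign≤1 (w₀ i ℕ.* 2 ℕ.^ t i)) (ℕ.≤-reflexive (sym Ki))
        where
        ι : Fin r
        ι = fromℕ< i<r
        bitAt-ι : ∀ (c : Vec Bool r) → bitAt c i ≡ bit (lookup c ι)
        bitAt-ι c = trans (cong (bitAt c) (sym (toℕ-fromℕ< i<r))) (bitAt-lookup c ι)
        bit-true : ∀ b → bit b ≢ 0 → b ≡ true
        bit-true true  _  = refl
        bit-true false ≢0 = contradiction refl ≢0
        light : weight c ℕ.≤ V ℕ.* 2 ℕ.^ j
        light = ℕ.≤-trans (ℕ.≤-reflexive (sym e)) (ℕ.≤-trans (ℕ.<⇒≤ (Doublings.above (t-doublings i<r)))
          (ℕ.≤-reflexive (cong (λ j → V ℕ.* 2 ℕ.^ j) (ℕ.≡ᵇ⇒≡ (t i) j (subst T (sym eq) tt)))))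
        Ki : bitAt K i ≡ 1
        Ki = trans (bitAt-ι K) (cong bit (light⊆ c∈ light ι (bit-true _ (λ z → bit≢0 (trans (bitAt-ι c) z)))))

-- Accuracy for all words at once

module UnionBound where

  open MinimumWeights using (∑<; bitAt; weight; minWeight)
  open CoinTossing using (toss; module Sampler; Doublings)
  open TailBounds using (module Moments; module Tails; sign; count-split; count-all)
  open Covering using (lightest≤weight; weight≡∣∣)
  open SupportSize using (reciprocals; mass-≤; live; supportMean≤mass; support-tail; atLevel-count)
  open import Data.Bool.Base using (Bool; true; false; not; _∧_)
  open import Data.Fin.Subset.Properties using (∣p∣≤n)
  open import Data.List.Base using (List; []; _∷_; take; drop; length)
  open import Data.List.Membership.Propositional using (_∈_)
  open import Data.List.Relation.Unary.Any using (here; there)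
  open import Data.Vec.Base using (Vec; []; _∷_; toList)
  open import Data.Nat.Base
  open import Data.Nat.DivMod using (m*n/n≡m; m/n*n≤m; /-monoˡ-≤)
  open import Data.Nat.Properties
  open import Data.Nat.Solver using (module +-*-Solver)
  open import Data.Product.Base using (∃; _×_; _,_)
  import Data.Rational.Properties as ℚ
  open import Data.Sum.Base using (_⊎_; inj₁; inj₂; [_,_]′)
  open import Function.Base using (_∘_)
  open import Relation.Nullary using (yes; no; Dec; contradiction)
  open import Relation.Nullary.Decidable using (isYes)
  open import Relation.Binary.PropositionalEquality
  open +-*-Solver

  bit01 : ∀ b → bit b ≡ 0 ⊎ bit b ≡ 1
  bit01 false = inj₁ refl
  bit01 true  = inj₂ refl

  nth01 : ∀ bs i → Defs.nth bs i ≡ 0 ⊎ Defs.nth bs i ≡ 1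
  nth01 []       i       = inj₁ refl
  nth01 (b ∷ bs) zero    = bit01 b
  nth01 (b ∷ bs) (suc i) = nth01 bs i

  count-none : ∀ m (A : List Bool → Bool) → (∀ cs → A cs ≡ false) → count m (A ∘ toList) ≡ 0
  count-none zero    A h = cong bit (h [])
  count-none (suc m) A h = cong₂ _+_ (count-none m (A ∘ (false ∷_)) (h ∘ (false ∷_))) (count-none m (A ∘ (true ∷_)) (h ∘ (true ∷_)))

  2^n≥1 : ∀ n → 1 ≤ 2 ^ n
  2^n≥1 zero    = ≤-refl
  2^n≥1 (suc n) = ≤-trans (2^n≥1 n) (m≤m+n (2 ^ n) _)

  isYes-true : ∀ {A : Set} (d : Dec A) → isYes d ≡ true → A
  isYes-true (yes a) _ = a

  isYes-yes : ∀ {A : Set} (d : Dec A) → A → not (isYes d) ≡ false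
  isYes-yes (yes _) _ = refl
  isYes-yes (no ¬a) a = contradiction a ¬a

  size≥1 : ∀ {r} (C : Code r) → 1 ≤ size C
  size≥1 C with words C | nonempty C
  ... | []    | ≢[] = contradiction refl ≢[]
  ... | _ ∷ _ | _   = s≤s z≤n

  squared : ∀ k → 2 ^ k * 2 ^ k ≡ 4 ^ k
  squared zero    = refl
  squared (suc k) = trans (solve 1 (λ d → (con 2 :* d) :* (con 2 :* d) := con 4 :* (d :* d)) refl (2 ^ k)) (cong (4 *_) (squared k))

  module Bands {r : ℕ} (C : Code r) (k ℓ : ℕ) (size≤ : size C ≤ 2 ^ ℓ) (t : ℕ → ℕ)
    (t-doublings : ∀ {i} → i < r → Doublings ((4 + ℓ) * 4 ^ suc k) (minWeight (words C) i) (t i)) where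

    private
      D L V : ℕ
      D = 2 ^ k
      L = 4 + ℓ
      V = L * 4 ^ suc k

      w₀ : ℕ → ℕ
      w₀ i = 1 ∸ (minWeight (words C) i ∸ r)

    open Sampler t w₀
    open Moments t w₀

    score : Vec Bool r → List Bool → ℕ
    score c = statistic (λ i v → v * bitAt c i) r

    supportSize : List Bool → ℕ
    supportSize = statistic (λ _ → sign) r

    -- Both are acceptance tests: `heavy` is true when the score is not too heavy, `light` when it
    -- is not too light. The extra `weight c` is the allowance for q L.
    heavy light : Vec Bool r → List Bool → Bool
    heavy c cs = isYes (D * score c cs ≤? suc D * weight c + weight c)
    light c cs = isYes ((D ∸ 1) * weight c ≤? D * score c cs + weight c)

    private
      D≡ : D ≡ suc (D ∸ 1)
      D≡ = sym (m+[n∸m]≡n (2^n≥1 k))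

      m≤weight : ∀ {c i} → c ∈ words C → bitAt c i ≡ 1 → minWeight (words C) i ≤ weight c
      m≤weight {c} {i} c∈ e = lightest≤weight (suc r) (words C) i c∈ (λ z → 1+n≢0 (trans (sym e) z))

      w₀≡1 : ∀ {c i} → c ∈ words C → bitAt c i ≡ 1 → w₀ i ≡ 1
      w₀≡1 {c} c∈ e = cong (1 ∸_) (m≤n⇒m∸n≡0 (≤-trans (m≤weight c∈ e) (≤-trans (≤-reflexive (weight≡∣∣ c)) (∣p∣≤n c))))

      -- For T = 2^(t-1) this explains the 4 in V = 4 D² L: one factor 2 comes from D + 1 <= 2 D,
      -- the other from `Doublings` bounding mᵢ below by V 2^(t-1) only.
      spread : ∀ x T → 2 * 4 ^ k * L * 2 * T ≤ x → D * suc D * (2 * T) * L ≤ x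
      spread x T h = ≤-trans (*-monoˡ-≤ L (*-monoˡ-≤ (2 * T) (*-monoʳ-≤ D (+-monoˡ-≤ D (2^n≥1 k)))))
        (≤-trans (≤-reflexive (trans
          (solve 3 (λ D T L → D :* (D :+ D) :* (con 2 :* T) :* L := con 2 :* (D :* D) :* L :* con 2 :* T) refl D T L)
          (cong (λ q → 2 * q * L * 2 * T) (squared k)))) h)

      V≡ : V ≡ 2 * 4 ^ k * L * 2
      V≡ = solve 2 (λ q L → L :* (con 4 :* q) := con 2 :* q :* L :* con 2) refl (4 ^ k) L

      -- V is twice the threshold, so mᵢ <= wt(c) < V for all i in c: no coin is tossed for them and
      -- each keeps the weight 1.
      deterministic : ∀ {c} → c ∈ words C → weight c < 2 * 4 ^ k * L → ∀ cs → score c cs ≡ weight c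
      deterministic {c} c∈ small = go r ≤-refl
        where
        go : ∀ n → n ≤ r → ∀ cs → statistic (λ i v → v * bitAt c i) n cs ≡ ∑< n (bitAt c)
        go zero    _   cs = refl
        go (suc n) n<r cs = cong₂ _+_ here′ (go n (<⇒≤ n<r) (drop (t n) cs))
          where
          here′ : toss (w₀ n) (take (t n) cs) * bitAt c n ≡ bitAt c n
          here′ with nth01 (toList c) n
          ... | inj₁ e = trans (cong (toss (w₀ n) (take (t n) cs) *_) e) (trans (*-zeroʳ (toss (w₀ n) (take (t n) cs))) (sym e))
          ... | inj₂ e with t n in eq
          ...   | zero  = trans (cong (_* bitAt c n) (w₀≡1 c∈ e)) (*-identityˡ _)
          ...   | suc t′ = contradiction (≤-trans (≤-reflexive (sym (*-identityʳ V))) (≤-trans (Doublings.below (t-doublings n<r) {0} (subst (0 <_) (sym eq) z<s)) (m≤weight c∈ e)))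
                    (<⇒≱ (<-≤-trans small (≤-trans (m≤m+n (2 * 4 ^ k * L) _) (≤-reflexive (trans (*-comm 2 (2 * 4 ^ k * L)) (sym V≡))))))

      -- Rounding down gives q L <= wt(c), as the tail requires; the condition D (D + 1) 2^t <= q
      -- survives it because its left side is an integer.
      q : Vec Bool r → ℕ
      q c = weight c / L

      q≥1 : ∀ {c} → 2 * 4 ^ k * L ≤ weight c → 1 ≤ q c
      q≥1 large = ≤-trans (≤-reflexive (sym (m*n/n≡m 1 L))) (/-monoˡ-≤ L (≤-trans (*-monoˡ-≤ L {1} {2 * 4 ^ k}
        (≤-trans (s≤s z≤n) (*-monoʳ-≤ 2 (≤-trans (*-mono-≤ (2^n≥1 k) (2^n≥1 k)) (≤-reflexive (squared k)))))) large))

      coordinates : ∀ {c} → c ∈ words C → 2 * 4 ^ k * L ≤ weight c → ∀ {i} → i < r →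
        bitAt c i ≡ 0 ⊎ (bitAt c i ≡ 1 × w₀ i ≡ 1 × D * suc D * 2 ^ t i ≤ q c)
      coordinates {c} c∈ large {i} i<r with nth01 (toList c) i
      ... | inj₁ e = inj₁ e
      ... | inj₂ e = inj₂ (e , w₀≡1 c∈ e , ≤-trans (≤-reflexive (sym (m*n/n≡m (D * suc D * 2 ^ t i) L))) (/-monoˡ-≤ L (bound (t i) refl)))
        where
        bound : ∀ s → t i ≡ s → D * suc D * 2 ^ s * L ≤ weight c
        -- Without tosses `Doublings` bounds mᵢ only from above, and the assumption wt(c) >= 2 D² L
        -- takes over.
        bound zero    _  = ≤-trans (*-monoˡ-≤ L (*-monoˡ-≤ 1 (*-monoʳ-≤ D (+-monoˡ-≤ D (2^n≥1 k)))))
          (≤-trans (≤-reflexive (trans (solve 2 (λ D L → D :* (D :+ D) :* con 1 :* L := con 2 :* (D :* D) :* L) refl D L)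
            (cong (λ q → 2 * q * L) (squared k)))) large)
        bound (suc s) eq = spread (weight c) (2 ^ s) (≤-trans (≤-reflexive (cong (_* 2 ^ s) (sym V≡)))
          (≤-trans (Doublings.below (t-doublings i<r) (subst (s <_) (sym eq) ≤-refl)) (m≤weight c∈ e)))

      heavy-rare : ∀ {c} → c ∈ words C → count (need r) (not ∘ heavy c ∘ toList) * 2 ^ L ≤ 2 ^ need r
      heavy-rare {c} c∈ = [ spreadOut , concentrated ]′ (≤-<-connex (2 * 4 ^ k * L) (weight c))
        where
        concentrated : weight c < 2 * 4 ^ k * L → count (need r) (not ∘ heavy c ∘ toList) * 2 ^ L ≤ 2 ^ need r
        concentrated small = ≤-trans (≤-reflexive (cong (_* 2 ^ L) (count-none (need r) (not ∘ heavy c) λ cs →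
          isYes-yes (D * score c cs ≤? suc D * weight c + weight c) (≤-trans (≤-reflexive (cong (D *_) (deterministic c∈ small cs)))
            (≤-trans (m≤n+m (D * weight c) (weight c)) (m≤m+n (suc D * weight c) (weight c))))))) z≤n
        spreadOut : 2 * 4 ^ k * L ≤ weight c → count (need r) (not ∘ heavy c ∘ toList) * 2 ^ L ≤ 2 ^ need r
        spreadOut large = let (μ , β , 0≤μ , qμ , 0<β , βb) = reciprocals {q c} (q≥1 {c} large) in
          Tails.overweight t w₀ (bitAt c) {r} {D} {q c} (2^n≥1 k) 0≤μ qμ 0<β βb (coordinates c∈ large) L {weight c} (m/n*n≤m (weight c) L)

      light-rare : ∀ {c} → c ∈ words C → count (need r) (not ∘ light c ∘ toList) * 2 ^ L ≤ 2 ^ need r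
      light-rare {c} c∈ = [ spreadOut , concentrated ]′ (≤-<-connex (2 * 4 ^ k * L) (weight c))
        where
        concentrated : weight c < 2 * 4 ^ k * L → count (need r) (not ∘ light c ∘ toList) * 2 ^ L ≤ 2 ^ need r
        concentrated small = ≤-trans (≤-reflexive (cong (_* 2 ^ L) (count-none (need r) (not ∘ light c) λ cs →
          isYes-yes ((D ∸ 1) * weight c ≤? D * score c cs + weight c) (≤-trans (*-monoˡ-≤ (weight c) (m∸n≤m D 1))
            (≤-trans (≤-reflexive (cong (D *_) (sym (deterministic c∈ small cs)))) (m≤m+n (D * score c cs) (weight c))))))) z≤n
        spreadOut : 2 * 4 ^ k * L ≤ weight c → count (need r) (not ∘ light c ∘ toList) * 2 ^ L ≤ 2 ^ need r
        spreadOut large = let (μ , β , 0≤μ , qμ , 0<β , βb) = reciprocals {q c} (q≥1 {c} large) in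
          Tails.underweight t w₀ (bitAt c) {r} {D} {q c} (2^n≥1 k) 0≤μ qμ 0<β βb (coordinates c∈ large) {D ∸ 1} D≡ L {weight c} (m/n*n≤m (weight c) L)

    module Union (J : ℕ) (levels : ∀ {i} → i < r → live t w₀ i ≡ 0 ⊎ t i < J) where

      supportBound : ℕ
      supportBound = J * (V * NRD C)

      small : List Bool → Bool
      small cs = isYes (supportSize cs ≤? 6 * supportBound)

      good : List (Vec Bool r) → List Bool → Bool
      good []       cs = small cs
      good (c ∷ ws) cs = (good ws cs ∧ heavy c cs) ∧ light c cs

      private
        m : ℕ
        m = need r

        small-likely : count m (not ∘ small ∘ toList) * 6 ≤ 2 ^ m
        small-likely = support-tail t w₀ r supportBound
          (ℚ.≤-trans (supportMean≤mass t w₀ r J levels) (mass-≤ J (atLevel-count C t t-doublings)))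

        -- The failures of the words accumulate in `e`, apart from those of the support, because
        -- they are measured in units of 2^-L.
        union : ∀ ws → (∀ {c} → c ∈ ws → c ∈ words C) →
          ∃ λ e → 2 ^ m ≤ count m (good ws ∘ toList) + (count m (not ∘ small ∘ toList) + e) × e * 2 ^ L ≤ 2 * length ws * 2 ^ m
        union [] _ = 0 , ≤-trans (≤-reflexive (sym (count-all m))) (≤-trans (count-split m (λ _ → true) (small ∘ toList))
          (+-monoʳ-≤ (count m (small ∘ toList)) (≤-reflexive (sym (+-identityʳ (count m (not ∘ small ∘ toList))))))) , z≤n
        union (c ∷ ws) within with union ws (within ∘ there)
        ... | e , total , rare = e + (h + l) ,
          (begin
            2 ^ m                        ≤⟨ total ⟩
            g + (s + e)                  ≤⟨ +-monoˡ-≤ (s + e) (≤-trans (count-split m (good ws ∘ toList) (heavy c ∘ toList))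
                                              (+-monoˡ-≤ h (count-split m (λ ω → good ws (toList ω) ∧ heavy c (toList ω)) (light c ∘ toList)))) ⟩
            g′ + l + h + (s + e)         ≡⟨ solve 5 (λ g l h s e → g :+ l :+ h :+ (s :+ e) := g :+ (s :+ (e :+ (h :+ l)))) refl g′ l h s e ⟩
            g′ + (s + (e + (h + l)))     ∎) ,
          (begin
            (e + (h + l)) * 2 ^ L        ≡⟨ solve 4 (λ e h l p → (e :+ (h :+ l)) :* p := e :* p :+ (h :* p :+ l :* p)) refl e h l (2 ^ L) ⟩
            e * 2 ^ L + (h * 2 ^ L + l * 2 ^ L) ≤⟨ +-mono-≤ rare (+-mono-≤ (heavy-rare (within (here refl))) (light-rare (within (here refl)))) ⟩
            2 * length ws * 2 ^ m + (2 ^ m + 2 ^ m) ≡⟨ solve 2 (λ n p → con 2 :* n :* p :+ (p :+ p) := con 2 :* (con 1 :+ n) :* p) refl (length ws) (2 ^ m) ⟩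
            2 * suc (length ws) * 2 ^ m  ∎)
          where
          open ≤-Reasoning
          g g′ h l s : ℕ
          g  = count m (good ws ∘ toList)
          g′ = count m (good (c ∷ ws) ∘ toList)
          h  = count m (not ∘ heavy c ∘ toList)
          l  = count m (not ∘ light c ∘ toList)
          s  = count m (not ∘ small ∘ toList)

      good-likely : 2 * 2 ^ m ≤ 3 * count m (good (words C) ∘ toList)
      good-likely = let (e , total , rare) = union (words C) (λ c∈ → c∈) in +-cancelʳ-≤ (2 ^ m) _ _ (begin
          2 * 2 ^ m + 2 ^ m              ≡⟨ solve 1 (λ p → con 2 :* p :+ p := con 3 :* p) refl (2 ^ m) ⟩
          3 * 2 ^ m                      ≤⟨ *-monoʳ-≤ 3 total ⟩
          3 * (g + (s + e))              ≡⟨ solve 3 (λ g s e → con 3 :* (g :+ (s :+ e)) := con 3 :* g :+ con 3 :* (s :+ e)) refl g s e ⟩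
          3 * g + 3 * (s + e)            ≤⟨ +-monoʳ-≤ (3 * g) (bad≤ e rare) ⟩
          3 * g + 2 ^ m                  ∎)
        where
        open ≤-Reasoning
        g s N : ℕ
        g = count m (good (words C) ∘ toList)
        s = count m (not ∘ small ∘ toList)
        N = size C
        instance
          2N≢0 : NonZero (2 * N)
          2N≢0 = >-nonZero (*-mono-≤ {1} {2} (s≤s z≤n) (size≥1 C))
        -- The 2 N tails of probability 2^-L must total at most 1/6; the 4 in L = 4 + ℓ supplies 16
        -- where 12 is needed.
        12N≤ : 12 * N ≤ 2 ^ L
        12N≤ = ≤-trans (*-mono-≤ {12} {16} (m≤m+n 12 4) size≤)
          (≤-reflexive (solve 1 (λ p → con 16 :* p := con 2 :* (con 2 :* (con 2 :* (con 2 :* p)))) refl (2 ^ ℓ)))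
        e≤ : ∀ e → e * 2 ^ L ≤ 2 * N * 2 ^ m → e * 6 ≤ 2 ^ m
        e≤ e rare = *-cancelˡ-≤ (2 * N) (begin
          2 * N * (e * 6)   ≡⟨ solve 2 (λ n e → con 2 :* n :* (e :* con 6) := e :* (con 12 :* n)) refl N e ⟩
          e * (12 * N)      ≤⟨ *-monoʳ-≤ e 12N≤ ⟩
          e * 2 ^ L         ≤⟨ rare ⟩
          2 * N * 2 ^ m     ∎)
        bad≤ : ∀ e → e * 2 ^ L ≤ 2 * N * 2 ^ m → 3 * (s + e) ≤ 2 ^ m
        bad≤ e rare = *-cancelˡ-≤ 2 (begin
          2 * (3 * (s + e)) ≡⟨ solve 2 (λ s e → con 2 :* (con 3 :* (s :+ e)) := s :* con 6 :+ e :* con 6) refl s e ⟩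
          s * 6 + e * 6     ≤⟨ +-mono-≤ small-likely (e≤ e rare) ⟩
          2 ^ m + 2 ^ m     ≡⟨ cong (2 ^ m +_) (sym (+-identityʳ _)) ⟩
          2 * 2 ^ m         ∎)

      good-small : ∀ ws {cs} → good ws cs ≡ true → supportSize cs ≤ 6 * supportBound
      good-small []       {cs} e = isYes-true (supportSize cs ≤? 6 * supportBound) e
      good-small (c ∷ ws) {cs} e with good ws cs in eq
      ... | true = good-small ws eq

      good-accurate : ∀ ws {cs c} → good ws cs ≡ true → c ∈ ws →
        D * score c cs ≤ suc D * weight c + weight c × (D ∸ 1) * weight c ≤ D * score c cs + weight c
      good-accurate (c ∷ ws) {cs} e c∈ with good ws cs in eq | heavy c cs in eqʰ | light c cs in eqˡ
      good-accurate (c ∷ ws) {cs} e (here refl) | true | true | true =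
        isYes-true (D * score c cs ≤? suc D * weight c + weight c) eqʰ , isYes-true ((D ∸ 1) * weight c ≤? D * score c cs + weight c) eqˡ
      good-accurate (c ∷ ws) {cs} e (there c∈) | true | true | true = good-accurate ws eq c∈

-- Reading a real tolerance to the right precision

module Precision where

  open RationalOrder
  open TailBounds using (pow2; pow2-+; pow2-suc; pow2-2⁻)
  open SupportSize using (0≤2⁻)
  open import Data.Nat.Base as ℕ using (ℕ; zero; suc)
  import Data.Nat.Properties as ℕ
  import Data.Integer.Base as ℤ
  import Data.Integer.Properties as ℤ
  import Data.Integer.DivMod as ℤ
  open import Data.Product.Base using (∃; _,_)
  open import Data.Rational.Base
  open import Data.Rational.Properties
  import Data.Rational.Unnormalised.Base as ℚᵘ
  import Data.Rational.Unnormalised.Properties as ℚᵘ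
  open import Data.Rational.Solver using (module +-*-Solver)
  open import Data.Sum.Base using (inj₁; inj₂)
  open import Relation.Binary.PropositionalEquality

  open +-*-Solver

  fromℕ≤⇐floor : ∀ x n → suc n ℕ.≤ ℤ.∣ ℤ.0ℤ ℤ.⊔ floor x ∣ → fromℕ (suc n) ≤ x
  fromℕ≤⇐floor x@(mkℚ num d-1 _) n h = toℚᵘ-cancel-≤ (ℚᵘ.≤-trans (ℚᵘ.≤-reflexive (fromℕ≃ (suc n)))
    (ℚᵘ.*≤* (ℤ.≤-trans (ℤ.*-monoʳ-≤-nonNeg (ℤ.+ suc d-1) (below (floor x) h))
      (ℤ.≤-trans (ℤ.[n/d]*d≤n num (ℤ.+ suc d-1)) (ℤ.≤-reflexive (sym (ℤ.*-identityʳ num)))))))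
    where
    below : ∀ f → suc n ℕ.≤ ℤ.∣ ℤ.0ℤ ℤ.⊔ f ∣ → ℤ.+ suc n ℤ.≤ f
    below (ℤ.+ f) h = ℤ.+≤+ h

  <fromℕ⇐floor : ∀ x n → ℤ.∣ ℤ.0ℤ ℤ.⊔ floor x ∣ ℕ.< n → x < fromℕ n
  <fromℕ⇐floor x@(mkℚ num d-1 _) n h = toℚᵘ-cancel-< (ℚᵘ.<-≤-trans
    (ℚᵘ.*<* (ℤ.≤-<-trans (ℤ.≤-reflexive (ℤ.*-identityʳ num)) (ℤ.<-≤-trans (ℤ.n<s[n/ℕd]*d num (suc d-1))
      (ℤ.*-monoʳ-≤-nonNeg (ℤ.+ suc d-1) (above (num ℤ./ℕ suc d-1) (subst (λ f → ℤ.∣ ℤ.0ℤ ℤ.⊔ f ∣ ℕ.< n) (ℤ.div-pos-is-/ℕ num (suc d-1)) h))))))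
    (ℚᵘ.≤-reflexive (ℚᵘ.≃-sym (fromℕ≃ n))))
    where
    above : ∀ f → ℤ.∣ ℤ.0ℤ ℤ.⊔ f ∣ ℕ.< n → ℤ.suc f ℤ.≤ ℤ.+ n
    above (ℤ.+ f) h = ℤ.+≤+ h
    above ℤ.-[1+ f ] h = ℤ.≤-trans (ℤ.i<j⇒suc[i]≤j (ℤ.-<+ {f} {0})) (ℤ.+≤+ ℕ.z≤n)

  p≤∣p∣ : ∀ p → p ≤ ∣ p ∣
  p≤∣p∣ p with ≤-total 0ℚ p
  ... | inj₁ 0≤p = ≤-reflexive (sym (0≤p⇒∣p∣≡p 0≤p))
  ... | inj₂ p≤0 = ≤-trans p≤0 (0≤∣p∣ p)

  2⁻-anti : ∀ {m n} → m ℕ.≤ n → 2⁻ n ≤ 2⁻ m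
  2⁻-anti {n = zero}  ℕ.z≤n = ≤-refl
  2⁻-anti {n = suc n} ℕ.z≤n = ≤-trans (≤-by-difference (*-nonNeg (<⇒≤ (positive⁻¹ ½)) (0≤2⁻ n))
    (solve 1 (λ x → con ½ :* x :+ con ½ :* x := x) refl (2⁻ n))) (2⁻-anti {n = n} ℕ.z≤n)
  2⁻-anti (ℕ.s≤s m≤n) = *-monoˡ-≤ (<⇒≤ (positive⁻¹ ½)) (2⁻-anti m≤n)

  -- From index k on, two terms differ by at most 2 · 2^-k; this 2 is the margin to allow for when a
  -- term stands for ε.
  scaled-regular : ∀ (ε : ℝ) k {m n} → k ℕ.≤ m → k ℕ.≤ n → pow2 k * seq ε m ≤ pow2 k * seq ε n + fromℕ 2
  scaled-regular ε k {m} {n} k≤m k≤n = ≤-trans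
    (≤-reflexive (solve 3 (λ p x y → p :* x := p :* y :+ p :* (x :- y)) refl (pow2 k) (seq ε m) (seq ε n)))
    (+-monoʳ-≤ (pow2 k * seq ε n) (≤-trans
      (*-monoˡ-≤ (0≤fromℕ (2 ℕ.^ k)) (≤-trans (p≤∣p∣ (seq ε m - seq ε n)) (≤-trans (regular ε m n) (+-mono-≤ (2⁻-anti k≤m) (2⁻-anti k≤n)))))
      (≤-reflexive (trans (*-distribˡ-+ (pow2 k) (2⁻ k) (2⁻ k)) (cong₂ _+_ (pow2-2⁻ k) (pow2-2⁻ k))))))

  digits-reach : ∀ ε → const 0ℚ <ℝ seq ε → ∃ λ k → 4 ℕ.≤ digits ε k
  digits-reach ε (j , N , h) = K , ℕ.≮⇒≥ λ few → <-irrefl refl (<-≤-trans (<fromℕ⇐floor (pow2 K * seq ε K) 4 few) large)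
    where
    K : ℕ
    -- K is at least N, where ε is bounded below by 2^-j, and 2^K 2^-j = 2^(N+2) is at least 4.
    K = N ℕ.+ 2 ℕ.+ j
    large : fromℕ 4 ≤ pow2 K * seq ε K
    large = begin
      fromℕ 4                         ≤⟨ fromℕ-mono-≤ (ℕ.≤-trans (ℕ.*-monoˡ-≤ 4 (1≤2^ N)) (ℕ.≤-reflexive (sym (ℕ.^-distribˡ-+-* 2 N 2)))) ⟩
      pow2 (N ℕ.+ 2)                  ≡⟨ *-identityʳ (pow2 (N ℕ.+ 2)) ⟨
      pow2 (N ℕ.+ 2) * 1ℚ             ≡⟨ cong (pow2 (N ℕ.+ 2) *_) (pow2-2⁻ j) ⟨
      pow2 (N ℕ.+ 2) * (pow2 j * 2⁻ j) ≡⟨ *-assoc (pow2 (N ℕ.+ 2)) (pow2 j) (2⁻ j) ⟨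
      pow2 (N ℕ.+ 2) * pow2 j * 2⁻ j  ≡⟨ cong (_* 2⁻ j) (pow2-+ (N ℕ.+ 2) j) ⟨
      pow2 K * 2⁻ j                   ≤⟨ *-monoˡ-≤ (0≤fromℕ (2 ℕ.^ K)) (≤-trans (≤-reflexive (sym (+-identityˡ (2⁻ j)))) (h K (ℕ.≤-trans (ℕ.m≤m+n N 2) (ℕ.m≤m+n (N ℕ.+ 2) j)))) ⟩
      pow2 K * seq ε K                ∎
      where
      open ≤-Reasoning
      1≤2^ : ∀ n → 1 ℕ.≤ 2 ℕ.^ n
      1≤2^ zero    = ℕ.≤-refl
      1≤2^ (suc n) = ℕ.≤-trans (1≤2^ n) (ℕ.m≤m+n (2 ℕ.^ n) _)

  module _ {ε : ℝ} {k : ℕ} where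

    -- The search stops at 4 so that, after the margin 2 is deducted, the 2 needed for 2/D <= ε
    -- remains.
    lower-bound : 4 ℕ.≤ digits ε k → ∀ n → k ℕ.≤ n → fromℕ 2 ≤ pow2 k * seq ε n
    lower-bound many n k≤n = ≤-by-cancel {pow2 k * seq ε n} (≤-trans (fromℕ≤⇐floor (pow2 k * seq ε k) 3 many) (scaled-regular ε k ℕ.≤-refl k≤n))
      where
      ≤-by-cancel : ∀ {x} → fromℕ 4 ≤ x + fromℕ 2 → fromℕ 2 ≤ x
      ≤-by-cancel {x} h = ≤-trans (+-monoˡ-≤ (- fromℕ 2) h)
        (≤-reflexive (solve 1 (λ x → (x :+ con (fromℕ 2)) :- con (fromℕ 2) := x) refl x))

  -- The failed attempt at precision k - 1 leaves 2^(k-1) ε at most 4 + 2, and doubling gives 12. At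
  -- k = 0 nothing has failed, and ε < 1 is used instead.
  upper-bound : ∀ {ε} k → (∀ {j} → j ℕ.< k → digits ε j ℕ.< 4) → seq ε <ℝ const 1ℚ →
    ∃ λ N → ∀ n → N ℕ.≤ n → pow2 k * seq ε n ≤ fromℕ 12
  upper-bound {ε} zero few (j , N , h) = N , λ n N≤n → ≤-trans (≤-reflexive (*-identityˡ (seq ε n)))
    (≤-trans (≤-trans (≤-by-difference (0≤2⁻ j) refl) (h n N≤n)) (fromℕ-mono-≤ {1} {12} (ℕ.s≤s ℕ.z≤n)))
  upper-bound {ε} (suc k) few _ = k , λ n k≤n → begin
    pow2 (suc k) * seq ε n                ≡⟨ cong (_* seq ε n) (pow2-suc k) ⟩
    (pow2 k + pow2 k) * seq ε n           ≡⟨ *-distribʳ-+ (seq ε n) (pow2 k) (pow2 k) ⟩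
    pow2 k * seq ε n + pow2 k * seq ε n   ≤⟨ +-mono-≤ (six n k≤n) (six n k≤n) ⟩
    fromℕ 12                              ∎
    where
    open ≤-Reasoning
    six : ∀ n → k ℕ.≤ n → pow2 k * seq ε n ≤ fromℕ 6
    six n k≤n = ≤-trans (scaled-regular ε k k≤n ℕ.≤-refl) (+-monoˡ-≤ (fromℕ 2) (<⇒≤ (<fromℕ⇐floor (pow2 k * seq ε k) 4 (few ℕ.≤-refl))))

-- Assembling accuracy, support and running time

open HoareLogic
open MinimumWeights
open CoinTossing
open Algorithm
open RationalOrder
open TailBounds using (pow2; sign; module Moments)
open Covering
open SupportSize using (live; live⇒≤r; 0≤2⁻)
open UnionBound
open Precision
open import Data.Bool.Base using (Bool; true; not)
open import Data.Fin.Base using (Fin; zero; suc; toℕ; fromℕ<)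
open import Data.Fin.Properties using (toℕ-fromℕ<; toℕ<n)
open import Data.Fin.Subset using (∣_∣)
open import Data.List.Relation.Unary.All as All using ()
open import Data.Vec.Base using (Vec; toList)
open import Data.Vec.Properties using (lookup∘tabulate; length-toList)
import Data.Integer.Base as ℤ
open import Data.Nat.Base as ℕ using (zero; suc; s≤s; z≤n)
open import Data.Nat.Logarithm using (⌊log₂_⌋; ⌊log₂⌋-mono-≤; ⌊log₂[2^n]⌋≡n)
import Data.Nat.Properties as ℕ
import Data.Nat.Solver as ℕ
open import Data.Product.Base using (∃; _,_; proj₁; proj₂)
open import Data.Rational.Base using (ℚ; ½; _/_; _≤_; _<_; _+_; _*_; _-_; -_)
open import Data.Rational.Properties
open import Data.Rational.Solver using (module +-*-Solver)
open import Data.Sum.Base using (_⊎_; inj₁; inj₂)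
open import Algebra.Properties.CommutativeMonoid.Sum +-0-commutativeMonoid using (sum)
open import Function.Base using (_∘_)
open import Relation.Binary.PropositionalEquality hiding (J)
open import Relation.Nullary using (yes; no; contradiction)
open import Relation.Nullary.Decidable using (⌊_⌋)
open +-*-Solver using (solve; con; _:=_; _:+_; _:*_; _:-_)

sum-fromℕ : ∀ {n} (g : Fin n → ℚ) (f : ℕ → ℕ) → (∀ i → g i ≡ fromℕ (f (toℕ i))) → sum g ≡ fromℕ (∑< n f)
sum-fromℕ {zero}  g f h = refl
sum-fromℕ {suc n} g f h = trans (cong₂ _+_ (h zero) (sum-fromℕ (g ∘ suc) (f ∘ suc) (h ∘ suc)))
  (trans (sym (fromℕ-+ (f 0) (∑< n (f ∘ suc)))) (cong fromℕ (sym (∑<-shift n f))))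

wt≡weight : ∀ {r} (c : Vec Bool r) → wt c ≡ fromℕ (weight c)
wt≡weight c = sum-fromℕ _ (bitAt c) λ i → cong fromℕ (sym (bitAt-lookup c i))

weightedSum≡ : ∀ {r} {w : Fin r → ℚ} {v : ℕ → ℕ} → (∀ i → w i ≡ fromℕ (v (toℕ i))) → ∀ c →
  weightedSum w c ≡ fromℕ (∑< r (λ i → v i ℕ.* bitAt c i))
weightedSum≡ {v = v} w≡ c = sum-fromℕ _ (λ i → v i ℕ.* bitAt c i) λ i →
  trans (cong₂ _*_ (w≡ i) (cong fromℕ (sym (bitAt-lookup c i)))) (sym (fromℕ-* (v (toℕ i)) (bitAt c (toℕ i))))

∣supp∣≤ : ∀ {r} {w : Fin r → ℚ} {v : ℕ → ℕ} → (∀ i → w i ≡ fromℕ (v (toℕ i))) → ∣ supp w ∣ ℕ.≤ ∑< r (sign ∘ v)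
∣supp∣≤ {r} {w} {v} w≡ = ℕ.≤-trans (ℕ.≤-reflexive (sym (weight≡∣∣ (supp w)))) (∑<-mono r below)
  where
  below : ∀ {i} → i ℕ.< r → bitAt (supp w) i ℕ.≤ sign (v i)
  below {i} i<r = ℕ.≤-trans (ℕ.≤-reflexive (trans (cong (bitAt (supp w)) (sym (toℕ-fromℕ< i<r)))
      (trans (bitAt-lookup (supp w) ι) (cong bit (lookup∘tabulate (λ i → not ⌊ w i ≟ 0ℚ ⌋) ι)))))
    (nonzero (v i) (trans (w≡ ι) (cong (fromℕ ∘ v) (toℕ-fromℕ< i<r))))
    where
    ι : Fin r
    ι = fromℕ< i<r
    nonzero : ∀ n → w ι ≡ fromℕ n → bit (not ⌊ w ι ≟ 0ℚ ⌋) ℕ.≤ sign n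
    nonzero n e with w ι ≟ 0ℚ
    nonzero n       e | yes _  = z≤n
    nonzero zero    e | no w≢0 = contradiction e w≢0
    nonzero (suc n) e | no _   = ℕ.≤-refl

output≡ : ∀ {r} s (i : Fin r) {v} → mem s (toℕ i ℕ.+ toℕ i) ≡ v → mem s (toℕ i ℕ.+ toℕ i ℕ.+ 1) ≡ 0 →
  output s i ≡ fromℕ v
output≡ s i {v} e₀ e₁ = cong₂ (λ a b → ℤ.+ a / suc b)
  (trans (cong (mem s) 2i≡) e₀)
  (trans (cong (mem s) (trans (cong suc 2i≡) (ℕ.+-comm 1 _))) e₁)
  where
  2i≡ : 2 ℕ.* toℕ i ≡ toℕ i ℕ.+ toℕ i
  2i≡ = cong (toℕ i ℕ.+_) (ℕ.+-identityʳ (toℕ i))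

n<2^n : ∀ n → n ℕ.< 2 ℕ.^ n
n<2^n zero    = s≤s z≤n
n<2^n (suc n) = ℕ.≤-trans (s≤s (n<2^n n)) (ℕ.+-mono-≤ (2^n≥1 n) (ℕ.≤-reflexive (sym (ℕ.+-identityʳ (2 ℕ.^ n)))))

doublings : ∀ {V} → 1 ℕ.≤ V → ∀ m → ∃ (Doublings V m)
doublings {V} V≥1 m = let (n , above , below) = least (λ n → m ℕ.<? V ℕ.* 2 ℕ.^ n) m
                            (ℕ.<-≤-trans (n<2^n m) (ℕ.≤-trans (ℕ.≤-reflexive (sym (ℕ.*-identityˡ _))) (ℕ.*-monoˡ-≤ (2 ℕ.^ m) V≥1))) in
  n , record { above = above ; below = λ j<n → ℕ.≮⇒≥ (below j<n) }

-- V >= 2 pays for the last doubling, which `below` does not reach.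
2^doublings≤ : ∀ {V m n} → 2 ℕ.≤ V → Doublings V m (suc n) → 2 ℕ.^ suc n ℕ.≤ m
2^doublings≤ {n = n} V≥2 d = ℕ.≤-trans (ℕ.*-monoˡ-≤ (2 ℕ.^ n) V≥2) (Doublings.below d ℕ.≤-refl)

least-power≤ : ∀ {N ℓ} → IsLeast (λ j → N ℕ.≤ 2 ℕ.^ j) ℓ → ℓ ℕ.≤ N × ℓ ℕ.≤ suc ⌊log₂ N ⌋
least-power≤ {N} {zero}  _ = z≤n , z≤n
least-power≤ {N} {suc ℓ} (_ , below) =
  ℕ.≤-trans (n<2^n ℓ) 2^ℓ≤N , s≤s (ℕ.≤-trans (ℕ.≤-reflexive (sym (⌊log₂[2^n]⌋≡n ℓ))) (⌊log₂⌋-mono-≤ 2^ℓ≤N))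
  where
  2^ℓ≤N : 2 ℕ.^ ℓ ℕ.≤ N
  2^ℓ≤N = ℕ.<⇒≤ (ℕ.≰⇒> (below ℕ.≤-refl))

module _ {r N k ℓ t X : ℕ} (r≤ : r ℕ.≤ X) (N≤ : N ℕ.≤ X) (k≤ : k ℕ.≤ 24 ℕ.* X) (ℓ≤ : ℓ ℕ.≤ X) (t≤ : t ℕ.≤ X) (X≥1 : 1 ℕ.≤ X) where
  open ℕ.≤-Reasoning
  open ℕ.+-*-Solver renaming (solve to solveℕ; con to conℕ; _:+_ to _⊕_; _:*_ to _⊗_; _:=_ to _≐_) hiding (_:-_)

  program-cost-≤ : program-cost r N k ℓ t ℕ.≤ 785 ℕ.* X ℕ.^ 3
  program-cost-≤ = begin
    program-cost r N k ℓ t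
      ≤⟨ ℕ.+-mono-≤ (ℕ.+-monoʳ-≤ 6 (ℕ.*-mono-≤ k≤ (ℕ.+-monoʳ-≤ 6 k≤)))
         (ℕ.+-mono-≤ (ℕ.+-monoʳ-≤ 5 (ℕ.*-monoˡ-≤ 4 ℓ≤))
         (ℕ.+-mono-≤ (ℕ.+-monoʳ-≤ 2 (ℕ.*-mono-≤ r≤ (ℕ.+-monoʳ-≤ 6 (s≤s (ℕ.+-monoˡ-≤ 3 (ℕ.*-mono-≤ N≤ (ℕ.+-monoʳ-≤ 5 (ℕ.+-monoˡ-≤ 6 (ℕ.*-monoˡ-≤ 5 r≤)))))))))
           (ℕ.+-monoʳ-≤ 2 (ℕ.*-mono-≤ r≤ (ℕ.+-monoʳ-≤ 9 (s≤s (ℕ.+-monoˡ-≤ 4 (ℕ.*-monoˡ-≤ 6 t≤)))))))) ⟩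
    6 ℕ.+ 24 ℕ.* X ℕ.* (6 ℕ.+ 24 ℕ.* X) ℕ.+ (5 ℕ.+ X ℕ.* 4 ℕ.+
      (2 ℕ.+ X ℕ.* (6 ℕ.+ suc (X ℕ.* (5 ℕ.+ (X ℕ.* 5 ℕ.+ 6)) ℕ.+ 3)) ℕ.+ (2 ℕ.+ X ℕ.* (9 ℕ.+ suc (X ℕ.* 6 ℕ.+ 4)))))
      ≡⟨ solveℕ 1 (λ X → conℕ 6 ⊕ conℕ 24 ⊗ X ⊗ (conℕ 6 ⊕ conℕ 24 ⊗ X) ⊕ (conℕ 5 ⊕ X ⊗ conℕ 4 ⊕
           (conℕ 2 ⊕ X ⊗ (conℕ 7 ⊕ (X ⊗ (conℕ 5 ⊕ (X ⊗ conℕ 5 ⊕ conℕ 6)) ⊕ conℕ 3)) ⊕ (conℕ 2 ⊕ X ⊗ (conℕ 10 ⊕ (X ⊗ conℕ 6 ⊕ conℕ 4)))))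
           ≐ conℕ 15 ⊕ (conℕ 172 ⊗ X ⊕ (conℕ 593 ⊗ (X ⊗ X) ⊕ conℕ 5 ⊗ (X ⊗ X ⊗ X)))) refl X ⟩
    -- All powers of X are replaced by X³, so 785 is the sum of the coefficients. Of it, 576 = 24²
    -- comes from trying up to k precisions, each at a cost linear in k.
    15 ℕ.+ (172 ℕ.* X ℕ.+ (593 ℕ.* (X ℕ.* X) ℕ.+ 5 ℕ.* X³))
      ≤⟨ ℕ.+-mono-≤ (ℕ.*-monoʳ-≤ 15 1≤X³) (ℕ.+-mono-≤ (ℕ.*-monoʳ-≤ 172 X≤X³) (ℕ.+-monoˡ-≤ (5 ℕ.* X³) (ℕ.*-monoʳ-≤ 593 X²≤X³))) ⟩
    15 ℕ.* X³ ℕ.+ (172 ℕ.* X³ ℕ.+ (593 ℕ.* X³ ℕ.+ 5 ℕ.* X³))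
      ≡⟨ solveℕ 1 (λ X → conℕ 15 ⊗ (X ⊗ X ⊗ X) ⊕ (conℕ 172 ⊗ (X ⊗ X ⊗ X) ⊕ (conℕ 593 ⊗ (X ⊗ X ⊗ X) ⊕ conℕ 5 ⊗ (X ⊗ X ⊗ X)))
           ≐ conℕ 785 ⊗ (X ⊗ (X ⊗ (X ⊗ conℕ 1)))) refl X ⟩
    785 ℕ.* X ℕ.^ 3 ∎
    where
    X³ : ℕ
    X³ = X ℕ.* X ℕ.* X
    X²≤X³ : X ℕ.* X ℕ.≤ X³
    X²≤X³ = ℕ.≤-trans (ℕ.≤-reflexive (sym (ℕ.*-identityʳ (X ℕ.* X)))) (ℕ.*-monoʳ-≤ (X ℕ.* X) X≥1)
    X≤X³ : X ℕ.≤ X³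
    X≤X³ = ℕ.≤-trans (ℕ.≤-trans (ℕ.≤-reflexive (sym (ℕ.*-identityʳ X))) (ℕ.*-monoʳ-≤ X X≥1)) X²≤X³
    1≤X³ : 1 ℕ.≤ X³
    1≤X³ = ℕ.≤-trans X≥1 X≤X³

module _ {k W S : ℕ} {e : ℚ} where

  private
    D : ℕ
    D = 2 ℕ.^ k

    d w s : ℚ
    d = fromℕ D
    w = fromℕ W
    s = fromℕ S

    0<d : 0ℚ < d
    0<d = fromℕ-mono-< (2^n≥1 k)

  scaled-upper : fromℕ 2 ≤ d * e → D ℕ.* S ℕ.≤ suc D ℕ.* W ℕ.+ W → s ≤ (1ℚ + e) * w
  scaled-upper 2≤de h = *-cancelˡ-≤ 0<d (begin
    d * s                  ≡⟨ fromℕ-* D S ⟨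
    fromℕ (D ℕ.* S)        ≤⟨ fromℕ-mono-≤ h ⟩
    fromℕ (suc D ℕ.* W ℕ.+ W) ≡⟨ cong fromℕ (ℕ.+-comm (W ℕ.+ D ℕ.* W) W) ⟩
    fromℕ (W ℕ.+ (W ℕ.+ D ℕ.* W)) ≡⟨ trans (fromℕ-+ W (W ℕ.+ D ℕ.* W)) (cong (w +_) (trans (fromℕ-+ W (D ℕ.* W)) (cong (w +_) (fromℕ-* D W)))) ⟩
    w + (w + d * w)        ≡⟨ solve 2 (λ d w → w :+ (w :+ d :* w) := d :* w :+ con (fromℕ 2) :* w) refl d w ⟩
    d * w + fromℕ 2 * w    ≤⟨ +-monoʳ-≤ (d * w) (*-monoʳ-≤ (0≤fromℕ W) 2≤de) ⟩
    d * w + d * e * w      ≡⟨ solve 3 (λ d e w → d :* w :+ d :* e :* w := d :* ((con 1ℚ :+ e) :* w)) refl d e w ⟩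
    d * ((1ℚ + e) * w)     ∎)
    where open ≤-Reasoning

  scaled-lower : fromℕ 2 ≤ d * e → (D ℕ.∸ 1) ℕ.* W ℕ.≤ D ℕ.* S ℕ.+ W → (1ℚ - e) * w ≤ s
  scaled-lower 2≤de h = *-cancelˡ-≤ 0<d (begin
    d * ((1ℚ - e) * w)     ≡⟨ solve 3 (λ d e w → d :* ((con 1ℚ :- e) :* w) := d :* w :- d :* e :* w) refl d e w ⟩
    d * w - d * e * w      ≤⟨ +-monoʳ-≤ (d * w) (neg-antimono-≤ (*-monoʳ-≤ (0≤fromℕ W) 2≤de)) ⟩
    d * w - fromℕ 2 * w    ≤⟨ +-monoˡ-≤ (- (fromℕ 2 * w)) dw≤ ⟩
    (d * s + w + w) - fromℕ 2 * w ≡⟨ solve 3 (λ d s w → (d :* s :+ w :+ w) :- con (fromℕ 2) :* w := d :* s) refl d s w ⟩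
    d * s                  ∎)
    where
    open ≤-Reasoning
    dw≤ : d * w ≤ d * s + w + w
    dw≤ = begin
      d * w                  ≡⟨ fromℕ-* D W ⟨
      fromℕ (D ℕ.* W)        ≡⟨ cong (λ D → fromℕ (D ℕ.* W)) (ℕ.m∸n+n≡m (2^n≥1 k)) ⟨
      fromℕ ((D ℕ.∸ 1 ℕ.+ 1) ℕ.* W) ≡⟨ cong fromℕ (trans (ℕ.*-distribʳ-+ W (D ℕ.∸ 1) 1) (cong ((D ℕ.∸ 1) ℕ.* W ℕ.+_) (ℕ.*-identityˡ W))) ⟩
      fromℕ ((D ℕ.∸ 1) ℕ.* W ℕ.+ W) ≤⟨ fromℕ-mono-≤ (ℕ.+-monoˡ-≤ W h) ⟩
      fromℕ (D ℕ.* S ℕ.+ W ℕ.+ W) ≡⟨ trans (fromℕ-+ (D ℕ.* S ℕ.+ W) W) (cong (_+ w) (trans (fromℕ-+ (D ℕ.* S) W) (cong (_+ w) (fromℕ-* D S)))) ⟩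
      d * s + w + w          ∎

-- 6 · 2 · 6 · 4 · 144: the factor in Markov's inequality, J <= 2 log r, L <= 6 log |C|, the spare 4
-- in 4^(k+1), and (2^k ε)² <= 12².
supportConstant : ℕ
supportConstant = 41472

scaled-support : ∀ {k s J L R a b e} → s ℕ.≤ 6 ℕ.* (J ℕ.* (L ℕ.* 4 ℕ.^ suc k ℕ.* R)) →
  J ℕ.≤ 2 ℕ.* b → L ℕ.≤ 6 ℕ.* a → 0ℚ ≤ e → pow2 k * e ≤ fromℕ 12 →
  fromℕ s * (e * e) ≤ fromℕ (supportConstant ℕ.* (R ℕ.* (a ℕ.* b)))
scaled-support {k} {s} {J} {L} {R} {a} {b} {e} s≤ J≤ L≤ 0≤e de≤ = begin
  fromℕ s * (e * e)                 ≤⟨ *-monoʳ-≤ (*-nonNeg 0≤e 0≤e) (fromℕ-mono-≤ s≤B) ⟩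
  fromℕ (B ℕ.* (D ℕ.* D)) * (e * e) ≡⟨ cong (_* (e * e)) (trans (fromℕ-* B (D ℕ.* D)) (cong (fromℕ B *_) (fromℕ-* D D))) ⟩
  fromℕ B * (d * d) * (e * e)       ≡⟨ solve 3 (λ b d e → b :* (d :* d) :* (e :* e) := b :* (d :* e :* (d :* e))) refl (fromℕ B) d e ⟩
  fromℕ B * (d * e * (d * e))       ≤⟨ *-monoˡ-≤ (0≤fromℕ B) (≤-trans (*-monoʳ-≤ (*-nonNeg (0≤fromℕ D) 0≤e) de≤) (*-monoˡ-≤ (0≤fromℕ 12) de≤)) ⟩
  fromℕ B * (fromℕ 12 * fromℕ 12)   ≡⟨ fromℕ-* B 144 ⟨
  fromℕ (B ℕ.* 144)                 ≤⟨ fromℕ-mono-≤ B≤ ⟩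
  fromℕ (supportConstant ℕ.* (R ℕ.* (a ℕ.* b))) ∎
  where
  open ≤-Reasoning
  open ℕ.+-*-Solver renaming (solve to solveℕ; con to conℕ; _:*_ to _⊗_; _:=_ to _≐_) using ()
  D B : ℕ
  D = 2 ℕ.^ k
  B = 24 ℕ.* J ℕ.* L ℕ.* R
  d : ℚ
  d = fromℕ D
  s≤B : s ℕ.≤ B ℕ.* (D ℕ.* D)
  s≤B = ℕ.≤-trans s≤ (ℕ.≤-reflexive (trans
    (solveℕ 4 (λ J L R q → conℕ 6 ⊗ (J ⊗ (L ⊗ (conℕ 4 ⊗ q) ⊗ R)) ≐ conℕ 24 ⊗ J ⊗ L ⊗ R ⊗ q) refl J L R (4 ℕ.^ k))
    (cong (B ℕ.*_) (sym (squared k)))))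
  B≤ : B ℕ.* 144 ℕ.≤ supportConstant ℕ.* (R ℕ.* (a ℕ.* b))
  B≤ = ℕ.≤-trans (ℕ.*-monoˡ-≤ 144 (ℕ.*-monoˡ-≤ R (ℕ.*-mono-≤ (ℕ.*-monoʳ-≤ 24 J≤) L≤)))
    (ℕ.≤-reflexive (solveℕ 3 (λ a b R → conℕ 24 ⊗ (conℕ 2 ⊗ b) ⊗ (conℕ 6 ⊗ a) ⊗ R ⊗ conℕ 144 ≐ conℕ 41472 ⊗ (R ⊗ (a ⊗ b))) refl a b R))

-- The real inequality 1 <= n ε is used only up to an error 1/2, hence 24 instead of 12.
precision≤ : ∀ {ε k} n → (∃ λ N → ∀ j → N ℕ.≤ j → pow2 k * seq ε j ≤ fromℕ 12) →
  const 1ℚ ≤ℝ const (fromℕ n) *ℝ seq ε → 2 ℕ.^ k ℕ.≤ 24 ℕ.* n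
precision≤ {ε} {k} n (N , upper) inverse with inverse 1
... | N′ , inverse′ = fromℕ-cancel-≤ (begin
  d                        ≡⟨ solve 1 (λ d → d := con (fromℕ 2) :* (d :* con 1ℚ :- d :* con ½)) refl d ⟩
  fromℕ 2 * (d * 1ℚ - d * ½) ≤⟨ *-monoˡ-≤ (0≤fromℕ 2) (≤-trans (+-monoˡ-≤ (- (d * ½)) (*-monoˡ-≤ (0≤fromℕ D) (inverse′ j (ℕ.m≤n+m N′ N))))
       (≤-reflexive (solve 3 (λ d n e → d :* (n :* e :+ con ½) :- d :* con ½ := n :* (d :* e)) refl d (fromℕ n) e))) ⟩
  fromℕ 2 * (fromℕ n * (d * e)) ≤⟨ *-monoˡ-≤ (0≤fromℕ 2) (*-monoˡ-≤ (0≤fromℕ n) (upper j (ℕ.m≤m+n N N′))) ⟩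
  fromℕ 2 * (fromℕ n * fromℕ 12) ≡⟨ solve 1 (λ n → con (fromℕ 2) :* (n :* con (fromℕ 12)) := con (fromℕ 24) :* n) refl (fromℕ n) ⟩
  fromℕ 24 * fromℕ n       ≡⟨ fromℕ-* 24 n ⟨
  fromℕ (24 ℕ.* n)         ∎)
  where
  open ≤-Reasoning
  j D : ℕ
  j = N ℕ.+ N′
  D = 2 ℕ.^ k
  d e : ℚ
  d = fromℕ D
  e = seq ε j

eventually-≤ : ∀ {x y : Seq} → (∃ λ N → ∀ n → N ℕ.≤ n → x n ≤ y n) → x ≤ℝ y
eventually-≤ (N , h) j = N , λ n N≤n → ≤-trans (h n N≤n) (≤-by-difference (0≤2⁻ j) refl)

log₁-bound : ∀ n → suc ⌊log₂ n ⌋ ℕ.≤ 2 ℕ.* log₁ n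
log₁-bound n = ℕ.+-mono-≤ (ℕ.m≤m⊔n 1 ⌊log₂ n ⌋) (ℕ.≤-trans (ℕ.m≤n⊔m 1 ⌊log₂ n ⌋) (ℕ.m≤m+n (log₁ n) 0))

module Correctness {r : ℕ} (C : Code r) (ε : ℝ) (0<ε : const 0ℚ <ℝ seq ε) (ε<1 : seq ε <ℝ const 1ℚ)
  {k ℓ : ℕ} (k-least : IsLeast (λ j → 4 ℕ.≤ digits ε j) k) (ℓ-least : IsLeast (λ j → size C ℕ.≤ 2 ℕ.^ j) ℓ)
  (t : ℕ → ℕ) (t-doublings : ∀ i → Doublings ((4 ℕ.+ ℓ) ℕ.* 4 ℕ.^ suc k) (minWeight (words C) i) (t i)) where

  w₀ : ℕ → ℕ
  w₀ i = 1 ℕ.∸ (minWeight (words C) i ℕ.∸ r)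

  open Sampler t w₀
  open Moments t w₀

  V J : ℕ
  V = (4 ℕ.+ ℓ) ℕ.* 4 ℕ.^ suc k
  J = suc ⌊log₂ r ⌋

  V≥2 : 2 ℕ.≤ V
  V≥2 = ℕ.*-mono-≤ {2} {4 ℕ.+ ℓ} (s≤s (s≤s z≤n)) (ℕ.≤-trans (ℕ.*-mono-≤ (2^n≥1 (suc k)) (2^n≥1 (suc k))) (ℕ.≤-reflexive (squared (suc k))))

  -- Coins are spent on coordinates in no word as well, where mᵢ = r + 1; t < 2^t <= r + 1 includes
  -- them.
  t≤r : ∀ {i} → i ℕ.< r → t i ℕ.≤ r
  t≤r {i} _ with t i | t-doublings i
  ... | zero  | _ = z≤n
  ... | suc n | d = ℕ.≤-pred (ℕ.≤-trans (n<2^n (suc n)) (ℕ.≤-trans (2^doublings≤ V≥2 d) (lightest≤ (suc r) (words C) i)))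

  -- Here, unlike for `t≤r`, the marker value is excluded: a live coordinate has mᵢ <= r, so 2^tᵢ <=
  -- r as soon as a coin is tossed.
  levels : ∀ {i} → i ℕ.< r → live t w₀ i ≡ 0 ⊎ t i ℕ.< J
  levels {i} _ with live t w₀ i ℕ.≟ 0
  ... | yes e = inj₁ e
  ... | no ≢0 = inj₂ (bound (t i) (t-doublings i))
    where
    bound : ∀ n → Doublings V (minWeight (words C) i) n → n ℕ.< J
    bound zero    _ = s≤s z≤n
    bound (suc n) d = s≤s (ℕ.≤-trans (ℕ.≤-reflexive (sym (⌊log₂[2^n]⌋≡n (suc n))))
      (⌊log₂⌋-mono-≤ (ℕ.≤-trans (2^doublings≤ V≥2 d) (live⇒≤r C t (λ {i} _ → t-doublings i) ≢0))))

  open Bands C k ℓ (proj₁ ℓ-least) t (λ {i} _ → t-doublings i)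
  open Union J levels

  upper : ∃ λ N → ∀ n → N ℕ.≤ n → pow2 k * seq ε n ≤ fromℕ 12
  upper = upper-bound {ε} k (λ j<k → ℕ.≰⇒> (proj₂ k-least j<k)) ε<1

  correct : ∀ {cs} {w : Fin r → ℚ} → (∀ i → w i ≡ fromℕ (sampled r cs (toℕ i))) →
    good (words C) cs ≡ true →
    IsSparsifier ε C w × SmallSupport supportConstant ε C w
  correct {cs} {w} w≡ is-good = record
    { nonneg = λ i → ≤-trans (0≤fromℕ (sampled r cs (toℕ i))) (≤-reflexive (sym (w≡ i)))
    ; lower = All.tabulate λ {c} c∈ → eventually-≤ (k , λ n k≤n →
        ≤-trans (≤-reflexive (cong ((1ℚ - seq ε n) *_) (wt≡weight c)))
        (≤-trans (scaled-lower {k} {weight c} {S c} (precise n k≤n) (proj₂ (accurate c∈))) (≤-reflexive (sym (total c)))))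
    ; upper = All.tabulate λ {c} c∈ → eventually-≤ (k , λ n k≤n →
        ≤-trans (≤-reflexive (total c))
        (≤-trans (scaled-upper {k} {weight c} {S c} (precise n k≤n) (proj₁ (accurate c∈)))
          (≤-reflexive (cong ((1ℚ + seq ε n) *_) (sym (wt≡weight c))))))
    } , eventually-≤ (N ℕ.+ N′ , λ n N≤n → scaled-support {k} {J = J} {4 ℕ.+ ℓ} {NRD C} {log₁ (size C)} {log₁ r}
      (ℕ.≤-trans (∣supp∣≤ {v = sampled r cs} w≡) (ℕ.≤-trans (ℕ.≤-reflexive (sym (statistic-sampled (λ _ → sign) r cs)))
        (good-small (words C) is-good)))
      (log₁-bound r) L≤ (≤-trans (≤-trans (0≤2⁻ j) (≤-reflexive (sym (+-identityˡ (2⁻ j))))) (positive-ε n (ℕ.≤-trans (ℕ.m≤n+m N′ N) N≤n)))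
      (proj₂ upper n (ℕ.≤-trans (ℕ.m≤m+n N N′) N≤n)))
    where
    j N N′ : ℕ
    j = proj₁ 0<ε
    N = proj₁ upper
    N′ = proj₁ (proj₂ 0<ε)
    positive-ε : ∀ n → N′ ℕ.≤ n → 0ℚ + 2⁻ j ≤ seq ε n
    positive-ε = proj₂ (proj₂ 0<ε)
    S : Vec Bool r → ℕ
    S c = statistic (λ i v → v ℕ.* bitAt c i) r cs
    precise : ∀ n → k ℕ.≤ n → fromℕ 2 ≤ pow2 k * seq ε n
    precise = lower-bound {ε} {k} (proj₁ k-least)
    accurate = λ {c} → good-accurate (words C) {cs} {c} is-good
    total : ∀ c → weightedSum w c ≡ fromℕ (S c)
    total c = trans (weightedSum≡ {v = sampled r cs} w≡ c) (cong fromℕ (sym (statistic-sampled (λ i v → v ℕ.* bitAt c i) r cs)))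
    L≤ : 4 ℕ.+ ℓ ℕ.≤ 6 ℕ.* log₁ (size C)
    L≤ = ℕ.≤-trans (ℕ.+-monoʳ-≤ 4 (ℕ.≤-trans (proj₂ (least-power≤ ℓ-least)) (log₁-bound (size C))))
      (ℕ.≤-trans (ℕ.+-monoˡ-≤ (2 ℕ.* log₁ (size C)) (ℕ.*-monoʳ-≤ 4 (ℕ.m≤m⊔n 1 ⌊log₂ size C ⌋)))
        (ℕ.≤-reflexive (sym (ℕ.*-distribʳ-+ (log₁ (size C)) 4 2))))

  fast : PolyTime 785 3 C ε (program-cost r (size C) k ℓ r)
  fast n inverse = program-cost-≤ r≤ N≤
    (ℕ.≤-trans (ℕ.<⇒≤ (n<2^n k)) (ℕ.≤-trans (precision≤ {ε} {k} n upper inverse) (ℕ.*-monoʳ-≤ 24 (ℕ.m≤n+m n (r ℕ.+ size C)))))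
    (ℕ.≤-trans (proj₁ (least-power≤ ℓ-least)) N≤) r≤ (ℕ.≤-trans (size≥1 C) N≤)
    where
    r≤ : r ℕ.≤ r ℕ.+ size C ℕ.+ n
    r≤ = ℕ.≤-trans (ℕ.m≤m+n r (size C)) (ℕ.m≤m+n (r ℕ.+ size C) n)
    N≤ : size C ℕ.≤ r ℕ.+ size C ℕ.+ n
    N≤ = ℕ.≤-trans (ℕ.m≤n+m (size C) r) (ℕ.m≤m+n (r ℕ.+ size C) n)

  computes : Computes program C ε (PolyTime 785 3 C ε) (λ w → IsSparsifier ε C w × SmallSupport supportConstant ε C w)
  computes = need r , good (words C) ∘ toList ,
    good-likely ,
    λ ω → runs ω (program-run C k-least ℓ-least t r t≤r (λ {i} _ → t-doublings i) (toList ω) (length-toList ω))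
    where
    runs : ∀ (ω : Vec Bool (need r)) →
      Terminates ε program (initial C (toList ω)) (program-cost r (size C) k ℓ r)
        (λ s → ∀ {i} → i ℕ.< r → mem s (i ℕ.+ i) ≡ sampled r (toList ω) i × mem s (i ℕ.+ i ℕ.+ 1) ≡ 0) → _
    runs ω (terminates {time} {final} run bound post) = time , final , run , (λ n inverse → ℕ.≤-trans bound (fast n inverse)) ,
      correct {toList ω} (λ i → output≡ final i (proj₁ (post (toℕ<n i))) (proj₂ (post (toℕ<n i))))

theorem1p11 : ∃[ P ] ∃[ K ] ∃[ a ] ∃[ e ]
    (∀ (r : ℕ) (C : Code r) (ε : ℝ) →
    const 0ℚ <ℝ seq ε → seq ε <ℝ const 1ℚ →
    Computes P C ε (PolyTime a e C ε)
    (λ w → IsSparsifier ε C w × SmallSupport K ε C w))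
theorem1p11 = program , supportConstant , 785 , 3 , λ r C ε 0<ε ε<1 →
  -- Positivity of ε supplies one sufficient precision, which bounds the search for the least; the
  -- program finds the least by itself.
  let (K , reached) = digits-reach ε 0<ε
      (k , k-least) = least (λ j → 4 ℕ.≤? digits ε j) K reached
      (ℓ , ℓ-least) = least (λ j → size C ℕ.≤? 2 ℕ.^ j) (size C) (ℕ.<⇒≤ (n<2^n (size C)))
      V≥1 = ℕ.*-mono-≤ {1} {4 ℕ.+ ℓ} (s≤s z≤n) (ℕ.≤-trans (ℕ.*-mono-≤ (2^n≥1 (suc k)) (2^n≥1 (suc k))) (ℕ.≤-reflexive (squared (suc k))))
      t = λ i → doublings V≥1 (minWeight (words C) i)
  in Correctness.computes C ε 0<ε ε<1 k-least ℓ-least (proj₁ ∘ t) (proj₂ ∘ t)
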